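{- Let $\Sigma$ be a ranked alphabet and $k\ge1$. A tree language $L\subseteq T_\Sigma$ is accepted by some deterministic $k$-head tree-walking automaton with nested pebbles if and only if $L=\{t\in T_\Sigma\mid t\models\phi\}$ for some closed formula $\phi$ of FO+DTC$^k$ over $\Sigma$. That is, $\mathrm{DPTWA}^k=\mathrm{FO{+}DTC}^k$.
   Context: Trees: a ranked alphabet is a finite set $\Sigma$ with a map $\mathrm{rank}:\Sigma\to\mathbb{N}$; $T_\Sigma$ is the set of trees over $\Sigma$, where a node labelled $\sigma$ has exactly $\mathrm{rank}(\sigma)$ children numbered $1,\dots,\mathrm{rank}(\sigma)$ (child number of the root is $0$). Strings are the special case of monadic trees. Logic: first-order logic over $\Sigma$ has node variables, atomic formulas $\mathrm{lab}_\sigma(x)$, $\mathrm{edg}_i(x,y)$ ($y$ is the $i$-th child of $x$), $x\le y$ ($x$ is an ancestor of $y$), $x=y$, and is closed under $\neg,\wedge,\vee,\exists,\forall$. $k$-ary transitive closure: for a formula $\phi$ with $k$-tuples $\bar x,\bar y$ of distinct free variables (other free variables fixed), $t\models\phi^*(\bar u,\bar v)$ iff there are $k$-tuples of nodes $\bar u_0=\bar u,\dots,\bar u_n=\bar v$ ($n\ge0$) with $t\models\phi(\bar u_i,\bar u_{i+1})$ for all $i<n$. It is deterministic if $\phi$ is functional: for every tree, every valuation of the other free variables and every $\bar u$ there is at most one $\bar v$ with $\phi(\bar u,\bar v)$. FO+DTC$^k$ is first-order logic extended with $k$-ary deterministic transitive closure. Automata: a $k$-head tree-walking automaton with nested pebbles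 is $\mathcal A=(Q,\Sigma,X,q_0,A,I)$: finite states $Q$, finite pebble set $X$, initial state $q_0$, accepting states $A$, finite set $I$ of instructions $\langle p,\chi,q\rangle$ with $\chi$ one of $\mathrm{up}_i$, $\mathrm{down}_{i,j}$, $\mathrm{drop}_i(x)$, $\mathrm{retrieve}(x)$, $\mathrm{lab}_{i,\sigma}$, $\mathrm{peb}_i(x)$, $\mathrm{chno}_{i,j}$ or a negated test $\neg\mathrm{lab}_{i,\sigma}$, $\neg\mathrm{peb}_i(x)$, $\neg\mathrm{chno}_{i,j}$ ($1\le i\le k$ a head, $x\in X$). Configurations: $[p,\bar u,\alpha]$ with state, $k$-tuple of head nodes, and stack $\alpha$ of (pebble,node) pairs. Semantics: $\mathrm{up}_i$/$\mathrm{down}_{i,j}$ move head $i$ to the parent/$j$-th child; $\mathrm{drop}_i(x)$ pushes $(x,u[i])$ if $x$ is not on the stack; $\mathrm{retrieve}(x)$ pops the top pair if its pebble is $x$, regardless of head positions; tests check the label of $u[i]$, the presence of $(x,u[i])$ on the stack, or the child number of $u[i]$ (negated tests succeed iff the test fails) and change nothing. A configuration is halting if no instruction applies. $t\in L(\mathcal A)$ iff from $[q_0,\overline{\mathrm{root}},\varepsilon]$ a halting configuration $[p,\overline{\mathrm{root}},\varepsilon]$ with $p\in A$ is reachable. $\mathcal A$ is deterministic if for any two distinct instructions from the same state, with tests/operations $\chi_1,\chi_2$, $\chi_1=\neg\chi_2$ or $\chi_2=\neg\chi_1$. -}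

module Defs where

open import Data.Nat using (ℕ; zero; suc; _+_)
open import Data.Fin using (Fin; zero; suc; toℕ; splitAt)
open import Data.Fin.Subset using (Subset; _∈_)
open import Data.Vec using (Vec; lookup; tabulate; replicate; _[_]≔_)
open import Data.List using (List; []; _∷_)
import Data.List.Membership.Propositional as LM
open import Data.List.Relation.Unary.Any using (Any)
open import Data.Product using (Σ; _×_; _,_; proj₁; ∃)
open import Data.Sum using (_⊎_; [_,_])
open import Data.Empty using (⊥)
open import Relation.Nullary using (¬_)
open import Relation.Binary.PropositionalEquality using (_≡_; _≢_)
open import Relation.Binary.Construct.Closure.ReflexiveTransitive using (Star)
open import Function using (_∘_; _⇔_)

record RankedAlphabet : Set where
  field
    size : ℕ
    rank : Fin size → ℕ

  Sym : Set
  Sym = Fin size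

open RankedAlphabet public

module _ (Sig : RankedAlphabet) where

  data Tree : Set where
    node : (σ : Sym Sig) → (Fin (rank Sig σ) → Tree) → Tree

  -- Nodes of a tree t (addresses): the root, or a node inside the
  -- subtree of the j-th child (child numbers j are 0-based in Fin,
  -- corresponding to child number toℕ j + 1 in the paper).
  data Node : Tree → Set where
    root  : ∀ {t} → Node t
    there : ∀ {σ ts} (j : Fin (rank Sig σ)) → Node (ts j) → Node (node σ ts)

  label : {t : Tree} → Node t → Sym Sig
  label {node σ ts} root = σ
  label (there j x) = label x

  data Edge : {t : Tree} → ℕ → Node t → Node t → Set where
    edge-root  : ∀ {σ ts} (j : Fin (rank Sig σ)) →
                 Edge {node σ ts} (suc (toℕ j)) root (there j root)
    edge-there : ∀ {σ ts i} (j : Fin (rank Sig σ)) {x y : Node (ts j)} →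
                 Edge i x y → Edge {node σ ts} i (there j x) (there j y)

  data Anc : {t : Tree} → Node t → Node t → Set where
    anc-root  : ∀ {t} {y : Node t} → Anc root y
    anc-there : ∀ {σ ts} (j : Fin (rank Sig σ)) {x y : Node (ts j)} →
                Anc x y → Anc {node σ ts} (there j x) (there j y)

  childNo′ : {t : Tree} → ℕ → Node t → ℕ
  childNo′ c root = c
  childNo′ c (there j x) = childNo′ (suc (toℕ j)) x

  childNo : {t : Tree} → Node t → ℕ
  childNo = childNo′ 0

  data Formula (k : ℕ) : ℕ → Set where
    lab  : ∀ {m} → Sym Sig → Fin m → Formula k m
    edg  : ∀ {m} → ℕ → Fin m → Fin m → Formula k m
    leq  : ∀ {m} → Fin m → Fin m → Formula k m
    eq   : ∀ {m} → Fin m → Fin m → Formula k m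
    neg  : ∀ {m} → Formula k m → Formula k m
    and  : ∀ {m} → Formula k m → Formula k m → Formula k m
    or   : ∀ {m} → Formula k m → Formula k m → Formula k m
    ex   : ∀ {m} → Formula k (suc m) → Formula k m
    all  : ∀ {m} → Formula k (suc m) → Formula k m
    -- tc φ ū v̄ = φ*(ū, v̄), where φ has free variables
    -- x̄ (first k), ȳ (next k) and the m outer variables (parameters).
    tc   : ∀ {m} → Formula k (k + (k + m)) →
           (Fin k → Fin m) → (Fin k → Fin m) → Formula k m

  _∷ₑ_ : {A : Set} {m : ℕ} → A → (Fin m → A) → Fin (suc m) → A
  (a ∷ₑ ρ) zero = a
  (a ∷ₑ ρ) (suc i) = ρ i

  _++ₑ_ : {A : Set} {k m : ℕ} → Vec A k → (Fin m → A) → Fin (k + m) → A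
  _++ₑ_ {k = k} xs ρ i = [ lookup xs , ρ ] (splitAt k i)

  ⟦_⟧ : ∀ {k m} → Formula k m → (t : Tree) → (Fin m → Node t) → Set
  ⟦ lab σ x ⟧ t ρ = label (ρ x) ≡ σ
  ⟦ edg i x y ⟧ t ρ = Edge i (ρ x) (ρ y)
  ⟦ leq x y ⟧ t ρ = Anc (ρ x) (ρ y)
  ⟦ eq x y ⟧ t ρ = ρ x ≡ ρ y
  ⟦ neg φ ⟧ t ρ = ¬ ⟦ φ ⟧ t ρ
  ⟦ and φ ψ ⟧ t ρ = ⟦ φ ⟧ t ρ × ⟦ ψ ⟧ t ρ
  ⟦ or φ ψ ⟧ t ρ = ⟦ φ ⟧ t ρ ⊎ ⟦ ψ ⟧ t ρ
  ⟦ ex φ ⟧ t ρ = Σ (Node t) λ v → ⟦ φ ⟧ t (v ∷ₑ ρ)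
  ⟦ all φ ⟧ t ρ = (v : Node t) → ⟦ φ ⟧ t (v ∷ₑ ρ)
  ⟦ tc φ us vs ⟧ t ρ =
    Star (λ u v → ⟦ φ ⟧ t (u ++ₑ (v ++ₑ ρ)))
         (tabulate (ρ ∘ us)) (tabulate (ρ ∘ vs))

  Functional : ∀ {k m} → Formula k (k + (k + m)) → Set
  Functional {k} {m} φ =
    (t : Tree) (ρ : Fin m → Node t) (u v v′ : Vec (Node t) k) →
    ⟦ φ ⟧ t (u ++ₑ (v ++ₑ ρ)) → ⟦ φ ⟧ t (u ++ₑ (v′ ++ₑ ρ)) → v ≡ v′

  IsDTC : ∀ {k m} → Formula k m → Set
  IsDTC (lab σ x) = Data.Unit.⊤ where import Data.Unit
  IsDTC (edg i x y) = Data.Unit.⊤ where import Data.Unit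
  IsDTC (leq x y) = Data.Unit.⊤ where import Data.Unit
  IsDTC (eq x y) = Data.Unit.⊤ where import Data.Unit
  IsDTC (neg φ) = IsDTC φ
  IsDTC (and φ ψ) = IsDTC φ × IsDTC ψ
  IsDTC (or φ ψ) = IsDTC φ × IsDTC ψ
  IsDTC (ex φ) = IsDTC φ
  IsDTC (all φ) = IsDTC φ
  IsDTC (tc φ us vs) = Functional φ × IsDTC φ

  _⊨_ : ∀ {k} → Tree → Formula k 0 → Set
  t ⊨ φ = ⟦ φ ⟧ t (λ ())

  -- k-head tree-walking automata with nested pebbles.
  -- Heads are Fin k (head i+1 of the paper is i), pebbles are Fin nX.

  data Test (k nX : ℕ) : Set where
    labT  : Fin k → Sym Sig → Test k nX
    pebT  : Fin k → Fin nX → Test k nX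
    chnoT : Fin k → ℕ → Test k nX

  data Op (k nX : ℕ) : Set where
    up       : Fin k → Op k nX
    down     : Fin k → ℕ → Op k nX           -- down_{i,j}, j ≥ 1
    drop     : Fin k → Fin nX → Op k nX
    retrieve : Fin nX → Op k nX
    pos      : Test k nX → Op k nX
    negT     : Test k nX → Op k nX

  record PTWA (k : ℕ) : Set where
    field
      nQ     : ℕ
      nX     : ℕ
      q₀     : Fin nQ
      acc    : Subset nQ
      instrs : List (Fin nQ × Op k nX × Fin nQ)

  -- stacks: head of the list is the top
  Stack : ℕ → Tree → Set
  Stack nX t = List (Fin nX × Node t)

  Holds : ∀ {k nX t} → Test k nX → Vec (Node t) k → Stack nX t → Set
  Holds (labT i σ) u α = label (lookup u i) ≡ σ
  Holds (pebT i x) u α = LM._∈_ (x , lookup u i) α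
  Holds (chnoT i j) u α = childNo (lookup u i) ≡ j

  data Exec {k nX : ℕ} {t : Tree} : Op k nX →
       Vec (Node t) k × Stack nX t → Vec (Node t) k × Stack nX t → Set where
    ex-up   : ∀ {u α i j v} → Edge j v (lookup u i) →
              Exec (up i) (u , α) (u [ i ]≔ v , α)
    ex-down : ∀ {u α i j v} → Edge j (lookup u i) v →
              Exec (down i j) (u , α) (u [ i ]≔ v , α)
    ex-drop : ∀ {u α i x} → ¬ Any (λ p → proj₁ p ≡ x) α →
              Exec (drop i x) (u , α) (u , (x , lookup u i) ∷ α)
    ex-retrieve : ∀ {u α x v} →
              Exec (retrieve x) (u , (x , v) ∷ α) (u , α)
    ex-pos  : ∀ {u α T} → Holds T u α → Exec (pos T) (u , α) (u , α)
    ex-neg  : ∀ {u α T} → ¬ Holds T u α → Exec (negT T) (u , α) (u , α)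

  module _ {k : ℕ} (𝒜 : PTWA k) where
    open PTWA 𝒜

    Config : Tree → Set
    Config t = Fin nQ × Vec (Node t) k × Stack nX t

    data Step {t : Tree} : Config t → Config t → Set where
      step : ∀ {p χ q u α u′ α′} → LM._∈_ (p , χ , q) instrs →
             Exec χ (u , α) (u′ , α′) →
             Step (p , u , α) (q , u′ , α′)

    Halting : {t : Tree} → Config t → Set
    Halting c = ¬ ∃ (Step c)

    Accepts : Tree → Set
    Accepts t = Σ (Fin nQ) λ p → p ∈ acc ×
      Star (Step {t}) (q₀ , replicate k root , [])
                      (p , replicate k root , []) ×
      Halting {t} (p , replicate k root , [])

    Deterministic : Set
    Deterministic =
      ∀ {p χ₁ q₁ χ₂ q₂} →
      LM._∈_ (p , χ₁ , q₁) instrs → LM._∈_ (p , χ₂ , q₂) instrs →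
      (p , χ₁ , q₁) ≢ (p , χ₂ , q₂) →
      Σ (Test k nX) λ T → (χ₁ ≡ pos T × χ₂ ≡ negT T) ⊎ (χ₁ ≡ negT T × χ₂ ≡ pos T)

  Language : Set₁
  Language = Tree → Set

  _≐_ : Language → Language → Set
  L ≐ L′ = ∀ t → L t ⇔ L′ t

  DPTWA-definable : ℕ → Language → Set
  DPTWA-definable k L =
    Σ (PTWA k) λ 𝒜 → Deterministic 𝒜 × (L ≐ Accepts 𝒜)

  FODTC-definable : ℕ → Language → Set
  FODTC-definable k L =
    Σ (Formula k 0) λ φ → IsDTC φ × (L ≐ (λ t → t ⊨ φ))

-- From formulas to automata: the values of the variables are kept as pebbles on the stack.
-- Quantifiers are searches through the tree in pre-order. For φ*(ū, v̄) the automaton follows the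
-- functional relation φ from ū, keeping the current tuple w̄ on the stack. The next tuple is found
-- component by component, after which the k heads remember it while the pebbles below are
-- exchanged. To stop on a cycle, the automaton checks, before every step, that the next tuple does
-- not occur on the path from ū to w̄, by a second walk from ū which is bound to reach w̄.
--
-- From automata to formulas: a computation is cut into moves, which leave the stack as it is; a
-- move is one instruction or a computation between the dropping and the retrieving of a pebble.
-- Moves are described by recursion on the number of free pebbles. A sequence of moves is described
-- by eliminating the states one by one, as in Kleene's theorem. By determinism the return to the
-- eliminated state is functional, so that its iteration is a deterministic transitive closure.

module Submission where

open import Defs hiding (lab; edg; leq; eq; neg; and; or; ex; all; tc)
import Defs as D
open import Data.Nat using (ℕ; zero; suc; _+_; _*_; _≤_; _<_; _≥_; z≤n; s≤s; _≤?_; _<?_)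
open import Data.Nat.DivMod using (_mod_; m%n<n; m<n⇒m%n≡m)
open import Data.Nat.Properties
  using (≤-refl; ≤-trans; ≤-reflexive; ≤-antisym; ≤-pred; <⇒≤; ≰⇒>; ≮⇒≥; ≤∧≢⇒<; m≤n⇒m<n∨m≡n;
         n≤0⇒n≡0; <-irrefl; <-trans; <-≤-trans; m≤m+n; m≤n+m; n≤1+n; n<1+n; +-suc; +-identityʳ;
         suc-injective)
  renaming (_≟_ to _≟ℕ_)
open import Data.Fin using (Fin; zero; suc; toℕ; fromℕ<; _↑ˡ_; _↑ʳ_; splitAt; combine)
open import Data.Fin.Properties
  using (toℕ<n; toℕ-injective; toℕ-fromℕ<; splitAt-↑ˡ; splitAt-↑ʳ; combine-injective; pigeonhole;
         any?; +↔⊎; 1↔⊤)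
  renaming (_≟_ to _≟F_)
open import Data.Fin.Subset using (⁅_⁆) renaming (_∈_ to _∈ₛ_)
open import Data.Fin.Subset.Properties using (x∈⁅x⁆; x∈⁅y⁆⇒x≡y) renaming (_∈?_ to _∈ₛ?_)
open import Data.Vec using (Vec; []; _∷_; lookup; tabulate; replicate; _[_]≔_)
open import Data.Vec.Properties
  using ([]≔-idempotent; []≔-lookup; lookup∘update; lookup∘update′; lookup-replicate;
         tabulate∘lookup; tabulate-cong; lookup∘tabulate)
  renaming (≡-dec to ≡-decᵛ)
open import Data.List using (List; []; _∷_; map; _++_; concat; allFin; length)
  renaming (tabulate to tabulateˡ; lookup to lookupˡ)
open import Data.List.Properties using () renaming (≡-dec to ≡-decˡ)
open import Data.List.Membership.Propositional using (_∈_; find)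
open import Data.List.Membership.Propositional.Properties
  using (∈-map⁺; ∈-++⁺ˡ; ∈-++⁺ʳ; ∈-concat⁺′; ∈-concat⁻′; ∈-tabulate⁺; ∈-tabulate⁻; ∈-allFin)
open import Data.List.Relation.Unary.Any using (Any; here; there; index) renaming (map to mapAny)
open import Data.List.Relation.Unary.Any.Properties using (lookup-index)
open import Data.Maybe using (Maybe; just; nothing)
open import Data.Product using (Σ; _×_; _,_; proj₁; proj₂; ∃; ∃₂) renaming (map to map×; map₁ to map₁ᵖ)
open import Data.Product.Properties using (≡-dec)
open import Data.Sum using (_⊎_; inj₁; inj₂; [_,_]; [_,_]′; map₁) renaming (map to map⊎)
open import Data.Sum.Function.Propositional using (_⊎-↔_)
open import Data.Empty using (⊥)
open import Data.Unit using (⊤; tt)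
open import Function using (_∘_; id; _⇔_; mk⇔; Equivalence; _↔_; mk↔ₛ′; Inverse)
open import Function.Construct.Composition using () renaming (equivalence to ⇔-trans)
open import Function.Construct.Symmetry using (⇔-sym)
open import Function.Properties.Inverse using (↔-refl; ↔-sym; ↔-trans)
open import Relation.Nullary using (¬_; Dec; yes; no; contradiction)
open import Relation.Nullary.Decidable using (decidable-stable)
open import Relation.Binary.PropositionalEquality
  using (_≡_; _≢_; refl; sym; trans; cong; cong₂; subst; subst₂)
open import Relation.Binary.Construct.Closure.ReflexiveTransitive using (Star; ε; _◅_; _◅◅_; gmap)

-- The automaton must answer no as well as yes: negation, universal quantification and the cycle
-- check of the closure all need a run that stops with `false`. Hence the program for each
-- subformula is proved to halt on every input, with a definite answer and with heads and stack
-- restored (`Decides`). This also makes truth decidable, so that classical steps are available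
-- constructively. Programs are structured terms (`Prog`) that branch only on a test and its
-- negation; determinism of the compiled automaton is thus syntactic, and a rejecting run excludes
-- an accepting one because at most one halting configuration is reachable. In the converse
-- direction non-terminating computations are harmless, for only the existence of a run to an
-- accepting halting configuration is described. The obstacle is that a closure must be functional
-- for every tree and valuation. Elimination preserves this because determinism is stated for a
-- whole row of the matrix: one state and one tuple lead to at most one state and tuple. The nesting
-- of calls is bounded by `nX`, since the pebbles on a stack are distinct.

-- Edges, ancestors and the pre-order traversal of a tree.

module Trees (Sig : RankedAlphabet) where

  Tr : Set
  Tr = Tree Sig

  Nd : Tr → Set
  Nd = Node Sig

  Edg : {t : Tr} → ℕ → Nd t → Nd t → Set
  Edg = Edge Sig

  lbl : {t : Tr} → Nd t → Sym Sig
  lbl = label Sig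

  rk : {t : Tr} → Nd t → ℕ
  rk x = rank Sig (lbl x)

  chn : {t : Tr} → Nd t → ℕ
  chn = childNo Sig

  there-injective : ∀ {σ ts} {j : Fin (rank Sig σ)} {x y : Nd (ts j)} →
    _≡_ {A = Nd (node σ ts)} (there j x) (there j y) → x ≡ y
  there-injective refl = refl

  _≟ₙ_ : {t : Tr} (x y : Nd t) → Dec (x ≡ y)
  root ≟ₙ root = yes refl
  root ≟ₙ there j y = no λ ()
  there j x ≟ₙ root = no λ ()
  there j x ≟ₙ there i y with j ≟F i
  ... | no j≢i = no λ { refl → j≢i refl }
  ... | yes refl with x ≟ₙ y
  ...   | yes refl = yes refl
  ...   | no x≢y = no λ e → x≢y (there-injective e)

  edge-childNo′ : ∀ {t i c} {x y : Nd t} → Edg i x y → childNo′ Sig c y ≡ i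
  edge-childNo′ (edge-root j) = refl
  edge-childNo′ (edge-there j e) = edge-childNo′ e

  edge-childNo : ∀ {t i} {x y : Nd t} → Edg i x y → chn y ≡ i
  edge-childNo = edge-childNo′

  edge-pos : ∀ {t i} {x y : Nd t} → Edg i x y → ∃ λ i′ → i ≡ suc i′
  edge-pos (edge-root j) = _ , refl
  edge-pos (edge-there j e) = edge-pos e

  edge-rank : ∀ {t i} {x y : Nd t} → Edg i x y → i ≤ rk x
  edge-rank (edge-root j) = toℕ<n j
  edge-rank (edge-there j e) = edge-rank e

  edge-target : ∀ {t i} {x y : Nd t} → Edg i x y → y ≢ root
  edge-target (edge-root j) ()
  edge-target (edge-there j e) ()

  parent : ∀ {t} (x : Nd t) → x ≡ root ⊎ ∃₂ λ i y → Edg i y x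
  parent root = inj₁ refl
  parent (there j x) with parent x
  ... | inj₁ refl = inj₂ (_ , _ , edge-root j)
  ... | inj₂ (i , y , e) = inj₂ (i , there j y , edge-there j e)

  edge-child : ∀ {t i} (x : Nd t) → i < rk x → ∃ λ y → Edg (suc i) x y
  edge-child {node σ ts} root i<r =
    there (fromℕ< i<r) root ,
    subst (λ i → Edg {node σ ts} (suc i) root (there (fromℕ< i<r) root))
          (toℕ-fromℕ< i<r) (edge-root (fromℕ< i<r))
  edge-child (there j x) i<r with edge-child x i<r
  ... | y , e = there j y , edge-there j e

  edge-functional : ∀ {t i} {x y y′ : Nd t} → Edg i x y → Edg i x y′ → y ≡ y′
  edge-functional e e′ = go e e′ refl
    where
    -- The indices are kept apart because `suc (toℕ j)` and `suc (toℕ j′)` cannot be unified by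
    -- matching; the equation is solved by the injectivity of `toℕ`.
    go : ∀ {t i i′} {x y y′ : Nd t} → Edg i x y → Edg i′ x y′ → i ≡ i′ → y ≡ y′
    go (edge-root j) (edge-root j′) eq with toℕ-injective (suc-injective eq)
    ... | refl = refl
    go (edge-there j e) (edge-there .j e′) eq = cong (there j) (go e e′ eq)

  edge-parent : ∀ {t i i′} {x x′ y : Nd t} → Edg i x y → Edg i′ x′ y → x ≡ x′
  edge-parent (edge-root j) (edge-root .j) = refl
  edge-parent (edge-root j) (edge-there .j e) = contradiction refl (edge-target e)
  edge-parent (edge-there j e) (edge-root .j) = contradiction refl (edge-target e)
  edge-parent (edge-there j e) (edge-there .j e′) = cong (there j) (edge-parent e e′)

  childNo≡0 : ∀ {t} {x : Nd t} → chn x ≡ 0 → x ≡ root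
  childNo≡0 {x = x} eq with parent x
  ... | inj₁ p = p
  ... | inj₂ (i , y , e) with edge-pos e
  ...   | _ , refl with trans (sym eq) (edge-childNo e)
  ...     | ()

  edge⇒chn≢0 : ∀ {t j} {x y : Nd t} → Edg j y x → chn x ≢ 0
  edge⇒chn≢0 e e′ = edge-target e (childNo≡0 e′)

  childNo-parent : ∀ {t i} {x : Nd t} → chn x ≡ suc i → ∃ λ y → Edg (suc i) y x
  childNo-parent {x = x} eq with parent x
  ... | inj₁ refl = contradiction eq λ ()
  ... | inj₂ (i , y , e) with trans (sym (edge-childNo e)) eq
  ...   | refl = y , e

  depth : ∀ {t} → Nd t → ℕ
  depth root = 0
  depth (there j x) = suc (depth x)

  edge-depth : ∀ {t i} {x y : Nd t} → Edg i x y → depth y ≡ suc (depth x)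
  edge-depth (edge-root j) = refl
  edge-depth (edge-there j e) = cong suc (edge-depth e)

  -- An address grows at its root end, so going to the parent is not a structural descent; the
  -- induction is on the depth.
  parent-induction : ∀ {t} (P : Nd t → Set) → P root →
    (∀ {i x y} → Edg i x y → P x → P y) → ∀ x → P x
  parent-induction P base next x = go (depth x) x refl
    where
    go : ∀ d x → depth x ≡ d → P x
    go zero x eq with parent x
    ... | inj₁ refl = base
    ... | inj₂ (i , y , e) = contradiction (trans (sym eq) (edge-depth e)) λ ()
    go (suc d) x eq with parent x
    ... | inj₁ refl = base
    ... | inj₂ (i , y , e) = next e (go d y (suc-injective (trans (sym (edge-depth e)) eq)))

  Ancestor : {t : Tr} → Nd t → Nd t → Set
  Ancestor = Anc Sig

  anc-refl : ∀ {t} (x : Nd t) → Ancestor x x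
  anc-refl root = anc-root
  anc-refl (there j x) = anc-there j (anc-refl x)

  anc-step : ∀ {t i} {x y z : Nd t} → Ancestor x y → Edg i y z → Ancestor x z
  anc-step anc-root e = anc-root
  anc-step (anc-there j a) (edge-there .j e) = anc-there j (anc-step a e)

  anc-parent : ∀ {t i} {x y z : Nd t} → Ancestor x z → Edg i y z → x ≢ z → Ancestor x y
  anc-parent anc-root e _ = anc-root
  anc-parent (anc-there j anc-root) (edge-root .j) x≢z = contradiction refl x≢z
  anc-parent (anc-there j a) (edge-there .j e) x≢z = anc-there j (anc-parent a e (x≢z ∘ cong (there j)))

  anc-of-root : ∀ {t} {x : Nd t} → Ancestor x root → x ≡ root
  anc-of-root anc-root = refl

  -- Climb x r: leaving the subtree of x upwards, a pre-order traversal arrives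
  -- at r (at nothing, if it has finished).
  data Climb {t : Tr} : Nd t → Maybe (Nd t) → Set where
    top : Climb root nothing
    sib : ∀ {j x y z} → Edg j y x → Edg (suc j) y z → Climb x (just z)
    up  : ∀ {j x y r} → Edg j y x → rk y ≤ j → Climb y r → Climb x r

  data Next {t : Tr} : Nd t → Maybe (Nd t) → Set where
    first : ∀ {x y} → Edg 1 x y → Next x (just y)
    leaf  : ∀ {x r} → rk x ≡ 0 → Climb x r → Next x r

  -- A traversal up to its end, as a finite object: the correctness of a search is proved by
  -- induction on it, and this is where its termination comes from.
  data Walk {t : Tr} : Nd t → List (Nd t) → Set where
    end : ∀ {x} → Next x nothing → Walk x (x ∷ [])
    _∷_ : ∀ {x y ys} → Next x (just y) → Walk y ys → Walk x (x ∷ ys)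

  module _ {σ} {ts : Fin (rank Sig σ) → Tr} (j : Fin (rank Sig σ)) where

    private
      t : Tr
      t = node σ ts

    climb-there-just : ∀ {x z} → Climb x (just z) → Climb {t} (there j x) (just (there j z))
    climb-there-just (sib e e′) = sib (edge-there j e) (edge-there j e′)
    climb-there-just (up e le c) = up (edge-there j e) le (climb-there-just c)

    -- A climb that finishes in the subtree has come to the root of the subtree; there the climb `c`
    -- of the larger tree takes the place of `top`.
    climb-there-nothing : ∀ {x r} → Climb x nothing → Climb {t} (there j root) r → Climb {t} (there j x) r
    climb-there-nothing top c = c
    climb-there-nothing (up e le c′) c = up (edge-there j e) le (climb-there-nothing c′ c)

    next-there-just : ∀ {x z} → Next x (just z) → Next {t} (there j x) (just (there j z))
    next-there-just (first e) = first (edge-there j e)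
    next-there-just (leaf r c) = leaf r (climb-there-just c)

    next-there-nothing : ∀ {x r} → Next x nothing → Climb {t} (there j root) r → Next {t} (there j x) r
    next-there-nothing (leaf r c′) c = leaf r (climb-there-nothing c′ c)

    walk-there-last : ∀ {x xs} → Walk x xs → Climb {t} (there j root) nothing →
      Walk {t} (there j x) (map (there j) xs)
    walk-there-last (end n) c = end (next-there-nothing n c)
    walk-there-last (n ∷ w) c = next-there-just n ∷ walk-there-last w c

    walk-there : ∀ {x xs z zs} → Walk x xs → Climb {t} (there j root) (just z) → Walk {t} z zs →
      Walk {t} (there j x) (map (there j) xs ++ zs)
    walk-there (end n) c w = next-there-nothing n c ∷ w
    walk-there (n ∷ w′) c w = next-there-just n ∷ walk-there w′ c w

  Traversal : Tr → Set
  Traversal t = ∃ λ xs → Walk {t} root xs × ∀ x → x ∈ xs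

  traversal-node : ∀ {σ ts} → (∀ j → Traversal (ts j)) → Traversal (node σ ts)
  traversal-node {σ} {ts} below = go (rank Sig σ) refl
    where
    -- `d` counts the siblings to the right of child `j`. The walk covers the subtrees of `j` and of
    -- these siblings; for `d = 0` it leaves the last child and ends at the root.
    children : ∀ d (j : Fin (rank Sig σ)) → suc (toℕ j) + d ≡ rank Sig σ →
      ∃ λ xs → Walk {node σ ts} (there j root) xs ×
               ∀ i x → toℕ j ≤ toℕ i → there i x ∈ xs
    children zero j eq with below j
    ... | ys , w , all =
      map (there j) ys ,
      walk-there-last j w (up (edge-root j) (≤-reflexive (trans (sym eq) (+-identityʳ _))) top) ,
      complete
      where
      complete : ∀ i x → toℕ j ≤ toℕ i → there i x ∈ map (there j) ys
      complete i x j≤i with toℕ-injective (≤-antisym j≤i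
        (≤-pred (≤-trans (toℕ<n i) (≤-reflexive (trans (sym eq) (+-identityʳ _))))))
      ... | refl = ∈-map⁺ (there j) (all x)
    children (suc d) j eq with below j
    ... | ys , w , all = map (there j) ys ++ proj₁ rest , walk-there j w c (proj₁ (proj₂ rest)) , complete
      where
      eq′ : suc (suc (toℕ j)) + d ≡ rank Sig σ
      eq′ = trans (sym (+-suc (suc (toℕ j)) d)) eq
      j+1< : suc (toℕ j) < rank Sig σ
      j+1< = ≤-trans (m≤m+n _ d) (≤-reflexive eq′)
      j′ : Fin (rank Sig σ)
      j′ = fromℕ< j+1<
      j′≡ : toℕ j′ ≡ suc (toℕ j)
      j′≡ = toℕ-fromℕ< j+1<
      rest : ∃ λ xs → Walk {node σ ts} (there j′ root) xs ×
                      ∀ i x → toℕ j′ ≤ toℕ i → there i x ∈ xs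
      rest = children d j′ (trans (cong (λ i → suc i + d) j′≡) eq′)
      c : Climb {node σ ts} (there j root) (just (there j′ root))
      c = sib (edge-root j) (subst (λ i → Edg {node σ ts} (suc i) root (there j′ root)) j′≡ (edge-root j′))
      complete : ∀ i x → toℕ j ≤ toℕ i → there i x ∈ map (there j) ys ++ proj₁ rest
      complete i x j≤i with m≤n⇒m<n∨m≡n j≤i
      ... | inj₁ j<i = ∈-++⁺ʳ (map (there j) ys)
                         (proj₂ (proj₂ rest) i x (≤-trans (≤-reflexive j′≡) j<i))
      ... | inj₂ j≡i with toℕ-injective j≡i
      ...   | refl = ∈-++⁺ˡ (∈-map⁺ (there j) (all x))
    go : ∀ r → rank Sig σ ≡ r → Traversal (node σ ts)
    go zero eq = root ∷ [] , end (leaf eq top) , complete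
      where
      complete : ∀ x → x ∈ root ∷ []
      complete root = here refl
      complete (there j x) = contradiction (≤-trans (toℕ<n j) (≤-reflexive eq)) λ ()
    go (suc r) eq = root ∷ proj₁ rest , first e ∷ proj₁ (proj₂ rest) , complete
      where
      0< : 0 < rank Sig σ
      0< = ≤-trans (s≤s z≤n) (≤-reflexive (sym eq))
      j : Fin (rank Sig σ)
      j = fromℕ< 0<
      j≡ : toℕ j ≡ 0
      j≡ = toℕ-fromℕ< 0<
      rest : ∃ λ xs → Walk {node σ ts} (there j root) xs ×
                      ∀ i x → toℕ j ≤ toℕ i → there i x ∈ xs
      rest = children r j (trans (cong (λ i → suc i + r) j≡) (sym eq))
      e : Edg {node σ ts} 1 root (there j root)
      e = subst (λ i → Edg {node σ ts} (suc i) root (there j root)) j≡ (edge-root j)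
      complete : ∀ x → x ∈ root ∷ proj₁ rest
      complete root = here refl
      complete (there i x) = there (proj₂ (proj₂ rest) i x (≤-trans (≤-reflexive j≡) z≤n))

  preorder : ∀ t → Traversal t
  preorder (node σ ts) = traversal-node λ j → preorder (ts j)

  upper-bound : ∀ {n} (f : Fin n → ℕ) → ∃ λ b → ∀ i → f i ≤ b
  upper-bound {zero} f = 0 , λ ()
  upper-bound {suc n} f with upper-bound (f ∘ suc)
  ... | b , le = f zero + b , λ { zero → m≤m+n _ b ; (suc i) → ≤-trans (le i) (m≤n+m b _) }

  -- In fact the sum of all ranks; any bound would do. It makes a switch over child numbers, or a
  -- disjunction over them, finite.
  maxRank : ℕ
  maxRank = proj₁ (upper-bound (rank Sig))

  rank≤maxRank : ∀ σ → rank Sig σ ≤ maxRank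
  rank≤maxRank = proj₂ (upper-bound (rank Sig))

  childNo≤maxRank : ∀ {t} (x : Nd t) → chn x ≤ maxRank
  childNo≤maxRank x with parent x
  ... | inj₁ refl = z≤n
  ... | inj₂ (i , y , e) = ≤-trans (≤-reflexive (edge-childNo e)) (≤-trans (edge-rank e) (rank≤maxRank _))

  lookup-extensionality : ∀ {A : Set} {n} (u v : Vec A n) → (∀ i → lookup u i ≡ lookup v i) → u ≡ v
  lookup-extensionality u v eq = trans (sym (tabulate∘lookup u)) (trans (tabulate-cong eq) (tabulate∘lookup v))

-- Structured programs and their compilation into deterministic automata.

module Machines (Sig : RankedAlphabet) (k′ nX : ℕ) where

  open Trees Sig

  k : ℕ
  k = suc k′

  Conf : Tr → Set
  Conf t = Vec (Nd t) k × Stack Sig nX t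

  Execute : ∀ {t} → Op Sig k nX → Conf t → Conf t → Set
  Execute = Exec Sig

  Hold : ∀ {t} → Test Sig k nX → Conf t → Set
  Hold T (u , α) = Holds Sig T u α

  hold? : ∀ {t} (T : Test Sig k nX) (c : Conf t) → Dec (Hold T c)
  hold? (labT i σ) (u , α) = lbl (lookup u i) ≟F σ
  hold? (pebT i x) (u , α) = (x , lookup u i) ∈? α
    where open import Data.List.Membership.DecPropositional (≡-dec _≟F_ _≟ₙ_)
  hold? (chnoT i j) (u , α) = chn (lookup u i) ≟ℕ j

  execute-functional : ∀ {t χ} {c c₁ c₂ : Conf t} → Execute χ c c₁ → Execute χ c c₂ → c₁ ≡ c₂
  execute-functional (ex-up e) (ex-up e′) = cong (λ v → _ [ _ ]≔ v , _) (edge-parent e e′)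
  execute-functional (ex-down e) (ex-down e′) = cong (λ v → _ [ _ ]≔ v , _) (edge-functional e e′)
  execute-functional (ex-drop _) (ex-drop _) = refl
  execute-functional ex-retrieve ex-retrieve = refl
  execute-functional (ex-pos _) (ex-pos _) = refl
  execute-functional (ex-neg _) (ex-neg _) = refl

  _≟C_ : ∀ {n t} (c c′ : Fin n × Conf t) → Dec (c ≡ c′)
  _≟C_ = ≡-dec _≟F_ (≡-dec (≡-decᵛ _≟ₙ_) (≡-decˡ (≡-dec _≟F_ _≟ₙ_)))

  exclusive : ∀ {t} {T : Test Sig k nX} {χ χ′} {c c₁ c₂ : Conf t} →
    (χ ≡ pos T × χ′ ≡ negT T) ⊎ (χ ≡ negT T × χ′ ≡ pos T) →
    Execute χ c c₁ → Execute χ′ c c₂ → ⊥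
  exclusive (inj₁ (refl , refl)) (ex-pos h) (ex-neg ¬h) = ¬h h
  exclusive (inj₂ (refl , refl)) (ex-neg ¬h) (ex-pos h) = ¬h h

  -- The index counts the exits, through which a program reports its result.
  data Prog : ℕ → Set where
    ret  : ∀ {n} → Fin n → Prog n
    act  : ∀ {n} → Op Sig k nX → Prog n → Prog n
    test : ∀ {n} → Test Sig k nX → Prog n → Prog n → Prog n
    bind : ∀ {m n} → Prog m → (Fin m → Prog n) → Prog n
    -- exit zero of the body starts the next iteration
    loop : ∀ {n} → Prog (suc n) → Prog n

  -- A derivation is a terminating run, so that termination is part of every correctness statement.
  data _∋_⇓_,_ {t : Tr} : ∀ {n} → Prog n → Conf t → Fin n → Conf t → Set where
    ⇓ret  : ∀ {n c} {a : Fin n} → ret a ∋ c ⇓ a , c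
    ⇓act  : ∀ {n χ c c′ c″} {p : Prog n} {a} → Execute χ c c′ → p ∋ c′ ⇓ a , c″ → act χ p ∋ c ⇓ a , c″
    ⇓yes  : ∀ {n T c c′} {p q : Prog n} {a} → Hold T c → p ∋ c ⇓ a , c′ → test T p q ∋ c ⇓ a , c′
    ⇓no   : ∀ {n T c c′} {p q : Prog n} {a} → ¬ Hold T c → q ∋ c ⇓ a , c′ → test T p q ∋ c ⇓ a , c′
    ⇓bind : ∀ {m n c c′ c″} {p : Prog m} {q : Fin m → Prog n} {a b} →
            p ∋ c ⇓ a , c′ → q a ∋ c′ ⇓ b , c″ → bind p q ∋ c ⇓ b , c″
    ⇓loop : ∀ {n c c′ c″} {p : Prog (suc n)} {a} →
            p ∋ c ⇓ zero , c′ → loop p ∋ c′ ⇓ a , c″ → loop p ∋ c ⇓ a , c″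
    ⇓exit : ∀ {n c c′} {p : Prog (suc n)} {a} → p ∋ c ⇓ suc a , c′ → loop p ∋ c ⇓ a , c′

  -- The two shapes that determinism leaves to a state with instructions: a single instruction, or a
  -- test together with its negation.
  data Action (Q : Set) : Set where
    perform : Op Sig k nX → Q → Action Q
    branch  : Test Sig k nX → Q → Q → Action Q

  data Performs {t : Tr} {Q : Set} : Action Q → Conf t → Q → Conf t → Set where
    done    : ∀ {χ q c c′} → Execute χ c c′ → Performs (perform χ q) c q c′
    success : ∀ {T q q′ c} → Hold T c → Performs (branch T q q′) c q c
    failure : ∀ {T q q′ c} → ¬ Hold T c → Performs (branch T q q′) c q′ c

  retarget : ∀ {Q Q′ : Set} → (Q → Q′) → Action Q → Action Q′
  retarget f (perform χ q) = perform χ (f q)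
  retarget f (branch T q q′) = branch T (f q) (f q′)

  performs-retarget : ∀ {Q Q′ : Set} (f : Q → Q′) {t} {a : Action Q} {c c′ : Conf t} {q} →
    Performs a c q c′ → Performs (retarget f a) c (f q) c′
  performs-retarget f (done e) = done e
  performs-retarget f (success h) = success h
  performs-retarget f (failure h) = failure h

  State : ∀ {n} → Prog n → Set
  State (ret a) = ⊤
  State (act χ p) = ⊤ ⊎ State p
  State (test T p q) = ⊤ ⊎ State p ⊎ State q
  State (bind {m} p q) = State p ⊎ Σ (Fin m) (State ∘ q)
  State (loop p) = State p

  start : ∀ {n} (p : Prog n) → State p
  start (ret a) = tt
  start (act χ p) = inj₁ tt
  start (test T p q) = inj₁ tt
  start (bind p q) = inj₁ (start p)
  start (loop p) = start p

  enter : ∀ {m n} (p : Prog m) (q : Fin m → Prog n) → State p ⊎ Fin m → State (bind p q) ⊎ Fin n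
  enter p q (inj₁ s) = inj₁ (inj₁ s)
  enter p q (inj₂ a) = inj₁ (inj₂ (a , start (q a)))

  repeat : ∀ {n} (p : Prog (suc n)) → State p ⊎ Fin (suc n) → State p ⊎ Fin n
  repeat p (inj₁ s) = inj₁ s
  repeat p (inj₂ zero) = inj₁ (start p)
  repeat p (inj₂ (suc a)) = inj₂ a

  -- Automata have no silent moves: ret is a test both of whose outcomes lead to
  -- the exit.
  transition : ∀ {n} (p : Prog n) → State p → Action (State p ⊎ Fin n)
  transition (ret a) s = branch (chnoT zero 0) (inj₂ a) (inj₂ a)
  transition (act χ p) (inj₁ _) = perform χ (inj₁ (inj₂ (start p)))
  transition (act χ p) (inj₂ s) = retarget (map₁ inj₂) (transition p s)
  transition (test T p q) (inj₁ _) = branch T (inj₁ (inj₂ (inj₁ (start p)))) (inj₁ (inj₂ (inj₂ (start q))))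
  transition (test T p q) (inj₂ (inj₁ s)) = retarget (map₁ (inj₂ ∘ inj₁)) (transition p s)
  transition (test T p q) (inj₂ (inj₂ s)) = retarget (map₁ (inj₂ ∘ inj₂)) (transition q s)
  transition (bind p q) (inj₁ s) = retarget (enter p q) (transition p s)
  transition (bind p q) (inj₂ (a , s)) = retarget (map₁ (inj₂ ∘ (a ,_))) (transition (q a) s)
  transition (loop p) s = retarget (repeat p) (transition p s)

  data Move {n} (p : Prog n) {t : Tr} : (State p ⊎ Fin n) × Conf t → (State p ⊎ Fin n) × Conf t → Set where
    move : ∀ {s q c c′} → Performs (transition p s) c q c′ → Move p (inj₁ s , c) (q , c′)

  -- No move starts at an exit, so `f` has to respect transitions on states only. It may send an
  -- exit of `p` to an exit of `q` or to the start of whatever comes next.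
  moves-embed : ∀ {m n} (p : Prog m) (q : Prog n) (f : State p ⊎ Fin m → State q ⊎ Fin n) {t} →
    (∀ s → Σ (State q) λ s′ → f (inj₁ s) ≡ inj₁ s′ × transition q s′ ≡ retarget f (transition p s)) →
    ∀ {x y : (State p ⊎ Fin m) × Conf t} → Star (Move p) x y → Star (Move q) (map₁ᵖ f x) (map₁ᵖ f y)
  moves-embed p q f h = gmap (map₁ᵖ f) λ { (move {s} pf) → lift s pf (h s) }
    where
    lift : ∀ s {x c c′} → Performs (transition p s) c x c′ →
      (Σ (State q) λ s′ → f (inj₁ s) ≡ inj₁ s′ × transition q s′ ≡ retarget f (transition p s)) →
      Move q (f (inj₁ s) , c) (f x , c′)
    lift s pf (s′ , e , e′) rewrite e =
      move (subst (λ a → Performs a _ _ _) (sym e′) (performs-retarget f pf))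

  compile-correct : ∀ {n} {p : Prog n} {t} {c c′ : Conf t} {a} → p ∋ c ⇓ a , c′ →
    Star (Move p) (inj₁ (start p) , c) (inj₂ a , c′)
  compile-correct {c = c} ⇓ret with hold? (chnoT zero 0) c
  ... | yes h = move (success h) ◅ ε
  ... | no ¬h = move (failure ¬h) ◅ ε
  compile-correct {p = act χ p} (⇓act e r) =
    move (done e) ◅ moves-embed p _ (map₁ inj₂) (λ s → inj₂ s , refl , refl) (compile-correct r)
  compile-correct {p = test T p q} (⇓yes h r) =
    move (success h) ◅
    moves-embed p _ (map₁ (inj₂ ∘ inj₁)) (λ s → inj₂ (inj₁ s) , refl , refl) (compile-correct r)
  compile-correct {p = test T p q} (⇓no h r) =
    move (failure h) ◅
    moves-embed q _ (map₁ (inj₂ ∘ inj₂)) (λ s → inj₂ (inj₂ s) , refl , refl) (compile-correct r)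
  compile-correct {p = bind p q} (⇓bind {a = a} r r′) =
    moves-embed p (bind p q) (enter p q) (λ s → inj₁ s , refl , refl) (compile-correct r) ◅◅
    moves-embed (q a) (bind p q) (map₁ (inj₂ ∘ (a ,_))) (λ s → inj₂ (a , s) , refl , refl) (compile-correct r′)
  compile-correct {p = loop p} (⇓loop r r′) =
    moves-embed p (loop p) (repeat p) (λ s → s , refl , refl) (compile-correct r) ◅◅ compile-correct r′
  compile-correct {p = loop p} (⇓exit r) =
    moves-embed p (loop p) (repeat p) (λ s → s , refl , refl) (compile-correct r)

  Finite : Set → Set
  Finite A = ∃ λ n → A ↔ Fin n

  finite-⊎ : ∀ {A B} → Finite A → Finite B → Finite (A ⊎ B)
  finite-⊎ (m , f) (n , g) = m + n , ↔-trans (f ⊎-↔ g) (↔-sym +↔⊎)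

  finite-⊤ : Finite ⊤
  finite-⊤ = 1 , ↔-sym 1↔⊤

  finite-Fin : ∀ n → Finite (Fin n)
  finite-Fin n = n , ↔-refl

  finite-Σ : ∀ n {B : Fin n → Set} → (∀ i → Finite (B i)) → Finite (Σ (Fin n) B)
  finite-Σ zero fin = 0 , mk↔ₛ′ (λ ()) (λ ()) (λ ()) (λ ())
  finite-Σ (suc n) {B} fin with finite-⊎ (fin zero) (finite-Σ n (fin ∘ suc))
  ... | N , f = N , ↔-trans split f
    where
    split : Σ (Fin (suc n)) B ↔ (B zero ⊎ Σ (Fin n) (B ∘ suc))
    split = mk↔ₛ′ (λ { (zero , b) → inj₁ b ; (suc i , b) → inj₂ (i , b) })
                  (λ { (inj₁ b) → zero , b ; (inj₂ (i , b)) → suc i , b })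
                  (λ { (inj₁ b) → refl ; (inj₂ (i , b)) → refl })
                  (λ { (zero , b) → refl ; (suc i , b) → refl })

  finite-State : ∀ {n} (p : Prog n) → Finite (State p)
  finite-State (ret a) = finite-⊤
  finite-State (act χ p) = finite-⊎ finite-⊤ (finite-State p)
  finite-State (test T p q) = finite-⊎ finite-⊤ (finite-⊎ (finite-State p) (finite-State q))
  finite-State (bind {m} p q) = finite-⊎ (finite-State p) (finite-Σ m (finite-State ∘ q))
  finite-State (loop p) = finite-State p

  module Automaton (p : Prog 2) where

    states : Finite (State p ⊎ Fin 2)
    states = finite-⊎ (finite-State p) (finite-Fin 2)

    N : ℕ
    N = proj₁ states

    code : State p ⊎ Fin 2 → Fin N
    code = Inverse.to (proj₂ states)

    decode : Fin N → State p ⊎ Fin 2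
    decode = Inverse.from (proj₂ states)

    decode-code : ∀ s → decode (code s) ≡ s
    decode-code s = Inverse.strictlyInverseʳ (proj₂ states) s

    Instruction : Set
    Instruction = Fin N × Op Sig k nX × Fin N

    encode : Fin N → Action (State p ⊎ Fin 2) → List Instruction
    encode i (perform χ q) = (i , χ , code q) ∷ []
    encode i (branch T q q′) = (i , pos T , code q) ∷ (i , negT T , code q′) ∷ []

    instructionsOf : Fin N → State p ⊎ Fin 2 → List Instruction
    instructionsOf i (inj₁ s) = encode i (transition p s)
    instructionsOf i (inj₂ a) = []

    instructionsAt : Fin N → List Instruction
    instructionsAt i = instructionsOf i (decode i)

    -- The two exits are states without instructions, hence halting; exit 1 accepts and exit 0
    -- rejects.
    automaton : PTWA Sig k
    automaton = record
      { nQ = N ; nX = nX ; q₀ = code (inj₁ (start p)) ; acc = ⁅ code (inj₂ (suc zero)) ⁆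
      ; instrs = concat (tabulateˡ instructionsAt) }

    source : ∀ {i j χ q} s → (i , χ , q) ∈ instructionsOf j s → i ≡ j
    source (inj₁ s) m with transition p s
    source (inj₁ s) (here refl) | perform χ q = refl
    source (inj₁ s) (here refl) | branch T q q′ = refl
    source (inj₁ s) (there (here refl)) | branch T q q′ = refl

    -- The concatenated list forgets the block of an instruction, but the source of the instruction
    -- recovers it.
    ∈-instructions : ∀ {i χ q} → (i , χ , q) ∈ PTWA.instrs automaton → (i , χ , q) ∈ instructionsAt i
    ∈-instructions m with ∈-concat⁻′ (tabulateˡ instructionsAt) m
    ... | xs , m′ , m″ with ∈-tabulate⁻ m″
    ...   | j , refl with source (decode j) m′
    ...     | refl = m′

    ∈-instructions⁺ : ∀ {s x} → x ∈ encode (code (inj₁ s)) (transition p s) → x ∈ PTWA.instrs automaton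
    ∈-instructions⁺ {s} m = ∈-concat⁺′
      (subst (λ s′ → _ ∈ instructionsOf (code (inj₁ s)) s′) (sym (decode-code (inj₁ s))) m)
      (∈-tabulate⁺ (code (inj₁ s)))

    deterministic : Deterministic Sig automaton
    deterministic {i} m m′ ne = go (decode i) (∈-instructions m) (∈-instructions m′) ne
      where
      go : ∀ {χ₁ q₁ χ₂ q₂} s → (i , χ₁ , q₁) ∈ instructionsOf i s → (i , χ₂ , q₂) ∈ instructionsOf i s →
        (i , χ₁ , q₁) ≢ (i , χ₂ , q₂) →
        Σ (Test Sig k nX) λ T → (χ₁ ≡ pos T × χ₂ ≡ negT T) ⊎ (χ₁ ≡ negT T × χ₂ ≡ pos T)
      go (inj₁ s) m m′ ne with transition p s
      go (inj₁ s) (here refl) (here refl) ne | perform χ q = contradiction refl ne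
      go (inj₁ s) (here refl) (here refl) ne | branch T q q′ = contradiction refl ne
      go (inj₁ s) (here refl) (there (here refl)) ne | branch T q q′ = T , inj₁ (refl , refl)
      go (inj₁ s) (there (here refl)) (here refl) ne | branch T q q′ = T , inj₂ (refl , refl)
      go (inj₁ s) (there (here refl)) (there (here refl)) ne | branch T q q′ = contradiction refl ne

    simulate : ∀ {t} {x y : (State p ⊎ Fin 2) × Conf t} → Move p x y →
      Step Sig automaton (map₁ᵖ code x) (map₁ᵖ code y)
    simulate (move {s} pf) = go pf (∈-instructions⁺ {s})
      where
      go : ∀ {a q c c′} → Performs a c q c′ →
        (∀ {x} → x ∈ encode (code (inj₁ s)) a → x ∈ PTWA.instrs automaton) →
        Step Sig automaton (code (inj₁ s) , c) (code q , c′)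
      go (done e) inc = step (inc (here refl)) e
      go (success h) inc = step (inc (here refl)) (ex-pos h)
      go (failure h) inc = step (inc (there (here refl))) (ex-neg h)

    exit-halts : ∀ {t a} {c : Conf t} → Halting Sig automaton (code (inj₂ a) , c)
    exit-halts {a = a} (_ , step {χ = χ} {q} m e)
      with subst (λ s → (code (inj₂ a) , χ , q) ∈ instructionsOf (code (inj₂ a)) s)
                 (decode-code (inj₂ a)) (∈-instructions m)
    ... | ()

    run : ∀ {t a} {c c′ : Conf t} → p ∋ c ⇓ a , c′ →
      Star (Step Sig automaton) (code (inj₁ (start p)) , c) (code (inj₂ a) , c′)
    run r = gmap (map₁ᵖ code) simulate (compile-correct r)

-- Uniqueness of computations of a deterministic automaton.

module Determinism (Sig : RankedAlphabet) (k′ : ℕ) (𝒜 : PTWA Sig (suc k′)) (det : Deterministic Sig 𝒜) where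

  open Trees Sig
  open Machines Sig k′ (PTWA.nX 𝒜)
  open PTWA 𝒜

  -- If the results differed, so would the instructions, because an operation is functional;
  -- determinism would then make them a test and its negation, which cannot both succeed. Equality
  -- of configurations is decidable, so this contradiction suffices.
  step-functional : ∀ {t} {c c₁ c₂ : Config Sig 𝒜 t} → Step Sig 𝒜 c c₁ → Step Sig 𝒜 c c₂ → c₁ ≡ c₂
  step-functional {t} {c} {c₁} {c₂} (step m e) (step m′ e′) = decidable-stable (c₁ ≟C c₂) λ ne →
    exclusive (proj₂ (det m m′ λ { refl → ne (cong (_ ,_) (execute-functional e e′)) })) e e′

  halting-unique : ∀ {t} {c c₁ c₂ : Config Sig 𝒜 t} → Star (Step Sig 𝒜) c c₁ → Star (Step Sig 𝒜) c c₂ →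
    Halting Sig 𝒜 c₁ → Halting Sig 𝒜 c₂ → c₁ ≡ c₂
  halting-unique ε ε h h′ = refl
  halting-unique ε (s ◅ _) h h′ = contradiction (_ , s) h
  halting-unique (s ◅ _) ε h h′ = contradiction (_ , s) h′
  halting-unique (s ◅ r) (s′ ◅ r′) h h′ with step-functional s s′
  ... | refl = halting-unique r r′ h h′

-- Moving the heads: climbing, pre-order search, finding a pebble.

module Walking (Sig : RankedAlphabet) (k′ nX : ℕ) where

  open Trees Sig
  open Machines Sig k′ nX

  module At {t : Tr} (u : Vec (Nd t) k) (α : Stack Sig nX t) (h : Fin k) where

    at : Nd t → Conf t
    at x = u [ h ]≔ x , α

    move-up : ∀ {j x y} → Edg j y x → Execute (up h) (at x) (at y)
    move-up {j} {x} {y} e = subst (λ v → Execute (up h) (at x) (v , α)) ([]≔-idempotent u h)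
      (ex-up (subst (Edg j y) (sym (lookup∘update h u x)) e))

    move-down : ∀ {j x y} → Edg j x y → Execute (down h j) (at x) (at y)
    move-down {j} {x} {y} e = subst (λ v → Execute (down h j) (at x) (v , α)) ([]≔-idempotent u h)
      (ex-down (subst (λ z → Edg j z y) (sym (lookup∘update h u x)) e))

    chno-here : ∀ {j} x → chn x ≡ j → Hold (chnoT h j) (at x)
    chno-here {j} x = subst (λ z → chn z ≡ j) (sym (lookup∘update h u x))

    chno-not-here : ∀ {j} x → chn x ≢ j → ¬ Hold (chnoT h j) (at x)
    chno-not-here {j} x = subst (λ z → chn z ≢ j) (sym (lookup∘update h u x))

    lab-here : ∀ {σ} x → lbl x ≡ σ → Hold (labT h σ) (at x)
    lab-here {σ} x = subst (λ z → lbl z ≡ σ) (sym (lookup∘update h u x))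

    lab-not-here : ∀ {σ} x → lbl x ≢ σ → ¬ Hold (labT h σ) (at x)
    lab-not-here {σ} x = subst (λ z → lbl z ≢ σ) (sym (lookup∘update h u x))

    peb-here : ∀ {p} x → (p , x) ∈ α → Hold (pebT h p) (at x)
    peb-here {p} x = subst (λ z → (p , z) ∈ α) (sym (lookup∘update h u x))

    peb-not-here : ∀ {p} x → ¬ (p , x) ∈ α → ¬ Hold (pebT h p) (at x)
    peb-not-here {p} x = subst (λ z → ¬ (p , z) ∈ α) (sym (lookup∘update h u x))

  -- Value 0 is an untested default: a child number that is at most `n` and differs from `n`, ..., 1
  -- must be 0.
  switchChno : ∀ {r} → Fin k → ℕ → (ℕ → Prog r) → Prog r
  switchChno h zero f = f 0
  switchChno h (suc n) f = test (chnoT h (suc n)) (f (suc n)) (switchChno h n f)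

  switchLab : ∀ {r} → Fin k → List (Sym Sig) → (Sym Sig → Prog r) → Prog r → Prog r
  switchLab h [] f d = d
  switchLab h (σ ∷ σs) f d = test (labT h σ) (f σ) (switchLab h σs f d)

  module _ {t : Tr} {u : Vec (Nd t) k} {α : Stack Sig nX t} {h : Fin k} where

    open At u α h

    ⇓switchChno : ∀ {r x a c} n {f : ℕ → Prog r} → chn x ≤ n →
      f (chn x) ∋ at x ⇓ a , c → switchChno h n f ∋ at x ⇓ a , c
    ⇓switchChno zero le d with n≤0⇒n≡0 le
    ... | e rewrite e = d
    ⇓switchChno {x = x} (suc n) {f} le d with chn x ≟ℕ suc n
    ... | yes e = ⇓yes (chno-here x e) (subst (λ j → f j ∋ at x ⇓ _ , _) e d)
    ... | no ne = ⇓no (chno-not-here x ne) (⇓switchChno n (≤-pred (≤∧≢⇒< le ne)) d)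

    ⇓switchLab : ∀ {r x a c} {σs} {f : Sym Sig → Prog r} {p} → lbl x ∈ σs →
      f (lbl x) ∋ at x ⇓ a , c → switchLab h σs f p ∋ at x ⇓ a , c
    ⇓switchLab {x = x} (here refl) d = ⇓yes (lab-here x refl) d
    ⇓switchLab {x = x} {σs = σ ∷ _} {f} (there m) d with lbl x ≟F σ
    ... | yes e = ⇓yes (lab-here x e) (subst (λ τ → f τ ∋ at x ⇓ _ , _) e d)
    ... | no ne = ⇓no (lab-not-here x ne) (⇓switchLab m d)

  toRoot : Fin k → Prog 1
  toRoot h = loop (test (chnoT h 0) (ret (suc zero)) (act (up h) (ret zero)))

  -- A node does not show whether it is a last child, so the head goes up first: `j` is the child
  -- number it had, counted from 1, and `σ` the label of the parent. If `j` is below the rank, child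
  -- `j + 1` is the next node and exit 2 reports it; otherwise exit 0 continues the climb.
  arrive : Fin k → ℕ → Sym Sig → Prog 3
  arrive h j σ with j <? rank Sig σ
  ... | yes _ = act (down h (suc j)) (ret (suc (suc zero)))
  ... | no _ = ret zero

  climb : Fin k → Prog 2
  climb h = loop (test (chnoT h 0) (ret (suc zero))
    (switchChno h maxRank λ j → act (up h) (switchLab h (allFin _) (arrive h j) (ret zero))))

  descend : Fin k → Sym Sig → Prog 2
  descend h σ with rank Sig σ
  ... | zero = climb h
  ... | suc _ = act (down h 1) (ret (suc zero))

  next : Fin k → Prog 2
  next h = switchLab h (allFin _) (descend h) (ret zero)

  -- The body must put head `h` back when it answers 0, since the traversal is resumed from that
  -- position.
  search : Fin k → Prog 2 → Prog 2
  search h p = loop (bind p λ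
    { zero → bind (next h) λ { zero → ret (suc zero) ; (suc _) → ret zero }
    ; (suc _) → ret (suc (suc zero)) })

  -- No operation brings a head to a pebble, so the whole tree is searched for it, while the other
  -- heads rest.
  goto : Fin k → Fin nX → Prog 1
  goto h x = bind (toRoot h) λ _ →
    bind (search h (test (pebT h x) (ret (suc zero)) (ret zero))) λ _ → ret zero

  module _ {t : Tr} {u : Vec (Nd t) k} {α : Stack Sig nX t} {h : Fin k} where

    open At u α h

    ⇓toRoot-at : ∀ x → toRoot h ∋ at x ⇓ zero , at root
    ⇓toRoot-at = parent-induction (λ x → toRoot h ∋ at x ⇓ zero , at root)
      (⇓exit (⇓yes (chno-here root refl) ⇓ret))
      λ {_} {_} {y} e r → ⇓loop (⇓no (chno-not-here y (edge⇒chn≢0 e)) (⇓act (move-up e) ⇓ret)) r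

    ⇓toRoot : toRoot h ∋ (u , α) ⇓ zero , at root
    ⇓toRoot = subst (λ v → toRoot h ∋ (v , α) ⇓ zero , at root) ([]≔-lookup u h) (⇓toRoot-at (lookup u h))

    arrival : Maybe (Nd t) → Fin 2 × Conf t
    arrival (just z) = suc zero , at z
    arrival nothing = zero , at root

    ⇓climb : ∀ {x r} → Climb x r → climb h ∋ at x ⇓ proj₁ (arrival r) , proj₂ (arrival r)
    ⇓climb top = ⇓exit (⇓yes (chno-here root refl) ⇓ret)
    ⇓climb {x} (sib {j} {y = y} {z} e e′) = ⇓exit
      (⇓no (chno-not-here x (edge⇒chn≢0 e)) (⇓switchChno maxRank (childNo≤maxRank x)
        (⇓act (move-up e) (⇓switchLab (∈-allFin (lbl y)) go))))
      where
      go : arrive h (chn x) (lbl y) ∋ at y ⇓ suc (suc zero) , at z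
      go rewrite edge-childNo e with j <? rank Sig (lbl y)
      ... | yes _ = ⇓act (move-down e′) ⇓ret
      ... | no j≮ = contradiction (edge-rank e′) j≮
    ⇓climb {x} (up {j} {y = y} e le c) = ⇓loop
      (⇓no (chno-not-here x (edge⇒chn≢0 e)) (⇓switchChno maxRank (childNo≤maxRank x)
        (⇓act (move-up e) (⇓switchLab (∈-allFin (lbl y)) go)))) (⇓climb c)
      where
      go : arrive h (chn x) (lbl y) ∋ at y ⇓ zero , at y
      go rewrite edge-childNo e with j <? rank Sig (lbl y)
      ... | yes j< = contradiction (<-≤-trans j< le) (<-irrefl refl)
      ... | no _ = ⇓ret

    ⇓next : ∀ {x r} → Next x r → next h ∋ at x ⇓ proj₁ (arrival r) , proj₂ (arrival r)
    ⇓next {x} n = ⇓switchLab (∈-allFin (lbl x)) (go n)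
      where
      go : ∀ {r} → Next x r → descend h (lbl x) ∋ at x ⇓ proj₁ (arrival r) , proj₂ (arrival r)
      go (first e) with rank Sig (lbl x) | edge-rank e
      ... | suc _ | _ = ⇓act (move-down e) ⇓ret
      go (leaf e c) with rank Sig (lbl x)
      go (leaf refl c) | zero = ⇓climb c

    -- Upon success the body may end in any configuration `C y`, for instance with a pebble left on
    -- the node found; upon failure it must restore its start.
    ⇓search : ∀ {p} (P : Nd t → Set) (C : Nd t → Conf t) →
      (∀ y → (P y × p ∋ at y ⇓ suc zero , C y) ⊎ (¬ P y × p ∋ at y ⇓ zero , at y)) →
      (∃ λ y → P y × search h p ∋ at root ⇓ suc zero , C y) ⊎
      ((∀ y → ¬ P y) × search h p ∋ at root ⇓ zero , at root)
    ⇓search {p} P C body with preorder t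
    ... | xs , w , complete with go w
      where
      go : ∀ {x xs} → Walk x xs → (∃ λ y → P y × search h p ∋ at x ⇓ suc zero , C y) ⊎
        ((∀ {y} → y ∈ xs → ¬ P y) × search h p ∋ at x ⇓ zero , at root)
      go {x} w with body x
      go w | inj₁ (px , r) = inj₁ (_ , px , ⇓exit (⇓bind r ⇓ret))
      go (end n) | inj₂ (¬px , r) =
        inj₂ ((λ { (here refl) → ¬px }) , ⇓exit (⇓bind r (⇓bind (⇓next n) ⇓ret)))
      go (n ∷ w) | inj₂ (¬px , r) with go w
      ... | inj₁ (y , py , r′) = inj₁ (y , py , ⇓loop (⇓bind r (⇓bind (⇓next n) ⇓ret)) r′)
      ... | inj₂ (none , r′) = inj₂ ((λ { (here refl) → ¬px ; (there m) → none m }) ,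
                                     ⇓loop (⇓bind r (⇓bind (⇓next n) ⇓ret)) r′)
    ...   | inj₁ found = inj₁ found
    ...   | inj₂ (none , r) = inj₂ ((λ y → none (complete y)) , r)

    ⇓goto : ∀ {x v} → (x , v) ∈ α → (∀ {y} → (x , y) ∈ α → y ≡ v) → goto h x ∋ (u , α) ⇓ zero , at v
    ⇓goto {x} {v} m unique = ⇓bind ⇓toRoot go
      where
      body : ∀ y → (y ≡ v × test (pebT h x) (ret (suc zero)) (ret zero) ∋ at y ⇓ suc zero , at y) ⊎
                   (y ≢ v × test (pebT h x) (ret (suc zero)) (ret zero) ∋ at y ⇓ zero , at y)
      body y with y ≟ₙ v
      ... | yes refl = inj₁ (refl , ⇓yes (peb-here y m) ⇓ret)
      ... | no ne = inj₂ (ne , ⇓no (peb-not-here y (ne ∘ unique)) ⇓ret)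
      go : bind (search h (test (pebT h x) (ret (suc zero)) (ret zero))) (λ _ → ret zero) ∋
           at root ⇓ zero , at v
      go with ⇓search (_≡ v) at body
      ... | inj₁ (_ , refl , r) = ⇓bind r ⇓ret
      ... | inj₂ (none , _) = contradiction refl (none v)

  each : List (Fin k) → (Fin k → Prog 1) → Prog 1
  each [] f = ret zero
  each (h ∷ hs) f = bind (f h) λ _ → each hs f

  ⇓each : ∀ {t} {α : Stack Sig nX t} {f : Fin k → Prog 1} (v : Vec (Nd t) k) →
    (∀ u h → f h ∋ (u , α) ⇓ zero , (u [ h ]≔ lookup v h , α)) →
    ∀ u → each (allFin k) f ∋ (u , α) ⇓ zero , (v , α)
  ⇓each {α = α} {f} v spec u = go (allFin k) u λ h → inj₁ (∈-allFin h)
    where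
    -- Invariant: a head is still to be treated or already in its final position.
    go : ∀ hs u → (∀ h → h ∈ hs ⊎ lookup u h ≡ lookup v h) → each hs f ∋ (u , α) ⇓ zero , (v , α)
    go [] u inv with lookup-extensionality u v (λ h → [ (λ ()) , id ] (inv h))
    ... | refl = ⇓ret
    go (h ∷ hs) u inv = ⇓bind (spec u h) (go hs (u [ h ]≔ lookup v h) inv′)
      where
      inv′ : ∀ i → i ∈ hs ⊎ lookup (u [ h ]≔ lookup v h) i ≡ lookup v i
      inv′ i with i ≟F h | inv i
      ... | yes refl | _ = inj₂ (lookup∘update h u (lookup v h))
      ... | no ne | inj₁ (here e) = contradiction e ne
      ... | no ne | inj₁ (there m) = inj₁ m
      ... | no ne | inj₂ e = inj₂ (trans (lookup∘update′ ne u (lookup v h)) e)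

  allToRoot : Prog 1
  allToRoot = each (allFin k) toRoot

  ⇓allToRoot : ∀ {t} {u : Vec (Nd t) k} {α : Stack Sig nX t} →
    allToRoot ∋ (u , α) ⇓ zero , (replicate k root , α)
  ⇓allToRoot {u = u} {α} = ⇓each (replicate k root)
    (λ u h → subst (λ x → toRoot h ∋ (u , α) ⇓ zero , (u [ h ]≔ x , α))
                   (sym (lookup-replicate h root)) ⇓toRoot) u

-- Deciding atomic formulas, connectives and quantifiers; tuples on the stack.

module Evaluation (Sig : RankedAlphabet) (k′ N : ℕ) where

  open Trees Sig
  open Machines Sig k′ (suc N)
  open Walking Sig k′ (suc N)

  Env : ℕ → Tr → Set
  Env n t = Fin n → Nd t

  infixr 5 _▷_ _⊕_

  _▷_ : ∀ {A : Set} {n} → A → (Fin n → A) → Fin (suc n) → A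
  _▷_ = _∷ₑ_ Sig

  -- Unlike `_++ₑ_`, which goes through `splitAt`, this recurses on the vector, so that `stackOf`
  -- computes on it and one entry corresponds to one drop or retrieve.
  _⊕_ : ∀ {A : Set} {j n} → Vec A j → (Fin n → A) → Fin (j + n) → A
  [] ⊕ ρ = ρ
  (x ∷ xs) ⊕ ρ = x ▷ (xs ⊕ ρ)

  ⊕-↑ˡ : ∀ {A : Set} {j n} (v : Vec A j) (ρ : Fin n → A) i → (v ⊕ ρ) (i ↑ˡ n) ≡ lookup v i
  ⊕-↑ˡ (x ∷ v) ρ zero = refl
  ⊕-↑ˡ (x ∷ v) ρ (suc i) = ⊕-↑ˡ v ρ i

  ⊕-↑ʳ : ∀ {A : Set} {j n} (v : Vec A j) (ρ : Fin n → A) i → (v ⊕ ρ) (j ↑ʳ i) ≡ ρ i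
  ⊕-↑ʳ [] ρ i = refl
  ⊕-↑ʳ (x ∷ v) ρ i = ⊕-↑ʳ v ρ i

  -- The pebble of the variable of de Bruijn level i; junk for i > N.
  peb : ℕ → Fin (suc N)
  peb i = i mod suc N

  toℕ-peb : ∀ {i} → i ≤ N → toℕ (peb i) ≡ i
  toℕ-peb {i} le = trans (toℕ-fromℕ< (m%n<n i (suc N))) (m<n⇒m%n≡m (s≤s le))

  peb-injective : ∀ {i j} → i ≤ N → j ≤ N → peb i ≡ peb j → i ≡ j
  peb-injective le le′ e = trans (sym (toℕ-peb le)) (trans (cong toℕ e) (toℕ-peb le′))

  stackOf : ∀ {t} n → Env n t → Stack Sig (suc N) t
  stackOf zero ρ = []
  stackOf (suc n) ρ = (peb n , ρ zero) ∷ stackOf n (ρ ∘ suc)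

  -- Unlike its index, the level of a variable does not change when another variable is added; hence
  -- the pebble can stay where it is.
  level : ∀ {n} → Fin n → ℕ
  level {suc n} zero = n
  level {suc n} (suc i) = level i

  level< : ∀ {n} (i : Fin n) → level i < n
  level< {suc n} zero = ≤-refl
  level< {suc n} (suc i) = <-trans (level< i) ≤-refl

  pebOf : ∀ {n} → Fin n → Fin (suc N)
  pebOf i = peb (level i)

  ∈-stackOf : ∀ {t n} (ρ : Env n t) i → (pebOf i , ρ i) ∈ stackOf n ρ
  ∈-stackOf {n = suc n} ρ zero = here refl
  ∈-stackOf {n = suc n} ρ (suc i) = there (∈-stackOf (ρ ∘ suc) i)

  stackOf-pebbles : ∀ {t n x y} {ρ : Env n t} → (x , y) ∈ stackOf n ρ → ∃ λ j → j < n × x ≡ peb j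
  stackOf-pebbles {n = suc n} (here refl) = n , ≤-refl , refl
  stackOf-pebbles {n = suc n} (there m) with stackOf-pebbles m
  ... | j , j<n , e = j , <-trans j<n ≤-refl , e

  fresh : ∀ {t n} {ρ : Env n t} → n ≤ N → ¬ Any (λ p → proj₁ p ≡ peb n) (stackOf n ρ)
  fresh le a with find a
  ... | (x , y) , m , refl with stackOf-pebbles m
  ...   | j , j<n , e with peb-injective le (≤-trans (<⇒≤ j<n) le) e
  ...     | refl = <-irrefl refl j<n

  stackOf-functional : ∀ {t n y} {ρ : Env n t} i → n ≤ N → (pebOf i , y) ∈ stackOf n ρ → y ≡ ρ i
  stackOf-functional zero le (here refl) = refl
  stackOf-functional {n = suc n} zero le (there m) with stackOf-pebbles m
  ... | j , j<n , e with peb-injective (<⇒≤ le) (≤-trans (<⇒≤ j<n) (<⇒≤ le)) e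
  ...   | refl = contradiction j<n (<-irrefl refl)
  stackOf-functional {n = suc n} (suc i) le (here e) with
    peb-injective (≤-trans (<⇒≤ (level< i)) (<⇒≤ le)) (<⇒≤ le) (cong proj₁ e)
  ... | e′ = contradiction (level< i) (<-irrefl e′)
  stackOf-functional {n = suc n} (suc i) le (there m) = stackOf-functional i (<⇒≤ le) m

  home : ∀ {t n} → Env n t → Conf t
  home {n = n} ρ = replicate k root , stackOf n ρ

  pattern true = suc zero
  pattern false = zero

  Rel : ℕ → Set₁
  Rel n = (t : Tr) → Env n t → Set

  -- Totality with a definite answer makes negation an exchange of exits, and the restored `home ρ`
  -- lets programs be composed. Moreover `spec` is a decision of `R`.
  record Decides (n : ℕ) (R : Rel n) : Set where
    constructor decides
    field
      prog : Prog 2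
      spec : ∀ t ρ → (R t ρ × prog ∋ home ρ ⇓ true , home ρ) ⊎ (¬ R t ρ × prog ∋ home ρ ⇓ false , home ρ)

  open Decides

  decides-cong : ∀ {n R R′} → (∀ t ρ → R t ρ ⇔ R′ t ρ) → Decides n R → Decides n R′
  decides-cong iff d = decides (prog d) λ t ρ →
    [ (λ { (r , run) → inj₁ (Equivalence.to (iff t ρ) r , run) })
    , (λ { (r , run) → inj₂ (r ∘ Equivalence.from (iff t ρ) , run) }) ]′ (spec d t ρ)

  decides-⊤ : ∀ {n} → Decides n λ _ _ → ⊤
  decides-⊤ = decides (ret true) λ t ρ → inj₁ (tt , ⇓ret)

  decides-¬ : ∀ {n R} → Decides n R → Decides n λ t ρ → ¬ R t ρ
  decides-¬ d = decides (bind (prog d) λ { false → ret true ; true → ret false }) λ t ρ →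
    [ (λ { (r , run) → inj₂ ((λ ¬r → ¬r r) , ⇓bind run ⇓ret) })
    , (λ { (r , run) → inj₁ (r , ⇓bind run ⇓ret) }) ]′ (spec d t ρ)

  decides-× : ∀ {n R R′} → Decides n R → Decides n R′ → Decides n λ t ρ → R t ρ × R′ t ρ
  decides-× {R = R} {R′} d d′ = decides p spec′
    where
    p : Prog 2
    p = bind (prog d) λ { false → ret false ; true → prog d′ }
    spec′ : ∀ t ρ → ((R t ρ × R′ t ρ) × p ∋ home ρ ⇓ true , home ρ) ⊎
                    (¬ (R t ρ × R′ t ρ) × p ∋ home ρ ⇓ false , home ρ)
    spec′ t ρ with spec d t ρ | spec d′ t ρ
    ... | inj₂ (r , run) | _ = inj₂ (r ∘ proj₁ , ⇓bind run ⇓ret)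
    ... | inj₁ (r , run) | inj₁ (r′ , run′) = inj₁ ((r , r′) , ⇓bind run run′)
    ... | inj₁ (r , run) | inj₂ (r′ , run′) = inj₂ (r′ ∘ proj₂ , ⇓bind run run′)

  decides-⊎ : ∀ {n R R′} → Decides n R → Decides n R′ → Decides n λ t ρ → R t ρ ⊎ R′ t ρ
  decides-⊎ {R = R} {R′} d d′ = decides p spec′
    where
    p : Prog 2
    p = bind (prog d) λ { false → prog d′ ; true → ret true }
    spec′ : ∀ t ρ → ((R t ρ ⊎ R′ t ρ) × p ∋ home ρ ⇓ true , home ρ) ⊎
                    (¬ (R t ρ ⊎ R′ t ρ) × p ∋ home ρ ⇓ false , home ρ)
    spec′ t ρ with spec d t ρ | spec d′ t ρ
    ... | inj₁ (r , run) | _ = inj₁ (inj₁ r , ⇓bind run ⇓ret)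
    ... | inj₂ (r , run) | inj₁ (r′ , run′) = inj₁ (inj₂ r′ , ⇓bind run run′)
    ... | inj₂ (r , run) | inj₂ (r′ , run′) = inj₂ ([ r , r′ ] , ⇓bind run run′)

  decides-∀Fin : ∀ {n} j {R : Fin j → Rel n} → (∀ i → Decides n (R i)) → Decides n λ t ρ → ∀ i → R i t ρ
  decides-∀Fin zero d = decides-cong (λ t ρ → mk⇔ (λ _ ()) λ _ → tt) decides-⊤
  decides-∀Fin (suc j) d = decides-cong
    (λ t ρ → mk⇔ (λ { (r , rs) zero → r ; (r , rs) (suc i) → rs i }) λ r → r zero , r ∘ suc)
    (decides-× (d zero) (decides-∀Fin j (d ∘ suc)))

  ⇓gotoVar : ∀ {t n} (ρ : Env n t) → n ≤ N → ∀ {h} i u →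
    goto h (pebOf i) ∋ (u , stackOf n ρ) ⇓ zero , (u [ h ]≔ ρ i , stackOf n ρ)
  ⇓gotoVar ρ le i u = ⇓goto (∈-stackOf ρ i) (stackOf-functional i le)

  -- For atoms that are read off near one node: head `zero` starts on variable `i` and the heads may
  -- end anywhere.
  DecidesAt : ∀ {n} → Rel n → Prog 2 → Fin n → Set
  DecidesAt {n} R p i = ∀ t ρ →
    (R t ρ × ∃ λ u → p ∋ (replicate k root [ zero ]≔ ρ i , stackOf n ρ) ⇓ true , (u , stackOf n ρ)) ⊎
    (¬ R t ρ × ∃ λ u → p ∋ (replicate k root [ zero ]≔ ρ i , stackOf n ρ) ⇓ false , (u , stackOf n ρ))

  decides-at : ∀ {n R} → n ≤ N → (p : Prog 2) (i : Fin n) → DecidesAt R p i → Decides n R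
  decides-at le p i sp = decides
    (bind (goto zero (pebOf i)) λ _ → bind p λ b → bind allToRoot λ _ → ret b) λ t ρ →
    map⊎ (λ { (r , _ , run) → r , ⇓bind (⇓gotoVar ρ le i _) (⇓bind run (⇓bind ⇓allToRoot ⇓ret)) })
         (λ { (r , _ , run) → r , ⇓bind (⇓gotoVar ρ le i _) (⇓bind run (⇓bind ⇓allToRoot ⇓ret)) }) (sp t ρ)

  decides-lab : ∀ {n} → n ≤ N → ∀ σ (i : Fin n) → Decides n λ t ρ → lbl (ρ i) ≡ σ
  decides-lab {n} le σ i = decides-at le (test (labT zero σ) (ret true) (ret false)) i sp
    where
    sp : DecidesAt (λ t ρ → lbl (ρ i) ≡ σ) (test (labT zero σ) (ret true) (ret false)) i
    sp t ρ with lbl (ρ i) ≟F σ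
    ... | yes e = inj₁ (e , _ , ⇓yes (At.lab-here (replicate k root) (stackOf n ρ) zero (ρ i) e) ⇓ret)
    ... | no ne = inj₂ (ne , _ , ⇓no (At.lab-not-here (replicate k root) (stackOf n ρ) zero (ρ i) ne) ⇓ret)

  module _ {t : Tr} {n : ℕ} (ρ : Env n t) (le : n ≤ N) (u : Vec (Nd t) k) (h : Fin k) (j : Fin n) where

    open At u (stackOf n ρ) h

    var-here : Hold (pebT h (pebOf j)) (at (ρ j))
    var-here = peb-here (ρ j) (∈-stackOf ρ j)

    var-not-here : ∀ {x} → x ≢ ρ j → ¬ Hold (pebT h (pebOf j)) (at x)
    var-not-here {x} ne = peb-not-here x (ne ∘ stackOf-functional j le)

  decides-eq : ∀ {n} → n ≤ N → ∀ (i j : Fin n) → Decides n λ t ρ → ρ i ≡ ρ j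
  decides-eq {n} le i j = decides-at le (test (pebT zero (pebOf j)) (ret true) (ret false)) i sp
    where
    sp : DecidesAt (λ t ρ → ρ i ≡ ρ j) (test (pebT zero (pebOf j)) (ret true) (ret false)) i
    sp t ρ with ρ i ≟ₙ ρ j
    ... | yes e = inj₁ (e , _ , ⇓yes
      (subst (λ x → Hold (pebT zero (pebOf j)) (replicate k root [ zero ]≔ x , stackOf n ρ))
             (sym e) (var-here ρ le (replicate k root) zero j)) ⇓ret)
    ... | no ne = inj₂ (ne , _ , ⇓no (var-not-here ρ le (replicate k root) zero j ne) ⇓ret)

  decides-edge : ∀ {n} → n ≤ N → ∀ c (i j : Fin n) → Decides n λ t ρ → Edg c (ρ i) (ρ j)
  -- Child numbers of edges start at 1.
  decides-edge le zero i j = decides (ret false) λ t ρ → inj₂ ((λ e → contradiction (edge-pos e) λ ()) , ⇓ret)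
  decides-edge {n} le (suc c) i j = decides-at le p j sp
    where
    p : Prog 2
    p = test (chnoT zero (suc c))
      (act (up zero) (test (pebT zero (pebOf i)) (ret true) (ret false))) (ret false)
    sp : DecidesAt (λ t ρ → Edg (suc c) (ρ i) (ρ j)) p j
    sp t ρ with chn (ρ j) ≟ℕ suc c
    ... | no ne = inj₂ (ne ∘ edge-childNo , _ ,
      ⇓no (At.chno-not-here (replicate k root) (stackOf n ρ) zero (ρ j) ne) ⇓ret)
    ... | yes e with childNo-parent e
    ...   | y , e′ with y ≟ₙ ρ i
    ...     | yes refl = inj₁ (e′ , _ ,
      ⇓yes (At.chno-here (replicate k root) (stackOf n ρ) zero (ρ j) e)
      (⇓act (At.move-up (replicate k root) _ _ e′)
      (⇓yes (var-here ρ le (replicate k root) zero i) ⇓ret)))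
    ...     | no ne = inj₂ ((λ e″ → ne (edge-parent e′ e″)) , _ ,
      ⇓yes (At.chno-here (replicate k root) (stackOf n ρ) zero (ρ j) e)
      (⇓act (At.move-up (replicate k root) _ _ e′)
      (⇓no (var-not-here ρ le (replicate k root) zero i ne) ⇓ret)))

  -- The head climbs from `ρ j` and looks for the pebble of `i`. The pebble is tested before the
  -- root, since the root may be the ancestor sought.
  decides-anc : ∀ {n} → n ≤ N → ∀ (i j : Fin n) → Decides n λ t ρ → Ancestor (ρ i) (ρ j)
  decides-anc {n} le i j = decides-at le p j λ t ρ → sp t ρ (ρ j)
    where
    p : Prog 2
    p = loop (test (pebT zero (pebOf i)) (ret (suc true))
          (test (chnoT zero 0) (ret (suc false)) (act (up zero) (ret zero))))
    sp : ∀ t (ρ : Env n t) x →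
      (Ancestor (ρ i) x × ∃ λ u →
        p ∋ (replicate k root [ zero ]≔ x , stackOf n ρ) ⇓ true , (u , stackOf n ρ)) ⊎
      (¬ Ancestor (ρ i) x × ∃ λ u →
        p ∋ (replicate k root [ zero ]≔ x , stackOf n ρ) ⇓ false , (u , stackOf n ρ))
    sp t ρ = parent-induction _ base later
      where
      open At (replicate k root) (stackOf n ρ) zero
      Goal : Nd t → Set
      Goal x = (Ancestor (ρ i) x × ∃ λ u → p ∋ at x ⇓ true , (u , stackOf n ρ)) ⊎
               (¬ Ancestor (ρ i) x × ∃ λ u → p ∋ at x ⇓ false , (u , stackOf n ρ))
      reached : ∀ {x} → x ≡ ρ i → Goal x
      reached refl = inj₁ (anc-refl _ , _ , ⇓exit (⇓yes (var-here ρ le (replicate k root) zero i) ⇓ret))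
      base : Goal root
      base with root ≟ₙ ρ i
      ... | yes e = reached e
      ... | no ne = inj₂ ((λ a → ne (sym (anc-of-root a))) , _ ,
        ⇓exit (⇓no (var-not-here ρ le (replicate k root) zero i ne) (⇓yes (chno-here root refl) ⇓ret)))
      later : ∀ {c x y} → Edg c x y → Goal x → Goal y
      later {y = y} e g with y ≟ₙ ρ i
      ... | yes e′ = reached e′
      ... | no ne = [ (λ { (a , u , run) → inj₁ (anc-step a e , u , go run) })
                    , (λ { (¬a , u , run) → inj₂ ((λ a → ¬a (anc-parent a e (ne ∘ sym))) , u , go run) }) ]′ g
        where
        go : ∀ {a c} → p ∋ at _ ⇓ a , c → p ∋ at y ⇓ a , c
        go run = ⇓loop (⇓no (var-not-here ρ le (replicate k root) zero i ne)
          (⇓no (chno-not-here y (edge⇒chn≢0 e)) (⇓act (move-up e) ⇓ret))) run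

  abstract

    -- Upon success the pebble is left on the witness, for use as a component of a tuple.
    try : ∀ {n R} → Decides (suc n) R → Prog 2
    try {n} d = act (drop zero (peb n)) (bind allToRoot λ _ → bind (prog d) λ
      -- Evaluation has sent the heads to the root, so the pebble is the only record of the current
      -- node; the head must return to it before it is retrieved.
      { false → bind (goto zero (peb n)) λ _ → act (retrieve (peb n)) (ret false)
      ; true → ret true })

    found : ∀ {n R} → Decides (suc n) R → Prog 2
    found d = search zero (try d)

    ⇓found : ∀ {n R} → n < N → (d : Decides (suc n) R) → ∀ t ρ →
      (∃ λ x → R t (x ▷ ρ) × found d ∋ home ρ ⇓ true , home (x ▷ ρ)) ⊎
      ((∀ x → ¬ R t (x ▷ ρ)) × found d ∋ home ρ ⇓ false , home ρ)
    ⇓found {n} {R} n<N d t ρ = subst (λ u →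
      (∃ λ x → R t (x ▷ ρ) × found d ∋ (u , stackOf n ρ) ⇓ true , home (x ▷ ρ)) ⊎
      ((∀ x → ¬ R t (x ▷ ρ)) × found d ∋ (u , stackOf n ρ) ⇓ false , (u , stackOf n ρ)))
      ([]≔-lookup (replicate k root) zero)
      (⇓search {u = replicate k root} (λ x → R t (x ▷ ρ)) (λ x → home (x ▷ ρ)) body)
      where
      open At (replicate k root) (stackOf n ρ) zero
      dropped : ∀ x → Execute (drop zero (peb n)) (at x) (x ∷ replicate k′ root , stackOf (suc n) (x ▷ ρ))
      dropped x = ex-drop (fresh (<⇒≤ n<N))
      body : ∀ x → (R t (x ▷ ρ) × try d ∋ at x ⇓ true , home (x ▷ ρ)) ⊎
                   (¬ R t (x ▷ ρ) × try d ∋ at x ⇓ false , at x)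
      body x with spec d t (x ▷ ρ)
      ... | inj₁ (r , run) = inj₁ (r , ⇓act (dropped x) (⇓bind ⇓allToRoot (⇓bind run ⇓ret)))
      ... | inj₂ (¬r , run) = inj₂ (¬r , ⇓act (dropped x) (⇓bind ⇓allToRoot
              (⇓bind run (⇓bind (⇓gotoVar (x ▷ ρ) n<N zero _) (⇓act ex-retrieve ⇓ret)))))

    decides-∃ : ∀ {n R} → n < N → Decides (suc n) R → Decides n λ t ρ → Σ (Nd t) λ x → R t (x ▷ ρ)
    decides-∃ {n} n<N d = decides
      (bind (found d) λ { false → ret false ; true → act (retrieve (peb n)) (ret true) }) λ t ρ →
      [ (λ { (x , r , run) → inj₁ ((x , r) , ⇓bind run (⇓act ex-retrieve ⇓ret)) })
      , (λ { (none , run) → inj₂ ((λ { (x , r) → none x r }) , ⇓bind run ⇓ret) }) ]′ (⇓found n<N d t ρ)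

    -- Obtained as the negation of a counterexample; the double negation is removed by the decision
    -- contained in `spec d`.
    decides-∀ : ∀ {n R} → n < N → Decides (suc n) R → Decides n λ t ρ → (x : Nd t) → R t (x ▷ ρ)
    decides-∀ {n} {R} n<N d = decides-cong
      (λ t ρ → mk⇔ (λ none x → [ proj₁ , (λ { (¬r , _) → contradiction (x , ¬r) none }) ]′ (spec d t (x ▷ ρ)))
                   (λ all (x , ¬r) → ¬r (all x)))
      (decides-¬ (decides-∃ n<N (decides-¬ d)))

    -- The entries of the tuple are found one after the other, the last one first,
    -- each of them such that the remaining ones exist.
    foundTuple : ∀ n j {R} → j + n ≤ N → Decides (j + n) R → Prog 2
    foundTuple n zero le d = prog d
    foundTuple n (suc j) le d = bind (foundTuple n j (<⇒≤ le) (decides-∃ le d)) λ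
      { false → ret false ; true → found d }

    ⇓foundTuple : ∀ n j {R} (le : j + n ≤ N) (d : Decides (j + n) R) → ∀ t ρ →
      (∃ λ (v : Vec (Nd t) j) → R t (v ⊕ ρ) × foundTuple n j le d ∋ home ρ ⇓ true , home (v ⊕ ρ)) ⊎
      ((∀ (v : Vec (Nd t) j) → ¬ R t (v ⊕ ρ)) × foundTuple n j le d ∋ home ρ ⇓ false , home ρ)
    ⇓foundTuple n zero le d t ρ with spec d t ρ
    ... | inj₁ (r , run) = inj₁ ([] , r , run)
    ... | inj₂ (¬r , run) = inj₂ ((λ { [] → ¬r }) , run)
    ⇓foundTuple n (suc j) le d t ρ with ⇓foundTuple n j (<⇒≤ le) (decides-∃ le d) t ρ
    ... | inj₂ (none , run) = inj₂ ((λ { (x ∷ v) r → none v (x , r) }) , ⇓bind run ⇓ret)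
    ... | inj₁ (v , (x , r) , run) with ⇓found le d t (v ⊕ ρ)
    ...   | inj₁ (x′ , r′ , run′) = inj₁ (x′ ∷ v , r′ , ⇓bind run run′)
    ...   | inj₂ (none , _) = contradiction r (none x)

    gather : ∀ {n} → (Fin k → Fin n) → Prog 1
    gather g = each (allFin k) λ h → goto h (pebOf (g h))

    ⇓gather : ∀ {t n} (ρ : Env n t) (g : Fin k → Fin n) → n ≤ N → ∀ u →
      gather g ∋ (u , stackOf n ρ) ⇓ zero , (tabulate (ρ ∘ g) , stackOf n ρ)
    ⇓gather {n = n} ρ g le = ⇓each (tabulate (ρ ∘ g)) λ u h →
      subst (λ x → goto h (pebOf (g h)) ∋ (u , stackOf n ρ) ⇓ zero , (u [ h ]≔ x , stackOf n ρ))
            (sym (lookup∘tabulate (ρ ∘ g) h)) (⇓gotoVar ρ le (g h) u)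

    pop : ∀ {r} (j n : ℕ) → Prog r → Prog r
    pop zero n p = p
    pop (suc j) n p = act (retrieve (peb (j + n))) (pop j n p)

    ⇓pop : ∀ {t r j n} {u : Vec (Nd t) k} (v : Vec (Nd t) j) (ρ : Env n t) {p : Prog r} {a c} →
      p ∋ (u , stackOf n ρ) ⇓ a , c → pop j n p ∋ (u , stackOf (j + n) (v ⊕ ρ)) ⇓ a , c
    ⇓pop [] ρ d = d
    ⇓pop (x ∷ v) ρ d = ⇓act ex-retrieve (⇓pop v ρ d)

    -- Written with a continuation because the last component is dropped first, so that component
    -- zero ends on top, as in `_⊕_`.
    push : ∀ {r j} → (Fin j → Fin k) → ℕ → Prog r → Prog r
    push {j = zero} g n p = p
    push {j = suc j} g n p = push (g ∘ suc) n (act (drop (g zero) (peb (j + n))) p)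

    ⇓push : ∀ {t r j n} {u : Vec (Nd t) k} (g : Fin j → Fin k) {ρ : Env n t} {p : Prog r} {a c} →
      j + n ≤ suc N →
      p ∋ (u , stackOf (j + n) (tabulate (lookup u ∘ g) ⊕ ρ)) ⇓ a , c → push g n p ∋ (u , stackOf n ρ) ⇓ a , c
    ⇓push {j = zero} g le d = d
    ⇓push {j = suc j} g le d = ⇓push (g ∘ suc) (<⇒≤ le) (⇓act (ex-drop (fresh (≤-pred le))) d)

    copy : ∀ {n} → (Fin k → Fin n) → Prog 1
    copy {n} g = bind (gather g) λ _ → push id n allToRoot

    ⇓copy : ∀ {t n} (ρ : Env n t) (g : Fin k → Fin n) → k + n ≤ N →
      copy g ∋ home ρ ⇓ zero , home (tabulate (ρ ∘ g) ⊕ ρ)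
    ⇓copy {n = n} ρ g le = ⇓bind (⇓gather ρ g (≤-trans (m≤n+m n k) le) _)
      (⇓push id (≤-trans le (n≤1+n N))
        (subst (λ v → allToRoot ∋ (tabulate (ρ ∘ g) , stackOf (k + n) (v ⊕ ρ)) ⇓
                               zero , home (tabulate (ρ ∘ g) ⊕ ρ))
                 (sym (tabulate∘lookup (tabulate (ρ ∘ g)))) ⇓allToRoot))

    -- Only here are all k heads needed: they hold v while the pebbles on w are
    -- retrieved from below those on v.
    collapse : ℕ → Prog 1
    collapse n = bind (gather (_↑ˡ (k + n))) λ _ → pop k (k + n) (pop k n (push id n allToRoot))

    ⇓collapse : ∀ {t n} (v w : Vec (Nd t) k) (ρ : Env n t) → k + (k + n) ≤ N →
      collapse n ∋ home (v ⊕ w ⊕ ρ) ⇓ zero , home (v ⊕ ρ)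
    ⇓collapse {t} {n} v w ρ le =
      ⇓bind (subst (λ v′ → gather (_↑ˡ (k + n)) ∋ home (v ⊕ w ⊕ ρ) ⇓ zero , (v′ , stackOf _ (v ⊕ w ⊕ ρ)))
                   (trans (tabulate-cong (⊕-↑ˡ v (w ⊕ ρ))) (tabulate∘lookup v))
                   (⇓gather (v ⊕ w ⊕ ρ) (_↑ˡ (k + n)) le _))
        (⇓pop v (w ⊕ ρ) (⇓pop w ρ (⇓push id (≤-trans (≤-trans (m≤n+m (k + n) k) le) (n≤1+n N))
          (subst (λ v′ → allToRoot ∋ (v , stackOf (k + n) (v′ ⊕ ρ)) ⇓ zero , home (v ⊕ ρ))
                 (sym (tabulate∘lookup v)) ⇓allToRoot))))

-- Deciding a deterministic transitive closure.

module Closure (Sig : RankedAlphabet) (k′ N : ℕ) where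

  open Trees Sig
  open Machines Sig k′ (suc N)
  open Walking Sig k′ (suc N)
  open Evaluation Sig k′ N
  open Decides

  abstract

    sameTuple : ∀ {n} → n ≤ N → (g h : Fin k → Fin n) →
      Decides n λ t ρ → tabulate (ρ ∘ g) ≡ tabulate (ρ ∘ h)
    sameTuple le g h = decides-cong
      (λ t ρ → mk⇔ tabulate-cong λ e i →
        trans (sym (lookup∘tabulate (ρ ∘ g) i)) (trans (cong (λ v → lookup v i) e) (lookup∘tabulate (ρ ∘ h) i)))
      (decides-∀Fin k λ i → decides-eq le (g i) (h i))

  block₀ : ∀ {t m} (v : Vec (Nd t) k) (ρ : Env m t) → tabulate ((v ⊕ ρ) ∘ (_↑ˡ m)) ≡ v
  block₀ v ρ = trans (tabulate-cong (⊕-↑ˡ v ρ)) (tabulate∘lookup v)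

  blockₛ : ∀ {t m} (v : Vec (Nd t) k) {ρ : Env m t} (g : Fin k → Fin m) {w} →
    tabulate (ρ ∘ g) ≡ w → tabulate ((v ⊕ ρ) ∘ (k ↑ʳ_) ∘ g) ≡ w
  blockₛ v {ρ} g e = trans (tabulate-cong λ i → ⊕-↑ʳ v ρ (g i)) e

  nodeIndex : ∀ t → ∃ λ M → Σ (Nd t → Fin M) λ f → ∀ {x y} → f x ≡ f y → x ≡ y
  nodeIndex t with preorder t
  ... | xs , _ , complete = length xs , (λ x → index (complete x)) , λ {x} {y} e →
    trans (lookup-index (complete x)) (trans (cong (lookupˡ xs) e) (sym (lookup-index (complete y))))

  abstract

    tupleIndex : ∀ t j → ∃ λ M → Σ (Vec (Nd t) j → Fin M) λ f → ∀ {v w} → f v ≡ f w → v ≡ w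
    tupleIndex t zero = 1 , (λ _ → zero) , λ { {[]} {[]} _ → refl }
    tupleIndex t (suc j) with nodeIndex t | tupleIndex t j
    ... | M , f , f-inj | M′ , g , g-inj = M * M′ , (λ { (x ∷ v) → combine (f x) (g v) }) ,
      λ { {x ∷ v} {y ∷ w} e → cong₂ _∷_ (f-inj (proj₁ (combine-injective (f x) (g v) (f y) (g w) e)))
                                        (g-inj (proj₂ (combine-injective (f x) (g v) (f y) (g w) e))) }

  module Orbit {V : Set} (E : V → V → Set) (functional : ∀ {u v v′} → E u v → E u v′ → v ≡ v′) (a : V) where

    data Iter : ℕ → V → Set where
      base : Iter 0 a
      succ : ∀ {i v w} → Iter i v → E v w → Iter (suc i) w

    iter-functional : ∀ {i v w} → Iter i v → Iter i w → v ≡ w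
    iter-functional base base = refl
    iter-functional (succ i e) (succ i′ e′) with iter-functional i i′
    ... | refl = functional e e′

    iter⇒star : ∀ {i v} → Iter i v → Star E a v
    iter⇒star base = ε
    iter⇒star (succ i e) = iter⇒star i ◅◅ (e ◅ ε)

    star⇒iter : ∀ {v} → Star E a v → ∃ λ i → Iter i v
    star⇒iter r = go base r
      where
      go : ∀ {i v w} → Iter i v → Star E v w → ∃ λ j → Iter j w
      go i ε = _ , i
      go i (e ◅ r) = go (succ i e) r

    iter-prefix : ∀ {i j w} → Iter i w → j ≤ i → ∃ λ v → Iter j v
    iter-prefix {j = j} it le with m≤n⇒m<n∨m≡n le
    ... | inj₂ refl = _ , it
    iter-prefix {j = j} (succ it e) le | inj₁ lt = iter-prefix it (≤-pred lt)

    Distinct : ℕ → Set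
    Distinct n = ∀ {i j v} → i < j → j ≤ n → Iter i v → ¬ Iter j v

    -- Once an iterate repeats an earlier one, the orbit contains nothing new: every later iterate
    -- is found among those up to `n`.
    iter-cycle : ∀ {n s} → Iter (suc n) s → (∃ λ i → i ≤ n × Iter i s) →
      ∀ {j v} → Iter j v → ∃ λ i → i ≤ n × Iter i v
    iter-cycle it seen {zero} base = 0 , z≤n , base
    iter-cycle {n} it (i₀ , i₀≤n , it₀) {suc j} (succ itⱼ e) with iter-cycle it (i₀ , i₀≤n , it₀) itⱼ
    ... | i , i≤n , it′ with m≤n⇒m<n∨m≡n i≤n
    ...   | inj₁ i<n = suc i , i<n , succ it′ e
    ...   | inj₂ refl with iter-functional it (succ it′ e)
    ...     | refl = i₀ , i₀≤n , it₀

    iter-stuck : ∀ {n w} → Iter n w → (∀ s → ¬ E w s) → ∀ {j v} → Iter j v → j ≤ n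
    iter-stuck {n} it none {j} itⱼ with j ≤? n
    ... | yes le = le
    ... | no j≰n with iter-prefix itⱼ (≰⇒> j≰n)
    ...   | s , succ it′ e with iter-functional it it′
    ...     | refl = contradiction e (none s)

    -- By the pigeonhole principle; with the finitely many tuples of a tree it bounds the length of
    -- the walk.
    distinct-bound : ∀ {M} (f : V → Fin M) → (∀ {v w} → f v ≡ f w → v ≡ w) →
      ∀ {n w} → Iter n w → Distinct n → n < M
    distinct-bound {M} f inj {n} it dist with n <? M
    ... | yes lt = lt
    ... | no n≮M
      with pigeonhole {M} {suc n} (s≤s (≮⇒≥ n≮M)) (λ i → f (proj₁ (iter-prefix it (≤-pred (toℕ<n i)))))
    ...   | i , j , i<j , e with iter-prefix it (≤-pred (toℕ<n i)) | iter-prefix it (≤-pred (toℕ<n j))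
    ...     | v , itᵢ | w , itⱼ with inj e
    ...       | refl = contradiction itⱼ (dist i<j (≤-pred (toℕ<n j)) itᵢ)

  module _ {n : ℕ} (E : ∀ t → Env n t → Vec (Nd t) k → Vec (Nd t) k → Set)
    (functional : ∀ {t ρ u v v′} → E t ρ u v → E t ρ u v′ → v ≡ v′)
    (A B : Fin k → Fin n)
    -- At the deepest point four tuples lie above `ρ`: the current `w`, its successor `s`, the
    -- current tuple `c` of the second walk, and the successor `v` of `c`.
    (le : k + (k + (k + (k + n))) ≤ N)
    {R₁ : Rel (k + (k + n))} (d₁ : Decides (k + (k + n)) R₁)
    (R₁⇔ : ∀ {t} (v w : Vec (Nd t) k) (ρ : Env n t) → R₁ t (v ⊕ w ⊕ ρ) ⇔ E t ρ w v)
    {R₂ : Rel (k + (k + (k + (k + n))))} (d₂ : Decides (k + (k + (k + (k + n)))) R₂)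
    (R₂⇔ : ∀ {t} (v c s w : Vec (Nd t) k) (ρ : Env n t) → R₂ t (v ⊕ c ⊕ s ⊕ w ⊕ ρ) ⇔ E t ρ c v)
    where

    private
      le₃ : k + (k + (k + n)) ≤ N
      le₃ = ≤-trans (m≤n+m _ k) le
      le₂ : k + (k + n) ≤ N
      le₂ = ≤-trans (m≤n+m _ k) le₃
      le₁ : k + n ≤ N
      le₁ = ≤-trans (m≤n+m _ k) le₂

      exit₀ exit₁ : Fin 3
      exit₀ = suc false
      exit₁ = suc true

    c≡s : Decides (k + (k + (k + n))) _
    c≡s = sameTuple le₃ (_↑ˡ _) ((k ↑ʳ_) ∘ (_↑ˡ _))

    c≡w : Decides (k + (k + (k + n))) _
    c≡w = sameTuple le₃ (_↑ˡ _) ((k ↑ʳ_) ∘ (k ↑ʳ_) ∘ (_↑ˡ _))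

    w≡B : Decides (k + n) _
    w≡B = sameTuple le₁ (_↑ˡ _) ((k ↑ʳ_) ∘ B)

    seenLoop : Prog 2
    -- The comparison with `s` precedes that with `w`, because `s` may be `w` itself.
    seenLoop = loop (bind (prog c≡s) λ
      { true → ret exit₁
      ; false → bind (prog c≡w) λ
        { true → ret exit₀
        ; false → bind (foundTuple (k + (k + (k + n))) k le d₂) λ
          -- Never taken: `c` lies properly before `w` on the orbit and so has a successor.
          { false → ret exit₀
          ; true → bind (collapse (k + (k + n))) λ _ → ret zero } } })

    -- Whether s occurs in the orbit of A up to w. The search ends because w occurs
    -- in that orbit.
    seen : Prog 2
    seen = bind (copy ((k ↑ʳ_) ∘ (k ↑ʳ_) ∘ A)) λ _ → bind seenLoop λ b → pop k (k + (k + n)) (ret b)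

    walkLoop : Prog 2
    walkLoop = loop (bind (prog w≡B) λ
      { true → ret exit₁
      ; false → bind (foundTuple (k + n) k le₂ d₁) λ
        { false → ret exit₀
        ; true → bind seen λ
          { true → pop k (k + n) (ret exit₀)
          ; false → bind (collapse n) λ _ → ret zero } } })

    -- A walk along E could run into a cycle without meeting B; it stops as soon as
    -- the next tuple has been seen before.
    walk : Prog 2
    walk = bind (copy A) λ _ → bind walkLoop λ b → pop k n (ret b)

    module _ {t : Tr} (ρ : Env n t) where

      open Orbit (E t ρ) functional (tabulate (ρ ∘ A))

      module _ {w s : Vec (Nd t) k} {n₀} (itw : Iter n₀ w) (dist : Distinct n₀) where

        SeenBy : (Fin 2 → Set) → Set
        SeenBy run = ((∃ λ i → i ≤ n₀ × Iter i s) × run true) ⊎ ((∀ {i} → i ≤ n₀ → ¬ Iter i s) × run false)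

        private
          σ : Env (k + (k + n)) t
          σ = s ⊕ w ⊕ ρ

        first≡ : ∀ c → tabulate ((c ⊕ σ) ∘ (_↑ˡ (k + (k + n)))) ≡ c
        first≡ c = block₀ c σ

        second≡ : ∀ c → tabulate ((c ⊕ σ) ∘ (k ↑ʳ_) ∘ (_↑ˡ (k + n))) ≡ s
        second≡ c = blockₛ c (_↑ˡ (k + n)) (block₀ s (w ⊕ ρ))

        third≡ : ∀ c → tabulate ((c ⊕ σ) ∘ (k ↑ʳ_) ∘ (k ↑ʳ_) ∘ (_↑ˡ n)) ≡ w
        third≡ c = blockₛ c ((k ↑ʳ_) ∘ (_↑ˡ n)) (blockₛ s (_↑ˡ n) (block₀ w ρ))

        -- `fuel` is the distance from `c` to `w` along the orbit. As the iterates up to `n₀` are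
        -- distinct, `w` is met only at `n₀`, when all of them have been compared with `s`.
        ⇓seenLoop : ∀ fuel j c → j + fuel ≡ n₀ → Iter j c → (∀ {i} → i < j → ¬ Iter i s) →
          SeenBy λ b → ∃ λ (c′ : Vec (Nd t) k) → seenLoop ∋ home (c ⊕ s ⊕ w ⊕ ρ) ⇓ b , home (c′ ⊕ s ⊕ w ⊕ ρ)
        ⇓seenLoop fuel j c j+fuel itc new with spec c≡s t (c ⊕ s ⊕ w ⊕ ρ)
        ... | inj₁ (e , run) =
          inj₁ ((j , subst (j ≤_) j+fuel (m≤m+n j fuel) , subst (Iter j) c≡ itc) , c , ⇓exit (⇓bind run ⇓ret))
          where
          c≡ : c ≡ s
          c≡ = trans (sym (first≡ c)) (trans e (second≡ c))
        ... | inj₂ (ne , run) with spec c≡w t (c ⊕ s ⊕ w ⊕ ρ)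
        ...   | inj₁ (e , run′) = inj₂ ((λ {i} → new′ i) , c , ⇓exit (⇓bind run (⇓bind run′ ⇓ret)))
          where
          c≡ : c ≡ w
          c≡ = trans (sym (first≡ c)) (trans e (third≡ c))
          c≢s : c ≢ s
          c≢s e′ = ne (trans (first≡ c) (trans e′ (sym (second≡ c))))
          j≡n₀ : j ≡ n₀
          j≡n₀ with m≤n⇒m<n∨m≡n (subst (j ≤_) j+fuel (m≤m+n j fuel))
          ... | inj₂ e′ = e′
          ... | inj₁ j<n₀ = contradiction (subst (Iter n₀) (sym c≡) itw) (dist j<n₀ ≤-refl itc)
          new′ : ∀ i → i ≤ n₀ → ¬ Iter i s
          new′ i i≤n₀ it with m≤n⇒m<n∨m≡n i≤n₀
          ... | inj₁ i<n₀ = new (subst (i <_) (sym j≡n₀) i<n₀) it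
          ... | inj₂ refl = c≢s (iter-functional (subst (λ m → Iter m c) j≡n₀ itc) it)
        ...   | inj₂ (ne′ , run′) with fuel
        ...     | zero = contradiction (trans (first≡ c) (trans c≡w′ (sym (third≡ c)))) ne′
          where
          c≡w′ : c ≡ w
          c≡w′ = iter-functional (subst (λ m → Iter m c) (trans (sym (+-identityʳ j)) j+fuel) itc) itw
        ...     | suc fuel′
          with ⇓foundTuple (k + (k + (k + n))) k le d₂ t (c ⊕ σ)
             | iter-prefix itw (subst (suc j ≤_) (trans (sym (+-suc j fuel′)) j+fuel) (m≤m+n (suc j) fuel′))
        ...       | inj₂ (none , _) | c′ , succ itc′ e with iter-functional itc itc′
        ...         | refl = contradiction (Equivalence.from (R₂⇔ c′ c s w ρ) e) (none c′)
        ⇓seenLoop fuel j c j+fuel itc new | inj₂ (ne , run) | inj₂ (ne′ , run′) | suc fuel′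
                  | inj₁ (c″ , r , run″) | _
          with ⇓seenLoop fuel′ (suc j) c″ (trans (sym (+-suc j fuel′)) j+fuel)
                 (succ itc (Equivalence.to (R₂⇔ c″ c s w ρ) r)) new′
          where
          new′ : ∀ {i} → i < suc j → ¬ Iter i s
          new′ i<1+j it with m≤n⇒m<n∨m≡n (≤-pred i<1+j)
          ... | inj₁ i<j = new i<j it
          ... | inj₂ refl = ne (trans (first≡ c) (trans (iter-functional itc it) (sym (second≡ c))))
        ... | inj₁ (yep , c‴ , rest) = inj₁ (yep , c‴ ,
          ⇓loop (⇓bind run (⇓bind run′ (⇓bind run″ (⇓bind (⇓collapse c″ c σ le) ⇓ret)))) rest)
        ... | inj₂ (nope , c‴ , rest) = inj₂ ((λ {i} → nope {i}) , c‴ ,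
          ⇓loop (⇓bind run (⇓bind run′ (⇓bind run″ (⇓bind (⇓collapse c″ c σ le) ⇓ret)))) rest)

        ⇓seen : SeenBy λ b → seen ∋ home (s ⊕ w ⊕ ρ) ⇓ b , home (s ⊕ w ⊕ ρ)
        ⇓seen = [ (λ { (yep , c , run) → inj₁ (yep , finish c run) })
                , (λ { (nope , c , run) → inj₂ ((λ {i} → nope {i}) , finish c run) }) ]′
                (⇓seenLoop n₀ 0 (tabulate (ρ ∘ A)) refl base λ ())
          where
          A≡ : tabulate ((s ⊕ w ⊕ ρ) ∘ (k ↑ʳ_) ∘ (k ↑ʳ_) ∘ A) ≡ tabulate (ρ ∘ A)
          A≡ = blockₛ s ((k ↑ʳ_) ∘ A) (blockₛ w A refl)
          finish : ∀ {b} (c : Vec (Nd t) k) →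
            seenLoop ∋ home (tabulate (ρ ∘ A) ⊕ σ) ⇓ b , home (c ⊕ σ) → seen ∋ home σ ⇓ b , home σ
          finish {b} c run = ⇓bind
            (subst (λ v → copy ((k ↑ʳ_) ∘ (k ↑ʳ_) ∘ A) ∋ home σ ⇓ zero , home (v ⊕ σ)) A≡
              (⇓copy σ ((k ↑ʳ_) ∘ (k ↑ʳ_) ∘ A) le₃))
            (⇓bind run (⇓pop c σ ⇓ret))

      b₀ : Vec (Nd t) k
      b₀ = tabulate (ρ ∘ B)

      ReachedBy : (Fin 2 → Set) → Set
      ReachedBy run = (Star (E t ρ) (tabulate (ρ ∘ A)) b₀ × run true) ⊎
                      (¬ Star (E t ρ) (tabulate (ρ ∘ A)) b₀ × run false)

      -- The iterates up to `n₀` are distinct, so `n₀` stays below the bound on the number of tuples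
      -- and `fuel` is what remains. If there is no successor, or if it has been seen, the orbit is
      -- exhausted without `b₀` (`iter-stuck`, `iter-cycle`).
      ⇓walkLoop : ∀ fuel n₀ w → n₀ + fuel ≡ proj₁ (tupleIndex t k) → Iter n₀ w → Distinct n₀ →
        (∀ {i} → i < n₀ → ¬ Iter i b₀) →
        ReachedBy λ b → ∃ λ (w′ : Vec (Nd t) k) → walkLoop ∋ home (w ⊕ ρ) ⇓ b , home (w′ ⊕ ρ)
      ⇓walkLoop fuel n₀ w n₀+fuel itw dist new with spec w≡B t (w ⊕ ρ)
      ... | inj₁ (e , run) = inj₁ (subst (Star (E t ρ) _) w≡ (iter⇒star itw) , w , ⇓exit (⇓bind run ⇓ret))
        where
        w≡ : w ≡ b₀
        w≡ = trans (sym (block₀ w ρ)) (trans e (blockₛ w B refl))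
      ... | inj₂ (ne , run) with ⇓foundTuple (k + n) k le₂ d₁ t (w ⊕ ρ)
      ...   | inj₂ (none , run′) = inj₂ (absent , w , ⇓exit (⇓bind run (⇓bind run′ ⇓ret)))
        where
        absent : ¬ Star (E t ρ) (tabulate (ρ ∘ A)) b₀
        absent st with star⇒iter st
        ... | j , itⱼ with m≤n⇒m<n∨m≡n (iter-stuck itw (λ s e → none s (Equivalence.from (R₁⇔ s w ρ) e)) itⱼ)
        ...   | inj₁ j<n₀ = new j<n₀ itⱼ
        ...   | inj₂ refl = ne (trans (block₀ w ρ) (trans (iter-functional itw itⱼ) (sym (blockₛ w B refl))))
      ...   | inj₁ (s , r , run′) with ⇓seen {w} {s} itw dist
      ...     | inj₁ (again , run″) =
        inj₂ (absent , w , ⇓exit (⇓bind run (⇓bind run′ (⇓bind run″ (⇓pop s (w ⊕ ρ) ⇓ret)))))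
        where
        absent : ¬ Star (E t ρ) (tabulate (ρ ∘ A)) b₀
        absent st with star⇒iter st
        ... | j , itⱼ with iter-cycle (succ itw (Equivalence.to (R₁⇔ s w ρ) r)) again itⱼ
        ...   | i , i≤n₀ , it with m≤n⇒m<n∨m≡n i≤n₀
        ...     | inj₁ i<n₀ = new i<n₀ it
        ...     | inj₂ refl = ne (trans (block₀ w ρ) (trans (iter-functional itw it) (sym (blockₛ w B refl))))
      ...     | inj₂ (fresh , run″) with fuel
      ...       | zero = contradiction
                    (distinct-bound (proj₁ (proj₂ (tupleIndex t k))) (proj₂ (proj₂ (tupleIndex t k))) itw dist)
                    (<-irrefl (trans (sym (+-identityʳ n₀)) n₀+fuel))
      ...       | suc fuel′
        with ⇓walkLoop fuel′ (suc n₀) s (trans (sym (+-suc n₀ fuel′)) n₀+fuel) its dist′ new′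
        where
        its : Iter (suc n₀) s
        its = succ itw (Equivalence.to (R₁⇔ s w ρ) r)
        dist′ : Distinct (suc n₀)
        dist′ i<j j≤ itᵢ itⱼ with m≤n⇒m<n∨m≡n j≤
        ... | inj₁ j<  = dist i<j (≤-pred j<) itᵢ itⱼ
        ... | inj₂ refl with iter-functional its itⱼ
        ...   | refl = fresh (≤-pred i<j) itᵢ
        new′ : ∀ {i} → i < suc n₀ → ¬ Iter i b₀
        new′ i< it with m≤n⇒m<n∨m≡n (≤-pred i<)
        ... | inj₁ i<n₀ = new i<n₀ it
        ... | inj₂ refl = ne (trans (block₀ w ρ) (trans (iter-functional itw it) (sym (blockₛ w B refl))))
      ...         | inj₁ (st , w′ , rest) =
        inj₁ (st , w′ , ⇓loop (⇓bind run (⇓bind run′ (⇓bind run″ (⇓bind (⇓collapse s w ρ le₂) ⇓ret)))) rest)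
      ...         | inj₂ (¬st , w′ , rest) =
        inj₂ (¬st , w′ , ⇓loop (⇓bind run (⇓bind run′ (⇓bind run″ (⇓bind (⇓collapse s w ρ le₂) ⇓ret)))) rest)

      ⇓walk : ReachedBy λ b → walk ∋ home ρ ⇓ b , home ρ
      ⇓walk = [ (λ { (st , w , run) → inj₁ (st , finish w run) })
              , (λ { (¬st , w , run) → inj₂ (¬st , finish w run) }) ]′
        (⇓walkLoop (proj₁ (tupleIndex t k)) 0 (tabulate (ρ ∘ A)) refl base
          (λ i<j j≤0 _ _ → contradiction (≤-trans i<j j≤0) λ ()) λ ())
        where
        finish : ∀ {b} (w : Vec (Nd t) k) →
          walkLoop ∋ home (tabulate (ρ ∘ A) ⊕ ρ) ⇓ b , home (w ⊕ ρ) → walk ∋ home ρ ⇓ b , home ρ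
        finish w run = ⇓bind (⇓copy ρ A le₁) (⇓bind run (⇓pop w ρ ⇓ret))

    decides-closure : Decides n λ t ρ → Star (E t ρ) (tabulate (ρ ∘ A)) (tabulate (ρ ∘ B))
    decides-closure = decides walk λ t ρ → ⇓walk ρ

-- Valuations up to pointwise equality, and renamings.

module Logic (Sig : RankedAlphabet) where

  open Trees Sig

  _⊢_,_ : ∀ {k m} → Formula Sig k m → (t : Tr) → (Fin m → Nd t) → Set
  φ ⊢ t , ρ = ⟦_⟧ Sig φ t ρ

  _⊞_ : ∀ {A : Set} {k m} → Vec A k → (Fin m → A) → Fin (k + m) → A
  _⊞_ = _++ₑ_ Sig

  infixr 5 _⊞_

  _≗ₑ_ : ∀ {A : Set} {m} → (Fin m → A) → (Fin m → A) → Set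
  ρ ≗ₑ ρ′ = ∀ i → ρ i ≡ ρ′ i

  ≗ₑ-sym : ∀ {A : Set} {m} {ρ ρ′ : Fin m → A} → ρ ≗ₑ ρ′ → ρ′ ≗ₑ ρ
  ≗ₑ-sym e i = sym (e i)

  ∷ₑ-cong : ∀ {A : Set} {m} (x : A) {ρ ρ′ : Fin m → A} → ρ ≗ₑ ρ′ → _∷ₑ_ Sig x ρ ≗ₑ _∷ₑ_ Sig x ρ′
  ∷ₑ-cong x e zero = refl
  ∷ₑ-cong x e (suc i) = e i

  ⊞-cong : ∀ {A : Set} {k m} (v : Vec A k) {ρ ρ′ : Fin m → A} → ρ ≗ₑ ρ′ → (v ⊞ ρ) ≗ₑ (v ⊞ ρ′)
  ⊞-cong {k = k} v e i with splitAt k i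
  ... | inj₁ j = refl
  ... | inj₂ j = e j

  ⊞-∷ : ∀ {A : Set} {k m} (x : A) (v : Vec A k) (ρ : Fin m → A) → ((x ∷ v) ⊞ ρ) ≗ₑ _∷ₑ_ Sig x (v ⊞ ρ)
  ⊞-∷ x v ρ zero = refl
  ⊞-∷ {k = k} x v ρ (suc i) with splitAt k i
  ... | inj₁ j = refl
  ... | inj₂ j = refl

  -- Valuations are functions and are compared pointwise, without function extensionality; this is
  -- the transport along such an equality.
  ⊢-cong : ∀ {k m t} {ρ ρ′ : Fin m → Nd t} (φ : Formula Sig k m) → ρ ≗ₑ ρ′ → φ ⊢ t , ρ → φ ⊢ t , ρ′
  ⊢-cong (D.lab σ x) e h = trans (cong lbl (sym (e x))) h
  ⊢-cong (D.edg i x y) e h = subst₂ (Edg i) (e x) (e y) h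
  ⊢-cong (D.leq x y) e h = subst₂ Ancestor (e x) (e y) h
  ⊢-cong (D.eq x y) e h = trans (sym (e x)) (trans h (e y))
  ⊢-cong (D.neg φ) e h = h ∘ ⊢-cong φ (≗ₑ-sym e)
  ⊢-cong (D.and φ ψ) e (h , h′) = ⊢-cong φ e h , ⊢-cong ψ e h′
  ⊢-cong (D.or φ ψ) e (inj₁ h) = inj₁ (⊢-cong φ e h)
  ⊢-cong (D.or φ ψ) e (inj₂ h) = inj₂ (⊢-cong ψ e h)
  ⊢-cong (D.ex φ) e (x , h) = x , ⊢-cong φ (∷ₑ-cong x e) h
  ⊢-cong (D.all φ) e h x = ⊢-cong φ (∷ₑ-cong x e) (h x)
  ⊢-cong (D.tc φ us vs) e h = subst₂ (Star _) (tabulate-cong (e ∘ us)) (tabulate-cong (e ∘ vs))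
    (gmap id (λ {u} {v} → ⊢-cong φ (⊞-cong u (⊞-cong v e))) h)

  ⊢-⇔ : ∀ {k m t} {ρ ρ′ : Fin m → Nd t} (φ : Formula Sig k m) → ρ ≗ₑ ρ′ → φ ⊢ t , ρ ⇔ φ ⊢ t , ρ′
  ⊢-⇔ φ e = mk⇔ (⊢-cong φ e) (⊢-cong φ (≗ₑ-sym e))

  lift : ∀ {m n} → (Fin m → Fin n) → Fin (suc m) → Fin (suc n)
  lift f zero = zero
  lift f (suc i) = suc (f i)

  lift-∷ₑ : ∀ {A : Set} {m n} (f : Fin m → Fin n) (x : A) (ρ : Fin n → A) →
    (_∷ₑ_ Sig x ρ ∘ lift f) ≗ₑ _∷ₑ_ Sig x (ρ ∘ f)
  lift-∷ₑ f x ρ zero = refl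
  lift-∷ₑ f x ρ (suc i) = refl

  append : ∀ {k m n} → (Fin k → Fin n) → (Fin m → Fin n) → Fin (k + m) → Fin n
  append {k} f g i = [ f , g ]′ (splitAt k i)

  append-⊞ : ∀ {A : Set} {k m n} (ρ : Fin n → A) (f : Fin k → Fin n) (g : Fin m → Fin n)
    (v : Vec A k) {ρ′ : Fin m → A} →
    (∀ i → ρ (f i) ≡ lookup v i) → (ρ ∘ g) ≗ₑ ρ′ → (ρ ∘ append f g) ≗ₑ (v ⊞ ρ′)
  append-⊞ {k = k} ρ f g v e e′ i with splitAt k i
  ... | inj₁ j = e j
  ... | inj₂ j = e′ j

-- From formulas to automata.

module Evaluators (Sig : RankedAlphabet) (k′ : ℕ) where

  open Trees Sig
  open Logic Sig

  k : ℕ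
  k = suc k′

  Decidesᴺ : (N n : ℕ) → ((t : Tr) → (Fin n → Nd t) → Set) → Set
  Decidesᴺ N = Evaluation.Decides Sig k′ N

  -- For all renamings, since the formula of a transitive closure is evaluated at
  -- several positions of the stack.
  Evaluable : ∀ {m} → Formula Sig k m → Set
  Evaluable {m} φ = ∀ {n} (f : Fin m → Fin n) →
    ∃ λ N₀ → ∀ N → N₀ ≤ N → Decidesᴺ N n λ t ρ → φ ⊢ t , (ρ ∘ f)

  module _ {N : ℕ} where
    open Evaluation Sig k′ N public
      using (decides-lab; decides-edge; decides-anc; decides-eq; decides-¬; decides-×; decides-⊎;
             decides-∃; decides-∀; decides-cong)

  open Evaluation Sig k′ 0 using (_⊕_; ⊕-↑ˡ; ⊕-↑ʳ)

  module _ {m n : ℕ} (φ : Formula Sig k (k + (k + m))) (f : Fin m → Fin n) where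

    private
      E : ∀ t → (Fin n → Nd t) → Vec (Nd t) k → Vec (Nd t) k → Set
      E t ρ u v = φ ⊢ t , (u ⊞ v ⊞ ρ ∘ f)

    fst : ∀ j → Fin k → Fin (k + j)
    fst j i = i ↑ˡ j

    snd : ∀ j → Fin k → Fin (k + (k + j))
    snd j i = k ↑ʳ (i ↑ˡ j)

    params₁ : Fin m → Fin (k + (k + n))
    params₁ i = k ↑ʳ (k ↑ʳ f i)

    params₂ : Fin m → Fin (k + (k + (k + (k + n))))
    params₂ i = k ↑ʳ (k ↑ʳ (k ↑ʳ (k ↑ʳ f i)))

    -- The formula lists the current tuple before the next one, whereas on the stack the next tuple,
    -- found last, lies on top: the two blocks are exchanged.
    arrange₁ : Fin (k + (k + m)) → Fin (k + (k + n))
    arrange₁ = append {k} {k + m} (snd n) (append {k} {m} (fst (k + n)) params₁)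

    -- The same exchange for the second walk; the parameters now lie below two more tuples, which
    -- are skipped.
    arrange₂ : Fin (k + (k + m)) → Fin (k + (k + (k + (k + n))))
    arrange₂ = append {k} {k + m} (snd (k + (k + n))) (append {k} {m} (fst (k + (k + (k + n)))) params₂)

    arrange₁-correct : ∀ {t} (v w : Vec (Nd t) k) (ρ : Fin n → Nd t) →
      φ ⊢ t , ((v ⊕ w ⊕ ρ) ∘ arrange₁) ⇔ E t ρ w v
    arrange₁-correct v w ρ = ⊢-⇔ φ
      (append-⊞ {k = k} {k + m} (v ⊕ w ⊕ ρ) (snd n) (append {k} {m} (fst (k + n)) params₁) w
        (λ i → trans (⊕-↑ʳ v (w ⊕ ρ) (i ↑ˡ n)) (⊕-↑ˡ w ρ i))
      (append-⊞ {k = k} {m} (v ⊕ w ⊕ ρ) (fst (k + n)) params₁ v (⊕-↑ˡ v (w ⊕ ρ))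
      λ i → trans (⊕-↑ʳ v (w ⊕ ρ) (k ↑ʳ f i)) (⊕-↑ʳ w ρ (f i))))

    arrange₂-correct : ∀ {t} (v c s w : Vec (Nd t) k) (ρ : Fin n → Nd t) →
      φ ⊢ t , ((v ⊕ c ⊕ s ⊕ w ⊕ ρ) ∘ arrange₂) ⇔ E t ρ c v
    arrange₂-correct v c s w ρ = ⊢-⇔ φ
      (append-⊞ {k = k} {k + m} (v ⊕ c ⊕ s ⊕ w ⊕ ρ) (snd (k + (k + n)))
        (append {k} {m} (fst (k + (k + (k + n)))) params₂) c
        (λ i → trans (⊕-↑ʳ v (c ⊕ s ⊕ w ⊕ ρ) (i ↑ˡ _)) (⊕-↑ˡ c (s ⊕ w ⊕ ρ) i))
      (append-⊞ {k = k} {m} (v ⊕ c ⊕ s ⊕ w ⊕ ρ) (fst (k + (k + (k + n)))) params₂ v (⊕-↑ˡ v (c ⊕ s ⊕ w ⊕ ρ))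
      λ i → trans (⊕-↑ʳ v (c ⊕ s ⊕ w ⊕ ρ) (k ↑ʳ (k ↑ʳ (k ↑ʳ f i))))
           (trans (⊕-↑ʳ c (s ⊕ w ⊕ ρ) (k ↑ʳ (k ↑ʳ f i)))
           (trans (⊕-↑ʳ s (w ⊕ ρ) (k ↑ʳ f i)) (⊕-↑ʳ w ρ (f i))))))

    decides-tc : Functional Sig φ → (us vs : Fin k → Fin m) → ∀ {N} → k + (k + (k + (k + n))) ≤ N →
      Decidesᴺ N (k + (k + n)) (λ t ρ → φ ⊢ t , (ρ ∘ arrange₁)) →
      Decidesᴺ N (k + (k + (k + (k + n)))) (λ t ρ → φ ⊢ t , (ρ ∘ arrange₂)) →
      Decidesᴺ N n (λ t ρ → D.tc φ us vs ⊢ t , (ρ ∘ f))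
    decides-tc functional us vs {N} le d₁ d₂ =
      Closure.decides-closure Sig k′ N E (λ {t} {ρ} {u} {v} {v′} → functional t (ρ ∘ f) u v v′)
        (f ∘ us) (f ∘ vs) le d₁ arrange₁-correct d₂ arrange₂-correct

  evaluable : ∀ {m} (φ : Formula Sig k m) → IsDTC Sig φ → Evaluable φ
  evaluable (D.lab σ x) d {n} f = n , λ N le → decides-lab le σ (f x)
  evaluable (D.edg i x y) d {n} f = n , λ N le → decides-edge le i (f x) (f y)
  evaluable (D.leq x y) d {n} f = n , λ N le → decides-anc le (f x) (f y)
  evaluable (D.eq x y) d {n} f = n , λ N le → decides-eq le (f x) (f y)
  evaluable (D.neg φ) d f with evaluable φ d f
  ... | N₀ , ev = N₀ , λ N le → decides-¬ (ev N le)
  evaluable (D.and φ ψ) (d , d′) f with evaluable φ d f | evaluable ψ d′ f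
  ... | N₀ , ev | N₁ , ev′ = N₀ + N₁ , λ N le →
    decides-× (ev N (≤-trans (m≤m+n N₀ N₁) le)) (ev′ N (≤-trans (m≤n+m N₁ N₀) le))
  evaluable (D.or φ ψ) (d , d′) f with evaluable φ d f | evaluable ψ d′ f
  ... | N₀ , ev | N₁ , ev′ = N₀ + N₁ , λ N le →
    decides-⊎ (ev N (≤-trans (m≤m+n N₀ N₁) le)) (ev′ N (≤-trans (m≤n+m N₁ N₀) le))
  evaluable (D.ex φ) d {n} f with evaluable φ d (lift f)
  ... | N₀ , ev = suc n + N₀ , λ N le → decides-cong
    (λ t ρ → mk⇔ (λ (x , h) → x , ⊢-cong φ (lift-∷ₑ f x ρ) h)
                 (λ (x , h) → x , ⊢-cong φ (≗ₑ-sym (lift-∷ₑ f x ρ)) h))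
    (decides-∃ (≤-trans (m≤m+n (suc n) N₀) le) (ev N (≤-trans (m≤n+m N₀ (suc n)) le)))
  evaluable (D.all φ) d {n} f with evaluable φ d (lift f)
  ... | N₀ , ev = suc n + N₀ , λ N le → decides-cong
    (λ t ρ → mk⇔ (λ h x → ⊢-cong φ (lift-∷ₑ f x ρ) (h x))
                 (λ h x → ⊢-cong φ (≗ₑ-sym (lift-∷ₑ f x ρ)) (h x)))
    (decides-∀ (≤-trans (m≤m+n (suc n) N₀) le) (ev N (≤-trans (m≤n+m N₀ (suc n)) le)))
  evaluable (D.tc φ us vs) (functional , d) {n} f
    with evaluable φ d (arrange₁ φ f) | evaluable φ d (arrange₂ φ f)
  ... | N₁ , ev₁ | N₂ , ev₂ = (k + (k + (k + (k + n)))) + (N₁ + N₂) , λ N le →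
    decides-tc φ f functional us vs (≤-trans (m≤m+n _ (N₁ + N₂)) le)
      (ev₁ N (≤-trans (≤-trans (m≤m+n N₁ N₂) (m≤n+m (N₁ + N₂) (k + (k + (k + (k + n)))))) le))
      (ev₂ N (≤-trans (≤-trans (m≤n+m N₂ N₁) (m≤n+m (N₁ + N₂) (k + (k + (k + (k + n)))))) le))

  formula⇒automaton : (φ : Formula Sig k 0) → IsDTC Sig φ →
    Σ (PTWA Sig k) λ 𝒜 → Deterministic Sig 𝒜 × (∀ t → φ ⊢ t , (λ ()) ⇔ Accepts Sig 𝒜 t)
  formula⇒automaton φ d with evaluable φ d {0} (λ ())
  ... | N , ev = automaton , deterministic , λ t → mk⇔ (accept t) (sound t)
    where
    open Evaluation.Decides (ev N ≤-refl) renaming (prog to p)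
    open Machines Sig k′ (suc N)
    open Automaton p
    ⊢-closed : ∀ {t} {ρ : Fin 0 → Nd t} → φ ⊢ t , ρ → φ ⊢ t , (λ ())
    ⊢-closed = ⊢-cong φ λ ()
    accept : ∀ t → φ ⊢ t , (λ ()) → Accepts Sig automaton t
    accept t h with spec t (λ ())
    ... | inj₁ (_ , r) = _ , x∈⁅x⁆ _ , run r , exit-halts
    ... | inj₂ (¬h , _) = contradiction (⊢-cong φ (λ ()) h) ¬h
    sound : ∀ t → Accepts Sig automaton t → φ ⊢ t , (λ ())
    sound t (q , q∈ , r , halts) with spec t (λ ())
    ... | inj₁ (h , _) = ⊢-closed h
    -- If the formula failed, the run to exit 0 would halt as well; the two halting configurations
    -- would coincide, although exits 0 and 1 have different codes.
    ... | inj₂ (_ , r′)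
      with Determinism.halting-unique Sig k′ automaton deterministic r (run r′) halts exit-halts
    ...   | e = contradiction (trans (sym (x∈⁅y⁆⇒x≡y (code (inj₂ (suc zero))) q∈)) (cong proj₁ e)) λ e′ →
      contradiction
        (trans (sym (decode-code (inj₂ (suc zero)))) (trans (cong decode e′) (decode-code (inj₂ zero))))
        λ ()

-- Relations definable in FO+DTC and their closure properties.

module Definability (Sig : RankedAlphabet) (k : ℕ) where

  open Trees Sig
  open Logic Sig

  ⊞-↑ˡ : ∀ {A : Set} {j m} (v : Vec A j) (ρ : Fin m → A) i → (v ⊞ ρ) (i ↑ˡ m) ≡ lookup v i
  ⊞-↑ˡ {j = j} {m} v ρ i rewrite splitAt-↑ˡ j i m = refl

  ⊞-↑ʳ : ∀ {A : Set} {j m} (v : Vec A j) (ρ : Fin m → A) i → (v ⊞ ρ) (j ↑ʳ i) ≡ ρ i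
  ⊞-↑ʳ {j = j} {m} v ρ i rewrite splitAt-↑ʳ j m i = refl

  liftBlock : ∀ j {m n} → (Fin m → Fin n) → Fin (j + m) → Fin (j + n)
  liftBlock j {m} {n} f = append {j} {m} (_↑ˡ n) ((j ↑ʳ_) ∘ f)

  liftBlock-⊞ : ∀ {A : Set} {j m n} (f : Fin m → Fin n) (v : Vec A j) (ρ : Fin n → A) {ρ′ : Fin m → A} →
    (ρ ∘ f) ≗ₑ ρ′ → ((v ⊞ ρ) ∘ liftBlock j f) ≗ₑ (v ⊞ ρ′)
  liftBlock-⊞ {j = j} {n = n} f v ρ e = append-⊞ (v ⊞ ρ) (_↑ˡ n) ((j ↑ʳ_) ∘ f) v (⊞-↑ˡ v ρ)
    λ i → trans (⊞-↑ʳ v ρ (f i)) (e i)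

  rename : ∀ {m n} → (Fin m → Fin n) → Formula Sig k m → Formula Sig k n
  rename f (D.lab σ x) = D.lab σ (f x)
  rename f (D.edg i x y) = D.edg i (f x) (f y)
  rename f (D.leq x y) = D.leq (f x) (f y)
  rename f (D.eq x y) = D.eq (f x) (f y)
  rename f (D.neg φ) = D.neg (rename f φ)
  rename f (D.and φ ψ) = D.and (rename f φ) (rename f ψ)
  rename f (D.or φ ψ) = D.or (rename f φ) (rename f ψ)
  rename f (D.ex φ) = D.ex (rename (lift f) φ)
  rename f (D.all φ) = D.all (rename (lift f) φ)
  rename f (D.tc φ us vs) = D.tc (rename (liftBlock k (liftBlock k f)) φ) (f ∘ us) (f ∘ vs)

  open Equivalence using (to; from)

  ⊢-rename : ∀ {m n t} (φ : Formula Sig k m) (f : Fin m → Fin n) {ρ : Fin n → Nd t} →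
    rename f φ ⊢ t , ρ ⇔ φ ⊢ t , (ρ ∘ f)
  ⊢-rename-block : ∀ {m n t} (φ : Formula Sig k (k + (k + m))) (f : Fin m → Fin n) (ρ : Fin n → Nd t)
    (u v : Vec (Nd t) k) →
    rename (liftBlock k (liftBlock k f)) φ ⊢ t , (u ⊞ v ⊞ ρ) ⇔ φ ⊢ t , (u ⊞ v ⊞ ρ ∘ f)

  ⊢-rename (D.lab σ x) f = mk⇔ id id
  ⊢-rename (D.edg i x y) f = mk⇔ id id
  ⊢-rename (D.leq x y) f = mk⇔ id id
  ⊢-rename (D.eq x y) f = mk⇔ id id
  ⊢-rename (D.neg φ) f = mk⇔ (λ h → h ∘ from (⊢-rename φ f)) (λ h → h ∘ to (⊢-rename φ f))
  ⊢-rename (D.and φ ψ) f = mk⇔ (λ (h , h′) → to (⊢-rename φ f) h , to (⊢-rename ψ f) h′)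
                               (λ (h , h′) → from (⊢-rename φ f) h , from (⊢-rename ψ f) h′)
  ⊢-rename (D.or φ ψ) f = mk⇔ (map⊎ (to (⊢-rename φ f)) (to (⊢-rename ψ f)))
                              (map⊎ (from (⊢-rename φ f)) (from (⊢-rename ψ f)))
  ⊢-rename (D.ex φ) f {ρ} = mk⇔
    (λ (x , h) → x , ⊢-cong φ (lift-∷ₑ f x ρ) (to (⊢-rename φ (lift f)) h))
    (λ (x , h) → x , from (⊢-rename φ (lift f)) (⊢-cong φ (≗ₑ-sym (lift-∷ₑ f x ρ)) h))
  ⊢-rename (D.all φ) f {ρ} = mk⇔
    (λ h x → ⊢-cong φ (lift-∷ₑ f x ρ) (to (⊢-rename φ (lift f)) (h x)))
    (λ h x → from (⊢-rename φ (lift f)) (⊢-cong φ (≗ₑ-sym (lift-∷ₑ f x ρ)) (h x)))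
  ⊢-rename (D.tc φ us vs) f {ρ} = mk⇔ (gmap id λ {u} {v} → to (⊢-rename-block φ f ρ u v))
                                  (gmap id λ {u} {v} → from (⊢-rename-block φ f ρ u v))

  ⊢-rename-block φ f ρ u v = ⇔-trans (⊢-rename φ (liftBlock k (liftBlock k f)))
    (⊢-⇔ φ (liftBlock-⊞ (liftBlock k f) u (v ⊞ ρ) (liftBlock-⊞ f v ρ λ _ → refl)))

  rename-IsDTC : ∀ {m n} (φ : Formula Sig k m) (f : Fin m → Fin n) → IsDTC Sig φ → IsDTC Sig (rename f φ)
  rename-IsDTC (D.lab σ x) f d = d
  rename-IsDTC (D.edg i x y) f d = d
  rename-IsDTC (D.leq x y) f d = d
  rename-IsDTC (D.eq x y) f d = d
  rename-IsDTC (D.neg φ) f d = rename-IsDTC φ f d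
  rename-IsDTC (D.and φ ψ) f (d , d′) = rename-IsDTC φ f d , rename-IsDTC ψ f d′
  rename-IsDTC (D.or φ ψ) f (d , d′) = rename-IsDTC φ f d , rename-IsDTC ψ f d′
  rename-IsDTC (D.ex φ) f d = rename-IsDTC φ (lift f) d
  rename-IsDTC (D.all φ) f d = rename-IsDTC φ (lift f) d
  rename-IsDTC (D.tc φ us vs) f (functional , d) =
    (λ t ρ u v v′ h h′ → functional t (ρ ∘ f) u v v′
      (to (⊢-rename-block φ f ρ u v) h) (to (⊢-rename-block φ f ρ u v′) h′)) ,
    rename-IsDTC φ (liftBlock k (liftBlock k f)) d

  Rel : ℕ → Set₁
  Rel m = (t : Tr) → (Fin m → Nd t) → Set

  -- Pairs a formula with its meaning, so that formulas are built by operations on relations and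
  -- need not be inspected.
  record Def (m : ℕ) (R : Rel m) : Set where
    constructor def
    field
      formula : Formula Sig k m
      isDTC   : IsDTC Sig formula
      correct : ∀ t ρ → formula ⊢ t , ρ ⇔ R t ρ

  open Def public

  -- An arbitrary `R` might distinguish pointwise equal valuations; a definable one cannot, because
  -- its formula does not.
  def-resp : ∀ {m R} → Def m R → ∀ {t ρ ρ′} → ρ ≗ₑ ρ′ → R t ρ → R t ρ′
  def-resp d {t} {ρ} {ρ′} e r = to (correct d t ρ′) (⊢-cong (formula d) e (from (correct d t ρ) r))

  def-cong : ∀ {m R R′} → (∀ t ρ → R t ρ ⇔ R′ t ρ) → Def m R → Def m R′
  def-cong e d = def (formula d) (isDTC d) λ t ρ → ⇔-trans (correct d t ρ) (e t ρ)

  -- The quantifier supplies the variable, so that this is a formula even for `m = 0`.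
  def-⊤ : ∀ {m} → Def m λ _ _ → ⊤
  def-⊤ = def (D.all (D.eq zero zero)) tt λ t ρ → mk⇔ (λ _ → tt) (λ _ x → refl)

  def-¬ : ∀ {m R} → Def m R → Def m λ t ρ → ¬ R t ρ
  def-¬ d = def (D.neg (formula d)) (isDTC d) λ t ρ → mk⇔ (_∘ from (correct d t ρ)) (_∘ to (correct d t ρ))

  def-⊥ : ∀ {m} → Def m λ _ _ → ⊥
  def-⊥ = def-cong (λ _ _ → mk⇔ (λ f → f tt) λ ()) (def-¬ def-⊤)

  def-× : ∀ {m R S} → Def m R → Def m S → Def m λ t ρ → R t ρ × S t ρ
  def-× d e = def (D.and (formula d) (formula e)) (isDTC d , isDTC e) λ t ρ →
    mk⇔ (map× (to (correct d t ρ)) (to (correct e t ρ))) (map× (from (correct d t ρ)) (from (correct e t ρ)))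

  def-⊎ : ∀ {m R S} → Def m R → Def m S → Def m λ t ρ → R t ρ ⊎ S t ρ
  def-⊎ d e = def (D.or (formula d) (formula e)) (isDTC d , isDTC e) λ t ρ →
    mk⇔ (map⊎ (to (correct d t ρ)) (to (correct e t ρ))) (map⊎ (from (correct d t ρ)) (from (correct e t ρ)))

  def-∃ : ∀ {m R} → Def (suc m) R → Def m λ t ρ → Σ (Nd t) λ x → R t (_∷ₑ_ Sig x ρ)
  def-∃ d = def (D.ex (formula d)) (isDTC d) λ t ρ →
    mk⇔ (λ (x , h) → x , to (correct d t _) h) (λ (x , h) → x , from (correct d t _) h)

  def-∀ : ∀ {m R} → Def (suc m) R → Def m λ t ρ → (x : Nd t) → R t (_∷ₑ_ Sig x ρ)
  def-∀ d = def (D.all (formula d)) (isDTC d) λ t ρ →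
    mk⇔ (λ h x → to (correct d t _) (h x)) (λ h x → from (correct d t _) (h x))

  def-Dec : ∀ {m} {P : Set} → Dec P → Def m λ _ _ → P
  def-Dec (yes p) = def-cong (λ _ _ → mk⇔ (λ _ → p) λ _ → tt) def-⊤
  def-Dec (no ¬p) = def-cong (λ _ _ → mk⇔ (λ ()) ¬p) def-⊥

  def-Any : ∀ {m} {A : Set} {R : A → Rel m} (xs : List A) → (∀ x → Def m (R x)) →
    Def m λ t ρ → ∃ λ x → x ∈ xs × R x t ρ
  def-Any [] d = def-cong (λ _ _ → mk⇔ (λ ()) λ { (_ , () , _) }) def-⊥
  def-Any (x ∷ xs) d = def-cong
    (λ _ _ → mk⇔ [ (λ r → x , here refl , r) , (λ (y , m , r) → y , there m , r) ]′
                 λ { (_ , here refl , r) → inj₁ r ; (y , there m , r) → inj₂ (y , m , r) })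
    (def-⊎ (d x) (def-Any xs d))

  def-∀Fin : ∀ {m} j {R : Fin j → Rel m} → (∀ i → Def m (R i)) → Def m λ t ρ → ∀ i → R i t ρ
  def-∀Fin zero d = def-cong (λ _ _ → mk⇔ (λ _ ()) λ _ → tt) def-⊤
  def-∀Fin (suc j) d = def-cong
    (λ _ _ → mk⇔ (λ { (r , rs) zero → r ; (r , rs) (suc i) → rs i }) λ r → r zero , r ∘ suc)
    (def-× (d zero) (def-∀Fin j (d ∘ suc)))

  def-∃Vec : ∀ {m} j {R} → Def (j + m) R → Def m λ t ρ → Σ (Vec (Nd t) j) λ v → R t (v ⊞ ρ)
  def-∃Vec zero d = def-cong
    (λ t ρ → mk⇔ (λ r → [] , def-resp d (λ _ → refl) r) λ { ([] , r) → def-resp d (λ _ → refl) r }) d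
  def-∃Vec (suc j) d = def-cong
    (λ t ρ → mk⇔ (λ { (v , x , r) → x ∷ v , def-resp d (≗ₑ-sym (⊞-∷ x v ρ)) r })
                 λ { (x ∷ v , r) → v , x , def-resp d (⊞-∷ x v ρ) r })
    (def-∃Vec j (def-∃ d))

  Rel₂ : ℕ → Set₁
  Rel₂ m = (t : Tr) → (u v : Vec (Nd t) k) → (Fin m → Nd t) → Set

  record Def₂ (m : ℕ) (R : Rel₂ m) : Set where
    constructor def₂
    field
      formula₂ : Formula Sig k (k + (k + m))
      isDTC₂   : IsDTC Sig formula₂
      correct₂ : ∀ t u v ρ → formula₂ ⊢ t , (u ⊞ v ⊞ ρ) ⇔ R t u v ρ

  open Def₂ public

  fst : ∀ {m} → Fin k → Fin (k + (k + m))
  fst {m} i = i ↑ˡ (k + m)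

  snd : ∀ {m} → Fin k → Fin (k + (k + m))
  snd {m} i = k ↑ʳ (i ↑ˡ m)

  par : ∀ {m} → Fin m → Fin (k + (k + m))
  par i = k ↑ʳ (k ↑ʳ i)

  module _ {t : Tr} {m : ℕ} (u v : Vec (Nd t) k) (ρ : Fin m → Nd t) where

    fst≡ : ∀ i → (u ⊞ v ⊞ ρ) (fst i) ≡ lookup u i
    fst≡ = ⊞-↑ˡ u (v ⊞ ρ)

    snd≡ : ∀ i → (u ⊞ v ⊞ ρ) (snd i) ≡ lookup v i
    snd≡ i = trans (⊞-↑ʳ u (v ⊞ ρ) (i ↑ˡ m)) (⊞-↑ˡ v ρ i)

    par≡ : ∀ i → (u ⊞ v ⊞ ρ) (par i) ≡ ρ i
    par≡ i = trans (⊞-↑ʳ u (v ⊞ ρ) (k ↑ʳ i)) (⊞-↑ʳ v ρ i)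

  def⇒def₂ : ∀ {m R} {R₂ : Rel₂ m} → Def (k + (k + m)) R →
    (∀ t u v ρ → R t (u ⊞ v ⊞ ρ) ⇔ R₂ t u v ρ) → Def₂ m R₂
  def⇒def₂ d e = def₂ (formula d) (isDTC d) λ t u v ρ → ⇔-trans (correct d t (u ⊞ v ⊞ ρ)) (e t u v ρ)

  def₂-at : ∀ {m n R} → Def₂ m R → (f g : Fin k → Fin n) (h : Fin m → Fin n) →
    Def n λ t ρ → R t (tabulate (ρ ∘ f)) (tabulate (ρ ∘ g)) (ρ ∘ h)
  def₂-at {m} {n} d f g h = def
    (rename choose (formula₂ d)) (rename-IsDTC (formula₂ d) choose (isDTC₂ d)) λ t ρ →
    ⇔-trans (⊢-rename (formula₂ d) choose)
    (⇔-trans (⊢-⇔ (formula₂ d)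
      (append-⊞ ρ f (append {k} {m} g h) (tabulate (ρ ∘ f)) (λ i → sym (lookup∘tabulate (ρ ∘ f) i))
      (append-⊞ ρ g h (tabulate (ρ ∘ g)) (λ i → sym (lookup∘tabulate (ρ ∘ g) i)) λ _ → refl)))
    (correct₂ d t (tabulate (ρ ∘ f)) (tabulate (ρ ∘ g)) (ρ ∘ h)))
    where
    choose : Fin (k + (k + m)) → Fin n
    choose = append {k} {k + m} f (append {k} {m} g h)

  def₂-resp : ∀ {m R} → Def₂ m R → ∀ {t u u′ v v′ ρ ρ′} → u ≡ u′ → v ≡ v′ → ρ ≗ₑ ρ′ → R t u v ρ → R t u′ v′ ρ′
  def₂-resp d {t} {u} {v = v} {ρ = ρ} {ρ′} refl refl e r = to (correct₂ d t u v ρ′)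
    (⊢-cong (formula₂ d) (⊞-cong u (⊞-cong v e)) (from (correct₂ d t u v ρ) r))

  def₂-cong : ∀ {m R R′} → (∀ t u v ρ → R t u v ρ ⇔ R′ t u v ρ) → Def₂ m R → Def₂ m R′
  def₂-cong e d = def₂ (formula₂ d) (isDTC₂ d) λ t u v ρ → ⇔-trans (correct₂ d t u v ρ) (e t u v ρ)

  tabulate≡ : ∀ {A : Set} {n} (f : Fin n → A) {v : Vec A n} → (∀ i → f i ≡ lookup v i) → tabulate f ≡ v
  tabulate≡ f {v} e = trans (tabulate-cong e) (tabulate∘lookup v)

  def₂⇒def : ∀ {m R} → Def₂ m R →
    Def (k + (k + m)) λ t ρ → R t (tabulate (ρ ∘ fst)) (tabulate (ρ ∘ snd)) (ρ ∘ par)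
  def₂⇒def d = def₂-at d fst snd par

  def₂⇒def-correct : ∀ {m R} → Def₂ m R → ∀ t u v ρ →
    R t (tabulate ((u ⊞ v ⊞ ρ) ∘ fst)) (tabulate ((u ⊞ v ⊞ ρ) ∘ snd)) ((u ⊞ v ⊞ ρ) ∘ par) ⇔ R t u v ρ
  def₂⇒def-correct d t u v ρ = mk⇔
    (def₂-resp d (tabulate≡ _ (fst≡ u v ρ)) (tabulate≡ _ (snd≡ u v ρ)) (par≡ u v ρ))
    (def₂-resp d (sym (tabulate≡ _ (fst≡ u v ρ))) (sym (tabulate≡ _ (snd≡ u v ρ))) (≗ₑ-sym (par≡ u v ρ)))

  def₂-⊥ : ∀ {m} → Def₂ m λ _ _ _ _ → ⊥
  def₂-⊥ = def⇒def₂ def-⊥ λ _ _ _ _ → mk⇔ id id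

  def₂-Dec : ∀ {m} {P : Set} → Dec P → Def₂ m λ _ _ _ _ → P
  def₂-Dec p = def⇒def₂ (def-Dec p) λ _ _ _ _ → mk⇔ id id

  def₂-¬ : ∀ {m R} → Def₂ m R → Def₂ m λ t u v ρ → ¬ R t u v ρ
  def₂-¬ d = def₂ (D.neg (formula₂ d)) (isDTC₂ d) λ t u v ρ →
    mk⇔ (_∘ from (correct₂ d t u v ρ)) (_∘ to (correct₂ d t u v ρ))

  def₂-× : ∀ {m R S} → Def₂ m R → Def₂ m S → Def₂ m λ t u v ρ → R t u v ρ × S t u v ρ
  def₂-× d e = def₂ (D.and (formula₂ d) (formula₂ e)) (isDTC₂ d , isDTC₂ e) λ t u v ρ →
    mk⇔ (map× (to (correct₂ d t u v ρ)) (to (correct₂ e t u v ρ)))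
        (map× (from (correct₂ d t u v ρ)) (from (correct₂ e t u v ρ)))

  def₂-⊎ : ∀ {m R S} → Def₂ m R → Def₂ m S → Def₂ m λ t u v ρ → R t u v ρ ⊎ S t u v ρ
  def₂-⊎ d e = def₂ (D.or (formula₂ d) (formula₂ e)) (isDTC₂ d , isDTC₂ e) λ t u v ρ →
    mk⇔ (map⊎ (to (correct₂ d t u v ρ)) (to (correct₂ e t u v ρ)))
        (map⊎ (from (correct₂ d t u v ρ)) (from (correct₂ e t u v ρ)))

  def₂-Any : ∀ {m} {A : Set} {R : A → Rel₂ m} (xs : List A) → (∀ x → Def₂ m (R x)) →
    Def₂ m λ t u v ρ → ∃ λ x → x ∈ xs × R x t u v ρ
  def₂-Any [] d = def₂-cong (λ _ _ _ _ → mk⇔ (λ ()) λ { (_ , () , _) }) def₂-⊥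
  def₂-Any (x ∷ xs) d = def₂-cong
    (λ _ _ _ _ → mk⇔ [ (λ r → x , here refl , r) , (λ (y , m , r) → y , there m , r) ]′
                     λ { (_ , here refl , r) → inj₁ r ; (y , there m , r) → inj₂ (y , m , r) })
    (def₂-⊎ (d x) (def₂-Any xs d))

  def₂-∃Fin : ∀ {m} j {R : Fin j → Rel₂ m} → (∀ i → Def₂ m (R i)) → Def₂ m λ t u v ρ → ∃ λ i → R i t u v ρ
  def₂-∃Fin j d = def₂-cong (λ _ _ _ _ → mk⇔ (λ (i , _ , r) → i , r) λ (i , r) → i , ∈-allFin i , r)
    (def₂-Any (allFin j) d)

  def₂-∀Fin : ∀ {m} j {R : Fin j → Rel₂ m} → (∀ i → Def₂ m (R i)) → Def₂ m λ t u v ρ → ∀ i → R i t u v ρ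
  def₂-∀Fin zero d = def₂-cong (λ _ _ _ _ → mk⇔ (λ _ ()) λ _ → tt) (def₂-Dec (yes tt))
  def₂-∀Fin (suc j) d = def₂-cong
    (λ _ _ _ _ → mk⇔ (λ { (r , rs) zero → r ; (r , rs) (suc i) → rs i }) λ r → r zero , r ∘ suc)
    (def₂-× (d zero) (def₂-∀Fin j (d ∘ suc)))

  def₂-id : ∀ {m} → Def₂ m λ t u v ρ → u ≡ v
  def₂-id = def⇒def₂
    (def-∀Fin k {λ i t ρ → ρ (fst i) ≡ ρ (snd i)} λ i → def (D.eq (fst i) (snd i)) tt λ _ _ → mk⇔ id id)
    λ t u v ρ → mk⇔
      (λ e → lookup-extensionality u v λ i → trans (sym (fst≡ u v ρ i)) (trans (e i) (snd≡ u v ρ i)))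
      (λ { refl i → trans (fst≡ u v ρ i) (sym (snd≡ u v ρ i)) })

  def₂-⨾ : ∀ {m R S} → Def₂ m R → Def₂ m S →
    Def₂ m λ t u v ρ → Σ (Vec (Nd t) k) λ w → R t u w ρ × S t w v ρ
  def₂-⨾ {m} {R} {S} d e = def⇒def₂
    (def-∃Vec k (def-× (def₂-at d ((k ↑ʳ_) ∘ fst) (_↑ˡ (k + (k + m))) ((k ↑ʳ_) ∘ par))
                       (def₂-at e (_↑ˡ (k + (k + m))) ((k ↑ʳ_) ∘ snd) ((k ↑ʳ_) ∘ par))))
    λ t u v ρ →
      let σ = u ⊞ v ⊞ ρ
          source w = tabulate≡ ((w ⊞ σ) ∘ (k ↑ʳ_) ∘ fst) {u} λ i → trans (⊞-↑ʳ w σ (fst i)) (fst≡ u v ρ i)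
          target w = tabulate≡ ((w ⊞ σ) ∘ (k ↑ʳ_) ∘ snd) {v} λ i → trans (⊞-↑ʳ w σ (snd i)) (snd≡ u v ρ i)
          middle w = tabulate≡ ((w ⊞ σ) ∘ (_↑ˡ (k + (k + m)))) {w} (⊞-↑ˡ w σ)
          rest w i = trans (⊞-↑ʳ w σ (par i)) (par≡ u v ρ i)
      in mk⇔
        (λ (w , r , s) → w , def₂-resp d (source w) (middle w) (rest w) r ,
                             def₂-resp e (middle w) (target w) (rest w) s)
        (λ (w , r , s) → w , def₂-resp d (sym (source w)) (sym (middle w)) (≗ₑ-sym (rest w)) r ,
                             def₂-resp e (sym (middle w)) (sym (target w)) (≗ₑ-sym (rest w)) s)

  Functional₂ : ∀ {m} → Rel₂ m → Set
  Functional₂ R = ∀ {t u v v′ ρ} → R t u v ρ → R t u v′ ρ → v ≡ v′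

  -- The only place where a closure is introduced. Its end points are variables of the context, so
  -- the body sees them as further parameters; the renaming along `par` makes it ignore them.
  def₂-star : ∀ {m R} → Def₂ m R → Functional₂ R → Def₂ m λ t u v ρ → Star (λ x y → R t x y ρ) u v
  def₂-star {m} {R} d functional = def₂ (D.tc ψ fst snd) (functional′ , rename-IsDTC (formula₂ d) _ (isDTC₂ d))
    λ t u v ρ → mk⇔
      (λ h → subst₂ (Star _) (tabulate≡ _ (fst≡ u v ρ)) (tabulate≡ _ (snd≡ u v ρ))
        (gmap id (λ {x} {y} r → def₂-resp d refl refl (par≡ u v ρ) (to (ψ-correct t (u ⊞ v ⊞ ρ) x y) r)) h))
      (λ h → subst₂ (Star _) (sym (tabulate≡ _ (fst≡ u v ρ))) (sym (tabulate≡ _ (snd≡ u v ρ)))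
        (gmap id (λ {x} {y} r → from (ψ-correct t (u ⊞ v ⊞ ρ) x y)
                                  (def₂-resp d refl refl (≗ₑ-sym (par≡ u v ρ)) r)) h))
    where
    ψ : Formula Sig k (k + (k + (k + (k + m))))
    ψ = rename (liftBlock k (liftBlock k par)) (formula₂ d)
    ψ-correct : ∀ t (σ : Fin (k + (k + m)) → Nd t) x y → ψ ⊢ t , (x ⊞ y ⊞ σ) ⇔ R t x y (σ ∘ par)
    ψ-correct t σ x y = ⇔-trans (⊢-rename-block (formula₂ d) par σ x y) (correct₂ d t x y (σ ∘ par))
    functional′ : Functional Sig ψ
    functional′ t σ u v v′ h h′ = functional (to (ψ-correct t σ u v) h) (to (ψ-correct t σ u v′) h′)

  -- The logical counterpart of dropping a pebble with head `i`: the position of the head becomes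
  -- the newest parameter.
  def₂-param : ∀ {m R} (i : Fin k) → Def₂ (suc m) R → Def₂ m λ t u v ρ → R t u v (_∷ₑ_ Sig (lookup u i) ρ)
  def₂-param {m} i d = def⇒def₂ (def₂-at d fst snd choose) λ t u v ρ → mk⇔
    (def₂-resp d (tabulate≡ _ (fst≡ u v ρ)) (tabulate≡ _ (snd≡ u v ρ)) (choose≡ u v ρ))
    (def₂-resp d (sym (tabulate≡ _ (fst≡ u v ρ))) (sym (tabulate≡ _ (snd≡ u v ρ))) (≗ₑ-sym (choose≡ u v ρ)))
    where
    choose : Fin (suc m) → Fin (k + (k + m))
    choose zero = fst i
    choose (suc j) = par j
    choose≡ : ∀ {t} u v (ρ : Fin m → Nd t) → ((u ⊞ v ⊞ ρ) ∘ choose) ≗ₑ _∷ₑ_ Sig (lookup u i) ρ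
    choose≡ u v ρ zero = fst≡ u v ρ i
    choose≡ u v ρ (suc j) = par≡ u v ρ j

-- Elimination of states.

module Elimination (Sig : RankedAlphabet) (k : ℕ) where

  open Trees Sig
  open Logic Sig
  open Definability Sig k
  open Equivalence using (to; from)

  Matrix : ℕ → ℕ → Set₁
  Matrix n m = Fin (suc n) → Fin (suc n) → Rel₂ m

  -- Stronger than functionality of every entry: the entries of a row also exclude one another.
  -- Without this a loop could be left in one continuation and repeated in another, and elimination
  -- would not preserve functionality.
  DeterministicMatrix : ∀ {n m} → Matrix n m → Set
  DeterministicMatrix {m = m} M = ∀ {t} {ρ : Fin m → Nd t} {i j j′ u v v′} →
    M i j t u v ρ → M i j′ t u v′ ρ → j ≡ j′ × v ≡ v′

  -- Row zero is the start and column zero the end; zero is not an intermediate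
  -- state of a path.
  data Path {n m} (M : Matrix n m) {t : Tr} (ρ : Fin m → Nd t)
            (i : Fin (suc n)) (u v : Vec (Nd t) k) : Set where
    exit : M i zero t u v ρ → Path M ρ i u v
    via  : ∀ {j w} → M i (suc j) t u w ρ → Path M ρ (suc j) w v → Path M ρ i u v

  -- The embedding that misses `suc zero`, the state to be eliminated.
  skip : ∀ {n} → Fin (suc n) → Fin (suc (suc n))
  skip zero = zero
  skip (suc j) = suc (suc j)

  skip-injective : ∀ {n} {i j : Fin (suc n)} → skip i ≡ skip j → i ≡ j
  skip-injective {i = zero} {zero} e = refl
  skip-injective {i = suc i} {suc .i} refl = refl

  skip≢1 : ∀ {n} (i : Fin (suc n)) → skip i ≢ suc zero
  skip≢1 zero ()
  skip≢1 (suc i) ()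

  module _ {n m : ℕ} (M : Matrix (suc n) m) where

    Loop : Rel₂ m
    Loop t u v ρ = Star (λ x y → M (suc zero) (suc zero) t x y ρ) u v

    Detour : Matrix n m
    Detour i j t u v ρ = Σ (Vec (Nd t) k) λ w → M (skip i) (suc zero) t u w ρ ×
                         Σ (Vec (Nd t) k) λ w′ → Loop t w w′ ρ × M (suc zero) (skip j) t w′ v ρ

    eliminate : Matrix n m
    eliminate i j t u v ρ = M (skip i) (skip j) t u v ρ ⊎ Detour i j t u v ρ

    module _ (det : DeterministicMatrix M) where

      -- Both computations make the same number of rounds: if one left where the other goes round
      -- again, determinism would equate `skip j` with `suc zero`.
      loop-exit : ∀ {t ρ u w w′ j j′ v v′} → Loop t u w ρ → Loop t u w′ ρ →
        M (suc zero) (skip j) t w v ρ → M (suc zero) (skip j′) t w′ v′ ρ → j ≡ j′ × v ≡ v′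
      loop-exit ε ε e e′ with det e e′
      ... | p , q = skip-injective p , q
      loop-exit {j = j} ε (s ◅ _) e e′ = contradiction (proj₁ (det e s)) (skip≢1 j)
      loop-exit {j′ = j′} (s ◅ _) ε e e′ = contradiction (proj₁ (det e′ s)) (skip≢1 j′)
      loop-exit (s ◅ l) (s′ ◅ l′) e e′ with det s s′
      ... | _ , refl = loop-exit l l′ e e′

      eliminate-deterministic : DeterministicMatrix eliminate
      eliminate-deterministic (inj₁ e) (inj₁ e′) with det e e′
      ... | p , q = skip-injective p , q
      eliminate-deterministic {j = j} (inj₁ e) (inj₂ (_ , s , _)) =
        contradiction (proj₁ (det e s)) (skip≢1 j)
      eliminate-deterministic {j′ = j′} (inj₂ (_ , s , _)) (inj₁ e) =
        contradiction (proj₁ (det e s)) (skip≢1 j′)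
      eliminate-deterministic (inj₂ (_ , s , _ , l , e)) (inj₂ (_ , s′ , _ , l′ , e′)) with det s s′
      ... | _ , refl = loop-exit l l′ e e′

    module _ {t : Tr} {ρ : Fin m → Nd t} where

      path-eliminate : ∀ {i u v} → Path M ρ (skip i) u v → Path eliminate ρ i u v
      -- Carries the rounds made so far at the eliminated state until the path leaves it.
      path-detour : ∀ {i u w w′ v} → M (skip i) (suc zero) t u w ρ → Loop t w w′ ρ →
        Path M ρ (suc zero) w′ v → Path eliminate ρ i u v
      path-eliminate (exit e) = exit (inj₁ e)
      path-eliminate (via {zero} e p) = path-detour e ε p
      path-eliminate (via {suc j} e p) = via (inj₁ e) (path-eliminate p)
      path-detour s l (exit e) = exit (inj₂ (_ , s , _ , l , e))
      path-detour s l (via {zero} e p) = path-detour s (l ◅◅ (e ◅ ε)) p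
      path-detour s l (via {suc j} e p) = via (inj₂ (_ , s , _ , l , e)) (path-eliminate p)

      path-loop : ∀ {u w v} → Loop t u w ρ → Path M ρ (suc zero) w v → Path M ρ (suc zero) u v
      path-loop ε p = p
      path-loop (s ◅ l) p = via s (path-loop l p)

      path-restore : ∀ {i u v} → Path eliminate ρ i u v → Path M ρ (skip i) u v
      path-restore (exit (inj₁ e)) = exit e
      path-restore (exit (inj₂ (_ , s , _ , l , e))) = via s (path-loop l (exit e))
      path-restore (via (inj₁ e) p) = via e (path-restore p)
      path-restore (via (inj₂ (_ , s , _ , l , e)) p) = via s (path-loop l (via e (path-restore p)))

  -- With no intermediate state left, a path is a single entry. Otherwise one state is eliminated;
  -- its loop is a diagonal entry, functional by determinism, so `def₂-star` applies.
  def₂-path : ∀ n {m} (M : Matrix n m) → (∀ i j → Def₂ m (M i j)) → DeterministicMatrix M →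
    Def₂ m λ t u v ρ → Path M ρ zero u v
  def₂-path zero M d det = def₂-cong (λ t u v ρ → mk⇔ exit λ { (exit e) → e ; (via {()} _ _) }) (d zero zero)
  def₂-path (suc n) M d det = def₂-cong
    (λ t u v ρ → mk⇔ (path-restore M) (path-eliminate M))
    (def₂-path n (eliminate M)
      (λ i j → def₂-⊎ (d (skip i) (skip j))
        (def₂-⨾ (d (skip i) (suc zero)) (def₂-⨾ (def₂-star (d (suc zero) (suc zero)) λ e e′ → proj₂ (det e e′))
                                               (d (suc zero) (skip j)))))
      (eliminate-deterministic M det))

  module _ {n m : ℕ} (Move : Fin n → Fin n → Rel₂ m) (Stop : Fin n → Rel₂ m) where

    data Chain {t : Tr} (ρ : Fin m → Nd t) (p : Fin n) (u v : Vec (Nd t) k) : Set where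
      stop : Stop p t u v ρ → Chain ρ p u v
      _∷_  : ∀ {q w} → Move p q t u w ρ → Chain ρ q w v → Chain ρ p u v

    -- The states are shifted by one. Row zero enters `p₀` without changing the tuple, and column
    -- zero is reached by stopping.
    chainMatrix : Fin n → Matrix n m
    chainMatrix p₀ zero zero t u v ρ = ⊥
    chainMatrix p₀ zero (suc q) t u v ρ = p₀ ≡ q × u ≡ v
    chainMatrix p₀ (suc p) zero = Stop p
    chainMatrix p₀ (suc p) (suc q) = Move p q

    def₂-chain : (∀ p q → Def₂ m (Move p q)) → (∀ p → Def₂ m (Stop p)) →
      (∀ {t} {ρ : Fin m → Nd t} {p q q′ u v v′} → Move p q t u v ρ → Move p q′ t u v′ ρ → q ≡ q′ × v ≡ v′) →
      (∀ {t} {ρ : Fin m → Nd t} {p u v v′} → Stop p t u v ρ → Stop p t u v′ ρ → v ≡ v′) →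
      (∀ {t} {ρ : Fin m → Nd t} {p q u v v′} → Stop p t u v ρ → ¬ Move p q t u v′ ρ) →
      ∀ p₀ → Def₂ m λ t u v ρ → Chain ρ p₀ u v
    def₂-chain dMove dStop det detStop excl p₀ = def₂-cong
      (λ t u v ρ → mk⇔ (λ { (via (refl , refl) p) → path⇒chain p }) (λ c → via (refl , refl) (chain⇒path c)))
      (def₂-path n (chainMatrix p₀) entries λ {_} {_} {i} {j} {j′} {u} → entries-det {i = i} {j} {j′} {u})
      where
      entries : ∀ i j → Def₂ m (chainMatrix p₀ i j)
      entries zero zero = def₂-⊥
      entries zero (suc q) = def₂-× (def₂-Dec (p₀ ≟F q)) def₂-id
      entries (suc p) zero = dStop p
      entries (suc p) (suc q) = dMove p q
      entries-det : DeterministicMatrix (chainMatrix p₀)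
      entries-det {i = zero} {suc _} {suc _} (refl , refl) (refl , refl) = refl , refl
      entries-det {i = suc p} {zero} {zero} e e′ = refl , detStop e e′
      entries-det {i = suc p} {zero} {suc _} e e′ = contradiction e′ (excl e)
      entries-det {i = suc p} {suc _} {zero} e e′ = contradiction e (excl e′)
      entries-det {i = suc p} {suc _} {suc _} e e′ with det e e′
      ... | refl , e″ = refl , e″
      path⇒chain : ∀ {t} {ρ : Fin m → Nd t} {p u v} → Path (chainMatrix p₀) ρ (suc p) u v → Chain ρ p u v
      path⇒chain (exit e) = stop e
      path⇒chain (via e p) = e ∷ path⇒chain p
      chain⇒path : ∀ {t} {ρ : Fin m → Nd t} {p u v} → Chain ρ p u v → Path (chainMatrix p₀) ρ (suc p) u v
      chain⇒path (stop e) = exit e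
      chain⇒path (e ∷ c) = via e (chain⇒path c)

-- Decomposition of computations into nested moves.

module Runs (Sig : RankedAlphabet) (k′ : ℕ) (𝒜 : PTWA Sig (suc k′)) (det : Deterministic Sig 𝒜) where

  open Trees Sig
  open PTWA 𝒜
  open Machines Sig k′ nX using (k; Conf; Execute; Hold)
  open Determinism Sig k′ 𝒜 det

  V : Tr → Set
  V t = Vec (Nd t) k

  Q : Set
  Q = Fin nQ

  Flat : ∀ {t} → Op Sig k nX → V t → V t → Stack Sig nX t → Set
  Flat (drop _ _) u v α = ⊥
  Flat (retrieve _) u v α = ⊥
  Flat (up i) u v α = Execute (up i) (u , α) (v , α)
  Flat (down i j) u v α = Execute (down i j) (u , α) (v , α)
  Flat (pos T) u v α = Execute (pos T) (u , α) (v , α)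
  Flat (negT T) u v α = Execute (negT T) (u , α) (v , α)

  flat-execute : ∀ {t u v} {α : Stack Sig nX t} χ → Flat χ u v α → Execute χ (u , α) (v , α)
  flat-execute (up i) e = e
  flat-execute (down i j) e = e
  flat-execute (pos T) e = e
  flat-execute (negT T) e = e

  Occurs : ∀ {t} → Fin nX → Stack Sig nX t → Set
  Occurs x α = Any (λ p → proj₁ p ≡ x) α

  -- Move α p u q v: the automaton gets from [p, u, α] to [q, v, α] by an
  -- instruction that leaves the stack as it is, or by dropping a pebble and
  -- running until that pebble has been retrieved.
  -- Run ((x , z) ∷ α) p u q v: it gets from [p, u, (x, z)α] to [q, v, α] without
  -- touching α before.
  data Move {t : Tr} (α : Stack Sig nX t) (p : Q) (u : V t) (q : Q) (v : V t) : Set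
  data Run {t : Tr} : Stack Sig nX t → Q → V t → Q → V t → Set

  data Move {t} α p u q v where
    flat : ∀ {χ} → (p , χ , q) ∈ instrs → Flat χ u v α → Move α p u q v
    call : ∀ {i x r} → (p , drop i x , r) ∈ instrs → ¬ Occurs x α →
           Run ((x , lookup u i) ∷ α) r u q v → Move α p u q v

  data Run {t} where
    return : ∀ {x z α p u q} → (p , retrieve x , q) ∈ instrs → Run ((x , z) ∷ α) p u q u
    _∷_    : ∀ {α p u r w q v} → Move α p u r w → Run α r w q v → Run α p u q v

  _⟶_ : ∀ {t} → Config Sig 𝒜 t → Config Sig 𝒜 t → Set
  _⟶_ = Step Sig 𝒜

  move-steps : ∀ {t} {α : Stack Sig nX t} {p u q v} → Move α p u q v → Star _⟶_ (p , u , α) (q , v , α)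
  run-steps : ∀ {t x z} {α : Stack Sig nX t} {p u q v} → Run ((x , z) ∷ α) p u q v →
    Star _⟶_ (p , u , (x , z) ∷ α) (q , v , α)
  move-steps (flat {χ} m f) = step m (flat-execute χ f) ◅ ε
  move-steps (call m new r) = step m (ex-drop new) ◅ run-steps r
  run-steps (return m) = step m ex-retrieve ◅ ε
  run-steps (mv ∷ r) = move-steps mv ◅◅ run-steps r

  -- The first step of a move does not shorten the stack. This tells it from a retrieval, and it
  -- shows that a halting configuration has no move.
  move-first : ∀ {t} {α : Stack Sig nX t} {p u q v} → Move α p u q v →
    ∃ λ c → (p , u , α) ⟶ c × length α ≤ length (proj₂ (proj₂ c))
  move-first (flat {χ} m f) = _ , step m (flat-execute χ f) , ≤-refl
  move-first (call m new r) = _ , step m (ex-drop new) , n≤1+n _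

  move-functional : ∀ {t} {α : Stack Sig nX t} {p u q v q′ v′} →
    Move α p u q v → Move α p u q′ v′ → q ≡ q′ × v ≡ v′
  -- Stacks and states are linked by equations because, after two calls, their agreement is known
  -- only from `step-functional`.
  run-functional : ∀ {t} {α α′ : Stack Sig nX t} {p p′ u q v q′ v′} → α ≡ α′ → p ≡ p′ →
    Run α p u q v → Run α′ p′ u q′ v′ → q ≡ q′ × v ≡ v′
  retrieve-no-move : ∀ {t x z} {α : Stack Sig nX t} {p u q q′ v} →
    (p , retrieve x , q) ∈ instrs → ¬ Move ((x , z) ∷ α) p u q′ v

  retrieve-no-move m mv with move-first mv
  ... | c , s , le with step-functional (step m ex-retrieve) s
  ...   | refl = <-irrefl refl le

  move-functional (flat {χ} m f) (flat {χ′} m′ f′)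
    with step-functional (step m (flat-execute χ f)) (step m′ (flat-execute χ′ f′))
  ... | refl = refl , refl
  move-functional {α = α} (flat {χ} m f) (call m′ new′ r′) = contradiction
    (cong (length ∘ proj₂ ∘ proj₂) (step-functional (step m (flat-execute χ f)) (step m′ (ex-drop new′))))
    λ e → <-irrefl e (n<1+n (length α))
  move-functional {α = α} (call m new r) (flat {χ} m′ f′) = contradiction
    (cong (length ∘ proj₂ ∘ proj₂) (step-functional (step m′ (flat-execute χ f′)) (step m (ex-drop new))))
    λ e → <-irrefl e (n<1+n (length α))
  move-functional {u = u} (call m new r) (call m′ new′ r′) =
    run-functional (cong (proj₂ ∘ proj₂) e) (cong proj₁ e) r r′
    where e = step-functional (step m (ex-drop {u = u} new)) (step m′ (ex-drop {u = u} new′))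

  run-functional refl refl (return {z = z} {u = u} m) (return m′)
    with step-functional (step m (ex-retrieve {u = u} {α = []} {v = z})) (step m′ ex-retrieve)
  ... | refl = refl , refl
  run-functional refl refl (return m) (mv ∷ _) = contradiction mv (retrieve-no-move m)
  run-functional refl refl (mv ∷ _) (return m) = contradiction mv (retrieve-no-move m)
  run-functional refl refl (mv ∷ r) (mv′ ∷ r′) with move-functional mv mv′
  ... | refl , refl = run-functional refl refl r r′

  len : ∀ {A : Set} {R : A → A → Set} {x y} → Star R x y → ℕ
  len ε = 0
  len (_ ◅ r) = suc (len r)

  module _ {t : Tr} {pₑ : Q} {uₑ : V t} where

    End : Config Sig 𝒜 t
    End = pₑ , uₑ , []

    -- `End` has the empty stack, so the pebble on top is retrieved on the way. After a nested call
    -- the recursion continues with the remainder `r′`, which is shorter but not a subterm; `fuel`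
    -- bounds the lengths.
    run-complete : ∀ fuel {x z α p u} (r : Star _⟶_ (p , u , (x , z) ∷ α) End) → len r ≤ fuel →
      ∃₂ λ q v → Run ((x , z) ∷ α) p u q v × Σ (Star _⟶_ (q , v , α) End) λ r′ → len r′ < len r
    run-complete-flat : ∀ fuel {x z α p χ p′ u u′} → (p , χ , p′) ∈ instrs → Flat χ u u′ ((x , z) ∷ α) →
      (r : Star _⟶_ (p′ , u′ , (x , z) ∷ α) End) → len r ≤ fuel →
      ∃₂ λ q v → Run ((x , z) ∷ α) p u q v × Σ (Star _⟶_ (q , v , α) End) λ r′ → len r′ < suc (len r)
    run-complete-flat fuel {χ = χ} m f r le with run-complete fuel r le
    ... | q , v , run , r′ , lt = q , v , flat {χ = χ} m f ∷ run , r′ , <-trans lt (n<1+n _)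
    run-complete (suc fuel) (step m e@(ex-up _) ◅ r) (s≤s le) = run-complete-flat fuel m e r le
    run-complete (suc fuel) (step m e@(ex-down _) ◅ r) (s≤s le) = run-complete-flat fuel m e r le
    run-complete (suc fuel) (step m e@(ex-pos _) ◅ r) (s≤s le) = run-complete-flat fuel m e r le
    run-complete (suc fuel) (step m e@(ex-neg _) ◅ r) (s≤s le) = run-complete-flat fuel m e r le
    run-complete (suc fuel) (step m ex-retrieve ◅ r) (s≤s le) = _ , _ , return m , r , ≤-refl
    run-complete (suc fuel) (step m (ex-drop new) ◅ r) (s≤s le) with run-complete fuel r le
    ... | q , v , run , r′ , lt with run-complete fuel r′ (≤-trans (<⇒≤ lt) le)
    ...   | q′ , v′ , run′ , r″ , lt′ =
      q′ , v′ , call m new run ∷ run′ , r″ , <-trans lt′ (<-trans lt (n<1+n _))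

    Moves : Q → V t → Set
    Moves p u = Star (λ (p , u) (q , v) → Move [] p u q v) (p , u) (pₑ , uₑ)

    moves-complete : ∀ fuel {p u} (r : Star _⟶_ (p , u , []) End) → len r ≤ fuel → Moves p u
    moves-complete fuel ε le = ε
    moves-complete (suc fuel) (step m e@(ex-up _) ◅ r) (s≤s le) = flat m e ◅ moves-complete fuel r le
    moves-complete (suc fuel) (step m e@(ex-down _) ◅ r) (s≤s le) = flat m e ◅ moves-complete fuel r le
    moves-complete (suc fuel) (step m e@(ex-pos _) ◅ r) (s≤s le) = flat m e ◅ moves-complete fuel r le
    moves-complete (suc fuel) (step m e@(ex-neg _) ◅ r) (s≤s le) = flat m e ◅ moves-complete fuel r le
    moves-complete (suc fuel) (step m (ex-drop new) ◅ r) (s≤s le) with run-complete fuel r le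
    ... | q , v , run , r′ , lt = call m new run ◅ moves-complete fuel r′ (≤-trans (<⇒≤ lt) le)

  -- The names of the pebbles are fixed while a formula is built; only their positions are variables
  -- of it.
  stack : ∀ {t m} → Vec (Fin nX) m → (Fin m → Nd t) → Stack Sig nX t
  stack [] ρ = []
  stack (x ∷ xs) ρ = (x , ρ zero) ∷ stack xs (ρ ∘ suc)

  ∈-stack : ∀ {t m} (xs : Vec (Fin nX) m) {ρ : Fin m → Nd t} i → (lookup xs i , ρ i) ∈ stack xs ρ
  ∈-stack (x ∷ xs) zero = here refl
  ∈-stack (x ∷ xs) (suc i) = there (∈-stack xs i)

  ∈-stack⁻ : ∀ {t m} (xs : Vec (Fin nX) m) {ρ : Fin m → Nd t} {x z} → (x , z) ∈ stack xs ρ →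
    ∃ λ i → lookup xs i ≡ x × ρ i ≡ z
  ∈-stack⁻ (x ∷ xs) (here refl) = zero , refl , refl
  ∈-stack⁻ (x ∷ xs) (there m) with ∈-stack⁻ xs m
  ... | i , e , e′ = suc i , e , e′

  occurs-stack : ∀ {t m} (xs : Vec (Fin nX) m) {ρ : Fin m → Nd t} {x} →
    Occurs x (stack xs ρ) ⇔ ∃ λ i → lookup xs i ≡ x
  occurs-stack xs {ρ} {x} = mk⇔ to from
    where
    to : Occurs x (stack xs ρ) → ∃ λ i → lookup xs i ≡ x
    to a with find a
    ... | (y , z) , m , refl with ∈-stack⁻ xs m
    ...   | i , e , _ = i , e
    from : (∃ λ i → lookup xs i ≡ x) → Occurs x (stack xs ρ)
    from (i , refl) = mapAny (λ { refl → refl }) (∈-stack xs i)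

-- From automata to formulas.

module Descriptions (Sig : RankedAlphabet) (k′ : ℕ) (𝒜 : PTWA Sig (suc k′)) (det : Deterministic Sig 𝒜) where

  open Trees Sig
  open PTWA 𝒜
  open Machines Sig k′ nX using (k; Conf; Execute; Hold; hold?)
  open Determinism Sig k′ 𝒜 det
  open Runs Sig k′ 𝒜 det
  open Logic Sig
  open Definability Sig k
  open Elimination Sig k
  open Equivalence using (to; from)

  def-ancestor : ∀ {m} (a b : Fin m) → Def m λ t ρ → Ancestor (ρ a) (ρ b)
  def-ancestor a b = def (D.leq a b) tt λ _ _ → mk⇔ id id

  def-edge : ∀ {m} j (a b : Fin m) → Def m λ t ρ → Edg j (ρ a) (ρ b)
  def-edge j a b = def (D.edg j a b) tt λ _ _ → mk⇔ id id

  -- Number 0 belongs to the root alone, which is definable as the ancestor of all nodes; number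
  -- `j + 1` means being child `j + 1` of some node.
  def-chn : ∀ {m} j (a : Fin m) → Def m λ t ρ → chn (ρ a) ≡ j
  def-chn zero a = def-cong
    (λ t ρ → mk⇔ (λ anc → cong chn (anc-of-root (anc root)))
                 (λ e x → subst (λ y → Ancestor y x) (sym (childNo≡0 e)) anc-root))
    (def-∀ (def-ancestor (suc a) zero))
  def-chn (suc j) a = def-cong
    (λ t ρ → mk⇔ (λ (x , e) → edge-childNo e) childNo-parent)
    (def-∃ (def-edge (suc j) zero (suc a)))

  module _ {m : ℕ} where

    def₂-edge-down : ∀ j i → Def₂ m λ t u v ρ → Edg j (lookup u i) (lookup v i)
    def₂-edge-down j i = def⇒def₂ (def-edge j (fst i) (snd i)) λ t u v ρ →
      mk⇔ (subst₂ (Edg j) (fst≡ u v ρ i) (snd≡ u v ρ i))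
          (subst₂ (Edg j) (sym (fst≡ u v ρ i)) (sym (snd≡ u v ρ i)))

    def₂-edge-up : ∀ j i → Def₂ m λ t u v ρ → Edg j (lookup v i) (lookup u i)
    def₂-edge-up j i = def⇒def₂ (def-edge j (snd i) (fst i)) λ t u v ρ →
      mk⇔ (subst₂ (Edg j) (snd≡ u v ρ i) (fst≡ u v ρ i))
          (subst₂ (Edg j) (sym (snd≡ u v ρ i)) (sym (fst≡ u v ρ i)))

    def₂-same : ∀ i → Def₂ m λ t u v ρ → lookup v i ≡ lookup u i
    def₂-same i = def⇒def₂ {R = λ t ρ → ρ (snd i) ≡ ρ (fst i)} (def (D.eq (snd i) (fst i)) tt λ _ _ → mk⇔ id id)
      λ t u v ρ → mk⇔ (λ e → trans (sym (snd≡ u v ρ i)) (trans e (fst≡ u v ρ i)))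
                      (λ e → trans (snd≡ u v ρ i) (trans e (sym (fst≡ u v ρ i))))

    def₂-chn : ∀ j i → Def₂ m λ t u v ρ → chn (lookup u i) ≡ j
    def₂-chn j i = def⇒def₂ (def-chn j (fst i)) λ t u v ρ →
      mk⇔ (subst (λ x → chn x ≡ j) (fst≡ u v ρ i)) (subst (λ x → chn x ≡ j) (sym (fst≡ u v ρ i)))

    def₂-lab : ∀ σ i → Def₂ m λ t u v ρ → lbl (lookup u i) ≡ σ
    def₂-lab σ i = def⇒def₂ {R = λ t ρ → lbl (ρ (fst i)) ≡ σ} (def (D.lab σ (fst i)) tt λ _ _ → mk⇔ id id)
      λ t u v ρ → mk⇔ (subst (λ x → lbl x ≡ σ) (fst≡ u v ρ i)) (subst (λ x → lbl x ≡ σ) (sym (fst≡ u v ρ i)))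

    def₂-param-at : ∀ l i → Def₂ m λ t u v ρ → ρ l ≡ lookup u i
    def₂-param-at l i = def⇒def₂ {R = λ t ρ → ρ (par l) ≡ ρ (fst i)}
      (def (D.eq (par l) (fst i)) tt λ _ _ → mk⇔ id id)
      λ t u v ρ → mk⇔ (λ e → trans (sym (par≡ u v ρ l)) (trans e (fst≡ u v ρ i)))
                      (λ e → trans (par≡ u v ρ l) (trans e (sym (fst≡ u v ρ i))))

    -- A head movement is expressed by an edge for head `i` and equality for the rest; `l ≡ i` is
    -- decided while the formula is built.
    OthersFixed : Fin k → Rel₂ m
    OthersFixed i t u v ρ = ∀ l → l ≡ i ⊎ lookup v l ≡ lookup u l

    def₂-others : ∀ i → Def₂ m (OthersFixed i)
    def₂-others i = def₂-∀Fin k λ l → def₂-⊎ (def₂-Dec (l ≟F i)) (def₂-same l)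

    others-update : ∀ {t} {u v : Vec (Nd t) k} {ρ : Fin m → Nd t} i → OthersFixed i t u v ρ →
      u [ i ]≔ lookup v i ≡ v
    others-update {u = u} {v} i fixed = lookup-extensionality _ v go
      where
      go : ∀ l → lookup (u [ i ]≔ lookup v i) l ≡ lookup v l
      go l with l ≟F i | fixed l
      ... | yes refl | _ = lookup∘update i u (lookup v i)
      ... | no ne | inj₁ e = contradiction e ne
      ... | no ne | inj₂ e = trans (lookup∘update′ ne u (lookup v i)) (sym e)

    update-others : ∀ {t} (u : Vec (Nd t) k) {ρ : Fin m → Nd t} i x → OthersFixed i t u (u [ i ]≔ x) ρ
    update-others u i x l with l ≟F i
    ... | yes e = inj₁ e
    ... | no ne = inj₂ (lookup∘update′ ne u x)

    module _ (xs : Vec (Fin nX) m) where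

      def₂-hold : ∀ T → Def₂ m λ t u v ρ → Hold T (u , stack xs ρ)
      def₂-hold (labT i σ) = def₂-lab σ i
      def₂-hold (chnoT i j) = def₂-chn j i
      def₂-hold (pebT i x) = def₂-cong
        (λ t u v ρ → mk⇔ (λ { (l , refl , e) → subst (λ z → (x , z) ∈ stack xs ρ) e (∈-stack xs l) })
                         (∈-stack⁻ xs))
        (def₂-∃Fin m λ l → def₂-× (def₂-Dec (lookup xs l ≟F x)) (def₂-param-at l i))

      def₂-flat : ∀ χ → Def₂ m λ t u v ρ → Flat χ u v (stack xs ρ)
      def₂-flat (drop _ _) = def₂-⊥
      def₂-flat (retrieve _) = def₂-⊥
      def₂-flat (pos T) = def₂-cong
        (λ t u v ρ → mk⇔ (λ { (refl , h) → ex-pos h }) λ { (ex-pos h) → refl , h })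
        (def₂-× def₂-id (def₂-hold T))
      def₂-flat (negT T) = def₂-cong
        (λ t u v ρ → mk⇔ (λ { (refl , h) → ex-neg h }) λ { (ex-neg h) → refl , h })
        (def₂-× def₂-id (def₂-¬ (def₂-hold T)))
      def₂-flat (down i j) = def₂-cong
        (λ t u v ρ → mk⇔
          (λ (e , fixed) → subst (λ v′ → Execute (down i j) (u , stack xs ρ) (v′ , stack xs ρ))
                                 (others-update {ρ = ρ} i fixed) (ex-down e))
          λ { (ex-down {v = x} e) →
                subst (Edg j (lookup u i)) (sym (lookup∘update i u x)) e , update-others u {ρ} i x })
        (def₂-× (def₂-edge-down j i) (def₂-others i))
      def₂-flat (up i) = def₂-cong
        (λ t u v ρ → mk⇔
          (λ ((j , e) , fixed) → subst (λ v′ → Execute (up i) (u , stack xs ρ) (v′ , stack xs ρ))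
                                       (others-update {ρ = ρ} i fixed) (ex-up e))
          λ { (ex-up {j = j} {v = x} e) →
                (fromℕ< (s≤s (≤-trans (edge-rank e) (rank≤maxRank _))) ,
                 subst₂ (λ j′ y → Edg j′ y (lookup u i)) (sym (toℕ-fromℕ< _)) (sym (lookup∘update i u x)) e) ,
                update-others u {ρ} i x })
        -- Moving up does not mention the child number, so the formula ranges over 0, ...,
        -- `maxRank`.
        (def₂-× (def₂-∃Fin (suc maxRank) λ j → def₂-edge-up (toℕ j) i) (def₂-others i))

  isRetrieve? : ∀ x (χ : Op Sig k nX) → Dec (χ ≡ retrieve x)
  isRetrieve? x (retrieve y) with y ≟F x
  ... | yes refl = yes refl
  ... | no ne = no λ { refl → ne refl }
  isRetrieve? x (up i) = no λ ()
  isRetrieve? x (down i j) = no λ ()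
  isRetrieve? x (drop i y) = no λ ()
  isRetrieve? x (pos T) = no λ ()
  isRetrieve? x (negT T) = no λ ()

  def₂-retrieves : ∀ {m} p x q → Def₂ m λ _ _ _ _ → (p , retrieve x , q) ∈ instrs
  def₂-retrieves p x q = def₂-cong
    (λ _ _ _ _ → mk⇔ (λ { (_ , m , refl , refl , refl) → m }) λ m → _ , m , refl , refl , refl)
    (def₂-Any instrs λ { (p′ , χ , q′) →
      def₂-× (def₂-Dec (p′ ≟F p)) (def₂-× (def₂-Dec (isRetrieve? x χ)) (def₂-Dec (q′ ≟F q))) })

  -- A pebble is dropped only if it is not on the stack; the names therefore stay distinct, and this
  -- bounds the nesting of calls.
  Injective : ∀ {m} → Vec (Fin nX) m → Set
  Injective xs = ∀ {i j} → lookup xs i ≡ lookup xs j → i ≡ j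

  injective-∷ : ∀ {m x} {xs : Vec (Fin nX) m} → Injective xs → ¬ (∃ λ i → lookup xs i ≡ x) → Injective (x ∷ xs)
  injective-∷ inj new {zero} {zero} e = refl
  injective-∷ inj new {zero} {suc j} e = contradiction (j , sym e) new
  injective-∷ inj new {suc i} {zero} e = contradiction (i , e) new
  injective-∷ inj new {suc i} {suc j} e = cong suc (inj e)

  occurs? : ∀ {m} (xs : Vec (Fin nX) m) x → Dec (∃ λ i → lookup xs i ≡ x)
  occurs? xs x = any? λ i → lookup xs i ≟F x

  module _ {t : Tr} where

    CallBy : Op Sig k nX → Q → Stack Sig nX t → Vec (Nd t) k → Q → Vec (Nd t) k → Set
    CallBy (drop i x) r α u q v = ¬ Occurs x α × Run ((x , lookup u i) ∷ α) r u q v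
    CallBy (up _) r α u q v = ⊥
    CallBy (down _ _) r α u q v = ⊥
    CallBy (retrieve _) r α u q v = ⊥
    CallBy (pos _) r α u q v = ⊥
    CallBy (negT _) r α u q v = ⊥

    callBy⇒move : ∀ χ {α p r u q v} → (p , χ , r) ∈ instrs → CallBy χ r α u q v → Move α p u q v
    callBy⇒move (drop i x) m (new , r) = call m new r

  -- d is the number of pebbles that are not on the stack.
  def₂-move : ∀ d {m} (xs : Vec (Fin nX) m) → Injective xs → m + d ≡ nX → ∀ p q →
    Def₂ m λ t u v ρ → Move (stack xs ρ) p u q v
  def₂-run : ∀ d {m} x (xs : Vec (Fin nX) m) → Injective (x ∷ xs) → suc m + d ≡ nX → ∀ p q →
    Def₂ (suc m) λ t u v ρ → Run (stack (x ∷ xs) ρ) p u q v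
  def₂-callBy : ∀ d {m} (xs : Vec (Fin nX) m) → Injective xs → m + d ≡ nX → ∀ χ r q →
    Def₂ m λ t u v ρ → CallBy χ r (stack xs ρ) u q v

  def₂-move d xs inj e p q = def₂-cong
    (λ t u v ρ → mk⇔
      (λ { (_ , m , refl , inj₁ (refl , f)) → flat m f
         ; ((_ , χ , _) , m , refl , inj₂ c) → callBy⇒move χ m c })
      λ { (flat m f) → _ , m , refl , inj₁ (refl , f) ; (call m new r) → _ , m , refl , inj₂ (new , r) })
    (def₂-Any instrs λ { (p′ , χ , r) → def₂-× (def₂-Dec (p′ ≟F p))
      (def₂-⊎ (def₂-× (def₂-Dec (r ≟F q)) (def₂-flat xs χ)) (def₂-callBy d xs inj e χ r q)) })

  def₂-callBy d xs inj e (up _) r q = def₂-⊥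
  def₂-callBy d xs inj e (down _ _) r q = def₂-⊥
  def₂-callBy d xs inj e (retrieve _) r q = def₂-⊥
  def₂-callBy d xs inj e (pos _) r q = def₂-⊥
  def₂-callBy d xs inj e (negT _) r q = def₂-⊥
  def₂-callBy d xs inj e (drop i x) r q with occurs? xs x
  ... | yes occ = def₂-cong (λ t u v ρ → mk⇔ (λ ()) λ (new , _) → new (from (occurs-stack xs) occ)) def₂-⊥
  -- All `nX` pebbles are on the stack: a further distinct one contradicts the pigeonhole principle.
  def₂-callBy zero {m} xs inj e (drop i x) r q | no new with
    pigeonhole (s≤s (≤-reflexive (trans (sym e) (+-identityʳ m)))) (lookup (x ∷ xs))
  ... | a , b , a<b , eq = contradiction a<b (<-irrefl (cong toℕ (injective-∷ inj new eq)))
  def₂-callBy (suc d) {m} xs inj e (drop i x) r q | no new = def₂-cong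
    (λ t u v ρ → mk⇔ (λ run → new ∘ to (occurs-stack xs) , run) proj₂)
    -- The call is described with one pebble less to spare; this decrease of `d` makes the mutual
    -- recursion terminate.
    (def₂-param i (def₂-run d x xs (injective-∷ inj new) (trans (sym (+-suc m d)) e) r q))

  def₂-run d {m} x xs inj e p q = def₂-cong
    (λ t u v ρ → mk⇔ chain⇒run run⇒chain)
    (def₂-chain Moves′ Stop (def₂-move d (x ∷ xs) inj e)
      (λ p → def₂-× (def₂-retrieves p x q) def₂-id)
      move-functional (λ { (_ , refl) (_ , refl) → refl })
      (λ { (m , refl) mv → retrieve-no-move m mv }) p)
    where
    Moves′ : Q → Q → Rel₂ (suc m)
    Moves′ p q t u v ρ = Move (stack (x ∷ xs) ρ) p u q v
    Stop : Q → Rel₂ (suc m)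
    Stop p t u v ρ = (p , retrieve x , q) ∈ instrs × u ≡ v
    chain⇒run : ∀ {t} {ρ : Fin (suc m) → Nd t} {p u v} → Chain Moves′ Stop ρ p u v →
      Run (stack (x ∷ xs) ρ) p u q v
    chain⇒run (stop (m , refl)) = return m
    chain⇒run (mv ∷ c) = mv ∷ chain⇒run c
    run⇒chain : ∀ {t} {ρ : Fin (suc m) → Nd t} {p u v} → Run (stack (x ∷ xs) ρ) p u q v →
      Chain Moves′ Stop ρ p u v
    run⇒chain (return m) = stop (m , refl)
    run⇒chain (mv ∷ r) = mv ∷ run⇒chain r

  Enabled : ∀ {t} → Op Sig k nX → Vec (Nd t) k → Set
  Enabled χ u = ∃ λ c → Execute χ (u , []) c

  -- On the empty stack a drop is always possible and a retrieval never; every other operation is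
  -- flat.
  def₂-enabled : ∀ χ → Def₂ 0 λ t u v ρ → Enabled χ u
  def₂-enabled χ = def₂-cong (λ t u v ρ → mk⇔ (to-enabled χ) (from-enabled χ))
    -- Composition with the full relation quantifies the successor tuple away.
    (def₂-⊎ (def₂-Dec (isDrop? χ)) (def₂-⨾ (def₂-flat [] χ) (def₂-Dec (yes tt))))
    where
    IsDrop : Op Sig k nX → Set
    IsDrop (drop _ _) = ⊤
    IsDrop _ = ⊥
    isDrop? : ∀ χ → Dec (IsDrop χ)
    isDrop? (drop _ _) = yes tt
    isDrop? (up _) = no λ ()
    isDrop? (down _ _) = no λ ()
    isDrop? (retrieve _) = no λ ()
    isDrop? (pos _) = no λ ()
    isDrop? (negT _) = no λ ()
    to-enabled : ∀ {t} χ {u : Vec (Nd t) k} →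
      IsDrop χ ⊎ (Σ (Vec (Nd t) k) λ w → Flat χ u w [] × ⊤) → Enabled χ u
    to-enabled (drop i x) (inj₁ _) = _ , ex-drop λ ()
    to-enabled χ (inj₂ (w , f , _)) = _ , flat-execute χ f
    from-enabled : ∀ {t} χ {u : Vec (Nd t) k} → Enabled χ u →
      IsDrop χ ⊎ (Σ (Vec (Nd t) k) λ w → Flat χ u w [] × ⊤)
    from-enabled (drop i x) _ = inj₁ tt
    from-enabled (up i) (_ , ex-up e) = inj₂ (_ , ex-up e , tt)
    from-enabled (down i j) (_ , ex-down e) = inj₂ (_ , ex-down e , tt)
    from-enabled (pos T) (_ , ex-pos h) = inj₂ (_ , ex-pos h , tt)
    from-enabled (negT T) (_ , ex-neg h) = inj₂ (_ , ex-neg h , tt)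

  def₂-halting : ∀ p → Def₂ 0 λ t u v ρ → Halting Sig 𝒜 {t} (p , u , [])
  def₂-halting p = def₂-cong
    (λ t u v ρ → mk⇔ (λ { none (_ , step m e) → none (_ , m , refl , _ , e) })
                     (λ { halt (_ , m , refl , _ , e) → halt (_ , step m e) }))
    (def₂-¬ (def₂-Any instrs λ (p′ , χ , _) → def₂-× (def₂-Dec (p′ ≟F p)) (def₂-enabled χ)))

  -- The logic has no constant for the root, hence the description by child numbers.
  AtRoots : ∀ {t} → Vec (Nd t) k → Set
  AtRoots u = ∀ i → chn (lookup u i) ≡ 0

  roots : ∀ {t} → Vec (Nd t) k
  roots = replicate k root

  roots-atRoots : ∀ {t} → AtRoots (roots {t})
  roots-atRoots {t} i = cong chn (lookup-replicate i (root {t = t}))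

  atRoots⇒roots : ∀ {t} (u : Vec (Nd t) k) → AtRoots u → u ≡ roots
  atRoots⇒roots u at = lookup-extensionality u roots λ i →
    trans (childNo≡0 (at i)) (sym (lookup-replicate i root))

  Moves₀ : Q → Q → Rel₂ 0
  Moves₀ p q t u v ρ = Move [] p u q v

  Accepting : Q → Rel₂ 0
  Accepting p t u v ρ = p ∈ₛ acc × Halting Sig 𝒜 {t} (p , u , []) × AtRoots u × u ≡ v

  Acceptance : Rel₂ 0
  Acceptance t u v ρ = AtRoots u × Chain Moves₀ Accepting ρ q₀ u v

  def₂-acceptance : Def₂ 0 Acceptance
  def₂-acceptance = def₂-× (def₂-∀Fin k (def₂-chn 0)) (def₂-chain Moves₀ Accepting
    (def₂-move nX [] (λ { {()} }) refl)
    (λ p → def₂-× (def₂-Dec (p ∈ₛ? acc)) (def₂-× (def₂-halting p) (def₂-× (def₂-∀Fin k (def₂-chn 0)) def₂-id)))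
    move-functional (λ { (_ , _ , _ , refl) (_ , _ , _ , refl) → refl })
    (λ { (_ , halt , _) mv → halt (_ , proj₁ (proj₂ (move-first mv))) }) q₀)

  module _ {t : Tr} {ρ : Fin 0 → Nd t} where

    chain⇒steps : ∀ {p u v} → Chain Moves₀ Accepting ρ p u v →
      Σ Q λ pₑ → pₑ ∈ₛ acc × Star _⟶_ (p , u , []) (pₑ , roots , []) × Halting Sig 𝒜 (pₑ , roots {t} , [])
    chain⇒steps {u = u} (stop (a , halt , at , refl)) with atRoots⇒roots u at
    ... | refl = _ , a , ε , halt
    chain⇒steps (mv ∷ c) with chain⇒steps c
    ... | pₑ , a , r , halt = pₑ , a , move-steps mv ◅◅ r , halt

    moves⇒chain : ∀ {pₑ} → pₑ ∈ₛ acc → Halting Sig 𝒜 (pₑ , roots {t} , []) →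
      ∀ {p u} → Star (λ (p , u) (q , v) → Move [] p u q v) (p , u) (pₑ , roots) →
      Chain Moves₀ Accepting ρ p u roots
    moves⇒chain a halt ε = stop (a , halt , roots-atRoots , refl)
    moves⇒chain a halt (mv ◅ r) = mv ∷ moves⇒chain a halt r

  automaton⇒formula : Σ (Formula Sig k 0) λ φ → IsDTC Sig φ × (∀ t → φ ⊢ t , (λ ()) ⇔ Accepts Sig 𝒜 t)
  automaton⇒formula = formula d , isDTC d , λ t → ⇔-trans (correct d t λ ()) (mk⇔ accepts describes)
    where
    -- The formula has to be closed, so both tuples are quantified; `Acceptance` forces each of them
    -- to consist of roots.
    d : Def 0 λ t ρ → Σ (V t) λ v → Σ (V t) λ u → Acceptance t u v ρ
    d = def-cong
      (λ t ρ → mk⇔ (λ h → proj₁ h , proj₁ (proj₂ h) ,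
        to (def₂⇒def-correct def₂-acceptance t (proj₁ (proj₂ h)) (proj₁ h) ρ) (proj₂ (proj₂ h)))
                   (λ h → proj₁ h , proj₁ (proj₂ h) ,
        from (def₂⇒def-correct def₂-acceptance t (proj₁ (proj₂ h)) (proj₁ h) ρ) (proj₂ (proj₂ h))))
      (def-∃Vec k (def-∃Vec k (def₂⇒def def₂-acceptance)))
    accepts : ∀ {t} {ρ : Fin 0 → Nd t} → (Σ (V t) λ v → Σ (V t) λ u → Acceptance t u v ρ) → Accepts Sig 𝒜 t
    accepts (v , u , at , c) with atRoots⇒roots u at
    ... | refl = chain⇒steps c
    describes : ∀ {t} {ρ : Fin 0 → Nd t} → Accepts Sig 𝒜 t → Σ (V t) λ v → Σ (V t) λ u → Acceptance t u v ρ
    describes (pₑ , a , r , halt) =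
      roots , roots , roots-atRoots , moves⇒chain a halt (moves-complete (len r) r ≤-refl)

theorem5p3 : (Sig : RankedAlphabet) (k : ℕ) → k ≥ 1 → (L : Language Sig) →
    DPTWA-definable Sig k L ⇔ FODTC-definable Sig k L
theorem5p3 Sig (suc k′) _ L = mk⇔
  (λ (𝒜 , det , e) → let (φ , d , e′) = Descriptions.automaton⇒formula Sig k′ 𝒜 det
                     in φ , d , λ t → ⇔-trans (e t) (⇔-sym (e′ t)))
  (λ (φ , d , e) → let (𝒜 , det , e′) = Evaluators.formula⇒automaton Sig k′ φ d
                   in 𝒜 , det , λ t → ⇔-trans (e t) (e′ t))
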